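{- Let $B(n)=\binom{\lfloor (n-2)/2\rfloor}{2}+\binom{\lceil (n-2)/2\rceil}{2}$. There exists an integer $n_0$ such that for every $n\ge n_0$, $$g(n,P_3,P_4)=B(n).$$
   Context: $P_r$ denotes the path on $r$ vertices. For fixed graphs $H$ and $F$, the Constructor–Blocker game is played on the edge set of $K_n$: Constructor and Blocker alternately claim previously unclaimed edges, Constructor moving first. Constructor may only claim an edge if after claiming it his graph (all edges he has claimed) contains no copy of $F$ as a subgraph; Blocker may claim any unclaimed edge. The game ends when Constructor cannot claim a further edge or all edges are claimed. The score is the number of copies of $H$ (as subgraphs) all of whose edges were claimed by Constructor. Constructor maximizes, Blocker minimizes the score; $g(n,H,F)$ is the score under optimal play by both players. -}

module Defs where

open import Data.Bool using (Bool; true; false; _∧_; _∨_; not; if_then_else_)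
open import Data.Nat using (ℕ; zero; suc; _∸_; _⊔_; _⊓_; _<ᵇ_)
open import Data.Nat.DivMod using (_/_)
open import Data.Nat.Combinatorics using (_C_)
open import Data.Fin using (Fin; toℕ; _≟_)
open import Data.Fin.Properties using ()
open import Data.List using (List; []; _∷_; length; filter; concatMap; map; allFin; foldr)
open import Data.Bool.ListAction using (any)
open import Data.Product using (_×_; _,_; proj₁; proj₂)
open import Relation.Nullary.Decidable using (⌊_⌋)

-- Vertices of K_n are Fin n; an edge {i,j} is stored as the pair (i , j) with i < j.
Edge : ℕ → Set
Edge n = Fin n × Fin n

_==_ : ∀ {n} → Fin n → Fin n → Bool
a == b = ⌊ a ≟ b ⌋

allEdges : (n : ℕ) → List (Edge n)
allEdges n = concatMap (λ i → map (λ j → (i , j)) (filter (λ j → toℕ i Data.Nat.<? toℕ j) (allFin n))) (allFin n)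

-- number of copies of P_3 in a (duplicate-free) edge list: unordered pairs of
-- distinct edges sharing a vertex (two distinct edges of a simple graph share at most one vertex)
sharesVertex : ∀ {n} → Edge n → Edge n → Bool
sharesVertex (a , b) (c , d) = (a == c) ∨ (a == d) ∨ (b == c) ∨ (b == d)

countP3 : ∀ {n} → List (Edge n) → ℕ
countP3 [] = 0
countP3 (e ∷ es) = length (filter (λ f → Data.Bool.T? (sharesVertex e f)) es) Data.Nat.+ countP3 es

orient : ∀ {n} → Edge n → List (Fin n × Fin n)
orient (x , y) = (x , y) ∷ (y , x) ∷ []

distinct4 : ∀ {n} → Fin n → Fin n → Fin n → Fin n → Bool
distinct4 a b c d = not ((a == b) ∨ (a == c) ∨ (a == d) ∨ (b == c) ∨ (b == d) ∨ (c == d))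

pathOriented : ∀ {n} → Fin n × Fin n → Fin n × Fin n → Fin n × Fin n → Bool
pathOriented (a , b) (b' , c) (c' , d) = (b == b') ∧ (c == c') ∧ distinct4 a b c d

formsP4 : ∀ {n} → Edge n → Edge n → Edge n → Bool
formsP4 e₁ e₂ e₃ =
  any (λ o₁ → any (λ o₂ → any (λ o₃ → pathOriented o₁ o₂ o₃) (orient e₃)) (orient e₂)) (orient e₁)

hasP4 : ∀ {n} → List (Edge n) → Bool
hasP4 G = any (λ e₁ → any (λ e₂ → any (λ e₃ → formsP4 e₁ e₂ e₃) G) G) G

picks : ∀ {A : Set} → List A → List (A × List A)
picks [] = []
picks (x ∷ xs) = (x , xs) ∷ map (λ p → proj₁ p , x ∷ proj₂ p) (picks xs)

maxList : List ℕ → ℕ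
maxList = foldr _⊔_ 0

-- minimum of a nonempty list (0 for the empty list, never used)
minList : List ℕ → ℕ
minList [] = 0
minList (x ∷ xs) = foldr _⊓_ x xs

data Player : Set where
  constructor′ blocker : Player

-- value of the Constructor–Blocker game (H = P_3, F = P_4) under optimal play.
-- State: player to move, list of unclaimed edges, Constructor's edges.
-- (Blocker's edges matter only by being removed from the unclaimed list.)
-- The game ends when all edges are claimed or Constructor has no legal edge
-- (Blocker's moves can never create a legal Constructor move again).
-- fuel = number of unclaimed edges, decreases by one per move.
value : ∀ {n} → ℕ → Player → List (Edge n) → List (Edge n) → ℕ
value zero _ _ C = countP3 C
value (suc k) p avail C with picks avail | filter (λ q → Data.Bool.T? (not (hasP4 (proj₁ q ∷ C)))) (picks avail)
... | _ | [] = countP3 C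
... | moves | legal@(_ ∷ _) with p
...   | constructor′ = maxList (map (λ q → value k blocker (proj₂ q) (proj₁ q ∷ C)) legal)
...   | blocker = minList (map (λ q → value k constructor′ (proj₂ q) C) moves)

g : ℕ → ℕ
g n = value (length (allEdges n)) constructor′ (allEdges n) []

B : ℕ → ℕ
B n = (((n ∸ 2) / 2) C 2) Data.Nat.+ (((n ∸ 2) ∸ ((n ∸ 2) / 2)) C 2)

{-# OPTIONS --safe #-}
module Submission where

-- A P₄-free graph is a disjoint union of stars and triangles, and its score is the sum of C(deg v, 2).
--
-- Lower bound.  Constructor fixes two centres u, v and joins every other vertex to one of them: whenever Blocker
-- claims u x he answers v x, and conversely.  The two stars have n − 2 leaves in total, so convexity gives B(n).
--
-- Upper bound.  Let φ(w) be twice the degree of w plus the number of available edges from w to isolated vertices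
-- of Constructor's graph.  Answering at the centre of the star just enlarged, Blocker keeps φ ≤ n + O(1), so every
-- star has at most n/2 + O(1) leaves.  Then the score can exceed B(n) only if the final graph consists of exactly
-- two spanning stars, for one missing vertex already costs about n/2.  A pair {p, q} is dead once some vertex can
-- no longer be a leaf of p or q, or p or q can no longer be a centre.  While Constructor builds a single star at u,
-- Blocker answers at u; when a disjoint edge c d appears, only {u, c} and {u, d} are alive, and claiming edges at a
-- vertex barred from u kills one of them.  If the last live pair is {u, v}, Blocker claims edges from the larger
-- star to untouched vertices x: Constructor must reply at the other centre or x is lost, so the stars end balanced.

open import Defs
open import Data.Bool using (T; T?; true; false; not; if_then_else_)
open import Data.Bool.ListAction using (any)
open import Data.Bool.Properties using (T-∧)
open import Data.Empty using (⊥; ⊥-elim)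
open import Data.Fin using (Fin; zero; suc; _≟_; toℕ)
open import Data.Fin.Properties using (any?; all?; toℕ-injective)
open import Data.List using (List; []; _∷_; _++_; length; filter; map; foldr; concatMap; allFin)
open import Data.List.Membership.Propositional using (_∈_; lose; find)
open import Data.List.Membership.Propositional.Properties
  using (∈-map⁺; ∈-map⁻; ∈-filter⁺; ∈-filter⁻; ∈-concatMap⁺; ∈-concatMap⁻; ∈-allFin; ∈-++⁺ˡ; ∈-++⁺ʳ)
open import Data.List.Properties using (++-identityʳ)
open import Data.List.Relation.Binary.Permutation.Propositional
  using (_↭_; ↭-refl; ↭-sym; ↭-trans; prep; swap; ↭⇒↭ₛ)
open import Data.List.Relation.Binary.Permutation.Propositional.Properties
  using (All-resp-↭; ∈-resp-↭; ↭-length; shift; ++⁺ʳ)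
import Data.List.Relation.Binary.Permutation.Setoid.Properties as Permutationₛ
open import Data.List.Relation.Unary.All as All using (All; []; _∷_)
open import Data.List.Relation.Unary.AllPairs using ([]; _∷_)
open import Data.List.Relation.Unary.Any using (here; there)
open import Data.List.Relation.Unary.Any.Properties using (any⁺; any⁻)
open import Data.List.Relation.Unary.Unique.Propositional using (Unique)
import Data.List.Relation.Unary.Unique.Propositional.Properties as Unique
open import Data.Nat
  using (ℕ; zero; suc; _+_; _*_; _∸_; _≤_; _<_; z≤n; s≤s; _≤?_; _<?_; _⊓_; ⌊_/2⌋; ⌈_/2⌉)
open import Data.Nat.Combinatorics using (nC1≡n; nCk+nC[k+1]≡[n+1]C[k+1]) renaming (_C_ to _choose_)
open import Data.Nat.DivMod using (_/_; _%_; m≡m%n+[m/n]*n; m%n<n)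
open import Data.Nat.Properties hiding (_≟_)
open import Data.Nat.Tactic.RingSolver using (solve-∀)
open import Data.Product using (∃; _×_; _,_; proj₁; proj₂)
open import Data.Product.Properties using (≡-dec)
open import Data.Sum using (_⊎_; inj₁; inj₂; [_,_]′) renaming (swap to ⊎-swap; map to ⊎-map)
open import Function using (_∘_; id; Equivalence)
open import Relation.Binary using (tri<; tri≈; tri>)
open import Relation.Binary.PropositionalEquality
open import Relation.Nullary using (¬_; Dec; yes; no; does; contradiction)
open import Relation.Nullary.Decidable using (_×-dec_; _⊎-dec_; ¬?; toWitness; decidable-stable)
open import Relation.Unary using (Decidable)
open import Algebra.Properties.Semiring.Sum +-*-semiring
  using (sum; sum-cong-≗; ∑-distrib-+; ∑-comm; *-distribʳ-sum)

-- The potential alone bounds every star only up to an additive constant, which cannot give an exact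
-- value. Exactness is rescued by a comparison of orders: when two stars have q and q + s leaves,
-- the imbalance gains only about `s * s` with `s` below a constant `S`, whereas one vertex outside
-- both costs an amount linear in q. Hence `S * S + S ≤ m` settles every position in which some
-- vertex is missed, and exact balance matters only when two stars span. This condition also
-- dictates the size of the final threshold. The game may stop at any moment, so each step of
-- Blocker's strategy must bound the current score as well; his strategy statements therefore hold
-- for every amount of fuel, and certificates of death are chosen to survive all later moves. All
-- scores are doubled: they become sums of `tri (deg v)` and are compared with the polynomial
-- benchmark `m * m ≤ 2 * (2 * B (2 + m)) + 2 * m`.

linear : ∀ t {x y a b} → a ≤ b → x + t ≡ a → b ≡ y + t → x ≤ y
-- The ring solver proves equations only; an inequality is therefore fed in as `a ≤ b`, and both
-- sides are rearranged by ring identities that share the cancelled term `t`.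
linear t {x} {y} a≤b refl refl = +-cancelʳ-≤ t x y a≤b

sum-mono : ∀ {n} {f g : Fin n → ℕ} → (∀ x → f x ≤ g x) → sum f ≤ sum g
sum-mono {zero}  h = z≤n
sum-mono {suc n} h = +-mono-≤ (h zero) (sum-mono (h ∘ suc))

sum-const : ∀ n c → sum {n} (λ _ → c) ≡ n * c
sum-const zero    c = refl
sum-const (suc n) c = cong (c +_) (sum-const n c)

-- Counting vertices

⟦_⟧ : {P : Set} → Dec P → ℕ
⟦ d ⟧ = if does d then 1 else 0

⟦⟧-yes : {P : Set} (d : Dec P) → P → ⟦ d ⟧ ≡ 1
⟦⟧-yes (yes _) p = refl
⟦⟧-yes (no ¬p) p = contradiction p ¬p

⟦⟧-no : {P : Set} (d : Dec P) → ¬ P → ⟦ d ⟧ ≡ 0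
⟦⟧-no (yes p) ¬p = contradiction p ¬p
⟦⟧-no (no _)  ¬p = refl

sum-point : ∀ {n} (a : Fin n) (f : Fin n → ℕ) → sum (λ x → ⟦ x ≟ a ⟧ * f x) ≡ f a
sum-point {suc n} zero f = trans (cong₂ _+_ (+-identityʳ (f zero)) (trans (sum-const n 0) (*-zeroʳ n)))
                                 (+-identityʳ (f zero))
sum-point {suc n} (suc a) f = trans (sum-cong-≗ {n} (λ x → cong (_* f (suc x)) (lem x))) (sum-point a (f ∘ suc))
  where
  lem : ∀ x → ⟦ suc x ≟ suc a ⟧ ≡ ⟦ x ≟ a ⟧
  lem x with x ≟ a
  ... | yes _ = refl
  ... | no _ = refl

module _ {n : ℕ} where

  # : {P : Fin n → Set} → Decidable P → ℕ
  # P? = sum (λ x → ⟦ P? x ⟧)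

  module _ {P Q : Fin n → Set} (P? : Decidable P) (Q? : Decidable Q) where

    #-mono : (∀ {x} → P x → Q x) → # P? ≤ # Q?
    #-mono h = sum-mono pt
      where
      pt : ∀ x → ⟦ P? x ⟧ ≤ ⟦ Q? x ⟧
      pt x with P? x | Q? x
      ... | no _  | _     = z≤n
      ... | yes _ | yes _ = ≤-refl
      ... | yes p | no ¬q = contradiction (h p) ¬q

    module _ {R : Fin n → Set} (R? : Decidable R) where

      #-cover : (∀ {x} → R x → P x ⊎ Q x) → # R? ≤ # P? + # Q?
      #-cover h = ≤-trans (sum-mono pt) (≤-reflexive (∑-distrib-+ {n} _ _))
        where
        pt : ∀ x → ⟦ R? x ⟧ ≤ ⟦ P? x ⟧ + ⟦ Q? x ⟧
        pt x with R? x | P? x | Q? x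
        ... | no _  | _     | _     = z≤n
        ... | yes _ | yes _ | _     = s≤s z≤n
        ... | yes _ | no _  | yes _ = ≤-refl
        ... | yes r | no ¬p | no ¬q = ⊥-elim ([ ¬p , ¬q ]′ (h r))

      #-disjoint : (∀ {x} → P x → ¬ Q x) → (∀ {x} → P x → R x) → (∀ {x} → Q x → R x) →
                   # P? + # Q? ≤ # R?
      #-disjoint d f g = ≤-trans (≤-reflexive (sym (∑-distrib-+ {n} _ _))) (sum-mono pt)
        where
        pt : ∀ x → ⟦ P? x ⟧ + ⟦ Q? x ⟧ ≤ ⟦ R? x ⟧
        pt x with P? x | Q? x | R? x
        ... | no _  | no _  | _     = z≤n
        ... | no _  | yes _ | yes _ = ≤-refl
        ... | no _  | yes q | no ¬r = contradiction (g q) ¬r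
        ... | yes _ | no _  | yes _ = ≤-refl
        ... | yes p | no _  | no ¬r = contradiction (f p) ¬r
        ... | yes p | yes q | _     = contradiction q (d p)

    #-disjoint-n : (∀ {x} → P x → ¬ Q x) → # P? + # Q? ≤ n
    #-disjoint-n d = ≤-trans (≤-reflexive (sym (∑-distrib-+ {n} _ _)))
      (≤-trans (sum-mono pt) (≤-reflexive (trans (sum-const n 1) (*-identityʳ n))))
      where
      pt : ∀ x → ⟦ P? x ⟧ + ⟦ Q? x ⟧ ≤ 1
      pt x with P? x | Q? x
      ... | no _  | no _  = z≤n
      ... | no _  | yes _ = ≤-refl
      ... | yes _ | no _  = ≤-refl
      ... | yes p | yes q = contradiction q (d p)

    #-cover-n : (∀ x → P x ⊎ Q x) → n ≤ # P? + # Q?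
    #-cover-n h = ≤-trans (≤-reflexive (sym (trans (sum-const n 1) (*-identityʳ n))))
      (≤-trans (sum-mono pt) (≤-reflexive (∑-distrib-+ {n} _ _)))
      where
      pt : ∀ x → 1 ≤ ⟦ P? x ⟧ + ⟦ Q? x ⟧
      pt x with P? x | Q? x | h x
      ... | yes _ | _     | _      = s≤s z≤n
      ... | no _  | yes _ | _      = ≤-refl
      ... | no ¬p | no _  | inj₁ p = contradiction p ¬p
      ... | no _  | no ¬q | inj₂ q = contradiction q ¬q

  module _ {P : Fin n → Set} (P? : Decidable P) where

    #-empty : (∀ x → ¬ P x) → # P? ≡ 0
    #-empty h = trans (sum-cong-≗ {n} (λ x → ⟦⟧-no (P? x) (h x))) (trans (sum-const n 0) (*-zeroʳ n))

    #≤n : # P? ≤ n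
    #≤n = ≤-trans (sum-mono pt) (≤-reflexive (trans (sum-const n 1) (*-identityʳ n)))
      where
      pt : ∀ x → ⟦ P? x ⟧ ≤ 1
      pt x with P? x
      ... | yes _ = ≤-refl
      ... | no _  = z≤n

  #-point : ∀ a → # (_≟ a) ≡ 1
  #-point a = trans (sum-cong-≗ {n} (λ x → sym (*-identityʳ ⟦ x ≟ a ⟧))) (sum-point a (λ _ → 1))

  module _ {P : Fin n → Set} (P? : Decidable P) where

    #≥1 : ∀ {x} → P x → 1 ≤ # P?
    #≥1 {x} px = subst (_≤ # P?) (#-point x) (#-mono (_≟ x) P? (λ { refl → px }))

    #-inhabited : 1 ≤ # P? → ∃ P
    #-inhabited h with any? P?
    ... | yes e = e
    ... | no ¬e = contradiction (subst (1 ≤_) (#-empty P? (λ x px → ¬e (x , px))) h) (λ ())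

    #≤1⊎pair : # P? ≤ 1 ⊎ (∃ λ x → ∃ λ y → P x × P y × y ≢ x)
    #≤1⊎pair with any? P?
    ... | no ¬e = inj₁ (≤-trans (≤-reflexive (#-empty P? (λ x px → ¬e (x , px)))) z≤n)
    ... | yes (x , px) with any? (λ y → P? y ×-dec ¬? (y ≟ x))
    ...   | yes (y , py , y≢x) = inj₂ (x , y , px , py , y≢x)
    ...   | no ¬e = inj₁ (≤-trans (#-mono P? (_≟ x) eq) (≤-reflexive (#-point x)))
      where
      eq : ∀ {y} → P y → y ≡ x
      eq {y} py with y ≟ x
      ... | yes e = e
      ... | no y≢x = contradiction (y , py , y≢x) ¬e

-- The game tree and edge lists

module _ {A : Set} where

  picks-↭ : ∀ {xs : List A} {q} → q ∈ picks xs → xs ↭ proj₁ q ∷ proj₂ q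
  picks-↭ {x ∷ xs} (here refl) = ↭-refl
  picks-↭ {x ∷ xs} (there q∈) with ∈-map⁻ _ q∈
  ... | q′ , q′∈ , refl = ↭-trans (prep x (picks-↭ q′∈)) (swap x _ ↭-refl)

  ∈-picks : ∀ {x} {xs : List A} → x ∈ xs → ∃ λ ys → (x , ys) ∈ picks xs
  ∈-picks (here refl) = _ , here refl
  ∈-picks (there x∈) with ∈-picks x∈
  ... | ys , q∈ = _ , there (∈-map⁺ _ q∈)

≤maxList : ∀ {x xs} → x ∈ xs → x ≤ maxList xs
≤maxList (here refl) = m≤m⊔n _ _
≤maxList {xs = y ∷ ys} (there x∈) = ≤-trans (≤maxList x∈) (m≤n⊔m y _)

maxList≤ : ∀ {b} xs → (∀ {x} → x ∈ xs → x ≤ b) → maxList xs ≤ b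
maxList≤ []       h = z≤n
maxList≤ (x ∷ xs) h = ⊔-lub (h (here refl)) (maxList≤ xs (h ∘ there))

minList≤ : ∀ {x xs} → x ∈ xs → minList xs ≤ x
minList≤ {xs = y ∷ ys} = go y ys
  where
  go : ∀ y ys {x} → x ∈ y ∷ ys → foldr _⊓_ y ys ≤ x
  go y []       (here refl)         = ≤-refl
  go y (z ∷ zs) (here refl)         = ≤-trans (m⊓n≤n z _) (go y zs (here refl))
  go y (z ∷ zs) (there (here refl)) = m⊓n≤m z _
  go y (z ∷ zs) (there (there x∈))  = ≤-trans (m⊓n≤n z _) (go y zs (there x∈))

≤minList : ∀ {b x xs} → x ∈ xs → (∀ {y} → y ∈ xs → b ≤ y) → b ≤ minList xs
≤minList {xs = y ∷ ys} _ h = go ys h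
  where
  go : ∀ {b} ys → (∀ {z} → z ∈ y ∷ ys → b ≤ z) → b ≤ foldr _⊓_ y ys
  go []       h = h (here refl)
  go (z ∷ zs) h = ⊓-glb (h (there (here refl))) (go zs (λ { (here e) → h (here e) ; (there i) → h (there (there i)) }))

Graph : ℕ → Set
Graph n = List (Edge n)

-- Twice `d choose 2`, which keeps division out of all estimates.
tri : ℕ → ℕ
tri d = d * (d ∸ 1)

tri-suc : ∀ d → tri (suc d) ≡ tri d + 2 * d
tri-suc zero    = refl
tri-suc (suc d) = lem d
  where
  lem : ∀ d → suc (suc d) * suc d ≡ suc d * d + 2 * suc d
  lem = solve-∀

module _ {n : ℕ} where

  Legal : Graph n → Edge n × Graph n → Set
  Legal C q = T (not (hasP4 (proj₁ q ∷ C)))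

  -- The last premise covers a stop on Blocker's turn: when Constructor has no legal edge, the value
  -- is the current score whatever edges remain.
  value-blocker≤ : ∀ {b} k {A C : Graph n} {q} → q ∈ picks A → value k constructor′ (proj₂ q) C ≤ b →
                   countP3 C ≤ b → value (suc k) blocker A C ≤ b
  value-blocker≤ k {A} {C} q∈ v≤b c≤b
    with filter (λ q → T? (not (hasP4 (proj₁ q ∷ C)))) (picks A)
  ... | []    = c≤b
  ... | _ ∷ _ = ≤-trans (minList≤ (∈-map⁺ (λ q → value k constructor′ (proj₂ q) C) q∈)) v≤b

  value-constructor≤ : ∀ {b} k {A C : Graph n} → countP3 C ≤ b →
    (∀ {q} → q ∈ picks A → Legal C q → value k blocker (proj₂ q) (proj₁ q ∷ C) ≤ b) →
    value (suc k) constructor′ A C ≤ b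
  value-constructor≤ k {A} {C} c≤b h
    with filter (λ q → T? (not (hasP4 (proj₁ q ∷ C)))) (picks A)
       | (λ {q} → ∈-filter⁻ (λ q → T? (not (hasP4 (proj₁ q ∷ C)))) {q} {picks A})
  ... | []     | _  = c≤b
  ... | l ∷ ls | mem = maxList≤ _ bound
    where
    bound : ∀ {x} → x ∈ map (λ q → value k blocker (proj₂ q) (proj₁ q ∷ C)) (l ∷ ls) → x ≤ _
    bound x∈ with ∈-map⁻ _ x∈
    ... | q , q∈ , refl with mem q∈
    ...   | q∈A , legal = h q∈A legal

  value-constructor≥ : ∀ k {A C : Graph n} {q} → q ∈ picks A → Legal C q →
    value k blocker (proj₂ q) (proj₁ q ∷ C) ≤ value (suc k) constructor′ A C
  value-constructor≥ k {A} {C} {q} q∈ legal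
    with filter (λ q → T? (not (hasP4 (proj₁ q ∷ C)))) (picks A)
       | ∈-filter⁺ (λ q → T? (not (hasP4 (proj₁ q ∷ C)))) q∈ legal
  ... | l ∷ ls | q∈′ = ≤maxList (∈-map⁺ (λ q → value k blocker (proj₂ q) (proj₁ q ∷ C)) q∈′)

  value-blocker≥ : ∀ {b} k {A C : Graph n} → ((∀ {q} → q ∈ picks A → ¬ Legal C q) → b ≤ countP3 C) →
    (∀ {q} → q ∈ picks A → b ≤ value k constructor′ (proj₂ q) C) → b ≤ value (suc k) blocker A C
  value-blocker≥ k {A} {C} c≥b h
    with filter (λ q → T? (not (hasP4 (proj₁ q ∷ C)))) (picks A)
       | (λ {q} → ∈-filter⁻ (λ q → T? (not (hasP4 (proj₁ q ∷ C)))) {q} {picks A})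
       | (λ {q} → ∈-filter⁺ (λ q → T? (not (hasP4 (proj₁ q ∷ C)))) {q} {picks A})
  ... | []     | _   | mem⁺ = c≥b (λ q∈ legal → contradiction (mem⁺ q∈ legal) (λ ()))
  ... | l ∷ ls | mem | _ =
    ≤minList (∈-map⁺ (λ q → value k constructor′ (proj₂ q) C) (proj₁ (mem (here refl)))) bound
    where
    bound : ∀ {x} → x ∈ map (λ q → value k constructor′ (proj₂ q) C) (picks A) → _ ≤ x
    bound x∈ with ∈-map⁻ _ x∈
    ... | q , q∈ , refl = h q∈

  -- Constructor's graph only grows, so a score once reached is kept under any play.
  countP3≤value : ∀ k p {A C : Graph n} → countP3 C ≤ value k p A C
  countP3≤value zero    p = ≤-refl
  countP3≤value (suc k) blocker {A} {C} = value-blocker≥ k {A} {C} (λ _ → ≤-refl) (λ _ → countP3≤value k constructor′ {_} {C})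
  countP3≤value (suc k) constructor′ {A} {C}
    with filter (λ q → T? (not (hasP4 (proj₁ q ∷ C)))) (picks A)
  ... | [] = ≤-refl
  ... | q ∷ _ = ≤-trans (m≤n+m (countP3 C) _)
    (≤-trans (countP3≤value k blocker {proj₂ q} {proj₁ q ∷ C}) (m≤m⊔n _ _))

  -- Adjacency, simple edge lists and single moves

  Adj : Graph n → Fin n → Fin n → Set
  Adj G x y = (x , y) ∈ G ⊎ (y , x) ∈ G

  abstract
    adj? : ∀ G x → Decidable (Adj G x)
    adj? G x y = ((x , y) ∈? G) ⊎-dec ((y , x) ∈? G)
      where open import Data.List.Membership.DecPropositional (≡-dec _≟_ _≟_) using (_∈?_)

  adj-sym : ∀ {G x y} → Adj G x y → Adj G y x
  adj-sym = ⊎-swap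

  Same : Fin n → Fin n → Fin n → Fin n → Set
  Same a b x y = (x ≡ a × y ≡ b) ⊎ (x ≡ b × y ≡ a)

  adj-∷ : ∀ {a b G x y} → Adj G x y → Adj ((a , b) ∷ G) x y
  adj-∷ = ⊎-map there there

  adj-new : ∀ {a b} {G : Graph n} → Adj ((a , b) ∷ G) a b
  adj-new = inj₁ (here refl)

  adj-∷⁻ : ∀ {a b G x y} → Adj ((a , b) ∷ G) x y → Same a b x y ⊎ Adj G x y
  adj-∷⁻ (inj₁ (here refl)) = inj₁ (inj₁ (refl , refl))
  adj-∷⁻ (inj₁ (there e))   = inj₂ (inj₁ e)
  adj-∷⁻ (inj₂ (here refl)) = inj₁ (inj₂ (refl , refl))
  adj-∷⁻ (inj₂ (there e))   = inj₂ (inj₂ e)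

  same-adj : ∀ {G a b x y} → Same a b x y → Adj G x y → Adj G a b
  same-adj (inj₁ (refl , refl)) e = e
  same-adj (inj₂ (refl , refl)) e = adj-sym e

  Ordered : Edge n → Set
  Ordered (i , j) = toℕ i < toℕ j

  -- Ordered pairs rule out loops and, with uniqueness, reversed duplicates. Imposed on `A ++ C`,
  -- the condition also keeps available and claimed edges disjoint.
  Simple : Graph n → Set
  Simple G = All Ordered G × Unique G

  simple-↭ : ∀ {G H} → G ↭ H → Simple G → Simple H
  simple-↭ p (o , u) = All-resp-↭ p o ,
    Permutationₛ.Unique-resp-↭ (setoid (Edge n)) (↭⇒↭ₛ p) u

  simple-tail : ∀ {e G} → Simple (e ∷ G) → Simple G
  simple-tail (_ ∷ o , _ ∷ u) = o , u

  simple-++ʳ : ∀ A {C} → Simple (A ++ C) → Simple C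
  simple-++ʳ []      s = s
  simple-++ʳ (e ∷ A) s = simple-++ʳ A (simple-tail s)

  adj-irrefl : ∀ {G x} → Simple G → ¬ Adj G x x
  adj-irrefl (o , _) (inj₁ e) = <-irrefl refl (All.lookup o e)
  adj-irrefl (o , _) (inj₂ e) = <-irrefl refl (All.lookup o e)

  adj⇒≢ : ∀ {G x y} → Simple G → Adj G x y → x ≢ y
  adj⇒≢ s e refl = adj-irrefl s e

  simple-fresh : ∀ {a b G} → Simple ((a , b) ∷ G) → ¬ Adj G a b
  simple-fresh (_ , u ∷ _) (inj₁ e) = All.lookup u e refl
  simple-fresh (o ∷ os , _) (inj₂ e) = <-asym o (All.lookup os e)

  simple-disjoint : ∀ A {C x y} → Simple (A ++ C) → Adj A x y → ¬ Adj C x y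
  simple-disjoint []            s (inj₁ ())
  simple-disjoint []            s (inj₂ ())
  simple-disjoint ((a , b) ∷ A) {C} s e f with adj-∷⁻ {G = A} e
  ... | inj₂ e′ = simple-disjoint A (simple-tail s) e′ f
  ... | inj₁ q  = simple-fresh s (same-adj q (⊎-map (∈-++⁺ʳ A) (∈-++⁺ʳ A) f))

  -- A move seen through symmetric adjacency, so that neither the place of the edge in the list nor
  -- its orientation matters to the strategies.
  record Take (a b : Fin n) (A A′ : Graph n) : Set where
    field
      was  : Adj A a b
      sub  : ∀ {x y} → Adj A′ x y → Adj A x y
      gone : ¬ Adj A′ a b
      rest : ∀ {x y} → Adj A x y → Same a b x y ⊎ Adj A′ x y

  module _ {a b : Fin n} {A A′ C : Graph n} (s : Simple (A ++ C)) (p : A ↭ (a , b) ∷ A′) where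

    private s′ : Simple ((a , b) ∷ A′ ++ C)
            s′ = simple-↭ (++⁺ʳ C p) s

    take-constructor : Simple (A′ ++ (a , b) ∷ C)
    take-constructor = simple-↭ (↭-sym (shift (a , b) A′ C)) s′

    take-blocker : Simple (A′ ++ C)
    take-blocker = simple-tail s′

    take : Take a b A A′
    take = record
      { was  = inj₁ (∈-resp-↭ (↭-sym p) (here refl))
      ; sub  = ⊎-map (∈-resp-↭ (↭-sym p) ∘ there) (∈-resp-↭ (↭-sym p) ∘ there)
      ; gone = λ e → simple-fresh s′ (⊎-map ∈-++⁺ˡ ∈-++⁺ˡ e)
      ; rest = λ e → adj-∷⁻ (⊎-map (∈-resp-↭ p) (∈-resp-↭ p) e)
      }

  take-flip : ∀ {a b A A′} → Take a b A A′ → Take b a A A′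
  take-flip t = record { was = adj-sym t.was ; sub = t.sub ; gone = t.gone ∘ adj-sym
    ; rest = λ e → ⊎-map ⊎-swap id (t.rest e) }
    where module t = Take t

  -- P₄-freeness and the Boolean legality test

  P4free : Graph n → Set
  P4free G = ∀ {a b c d} → Adj G a b → Adj G b c → Adj G c d → a ≢ c → b ≢ d → a ≢ d → ⊥

  adj-orient : ∀ {G x y} → Adj G x y → ∃ λ e → e ∈ G × (x , y) ∈ orient e
  adj-orient (inj₁ e) = _ , e , here refl
  adj-orient (inj₂ e) = _ , e , there (here refl)

  orient-adj : ∀ {G e x y} → e ∈ G → (x , y) ∈ orient e → Adj G x y
  orient-adj e∈ (here refl)         = inj₁ e∈
  orient-adj e∈ (there (here refl)) = inj₂ e∈

  ==-refl : ∀ (x : Fin n) → T (x == x)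
  ==-refl x with x ≟ x
  ... | yes _ = _
  ... | no ¬e = contradiction refl ¬e

  distinct4⁺ : ∀ {a b c d : Fin n} → a ≢ b → a ≢ c → a ≢ d → b ≢ c → b ≢ d → c ≢ d → T (distinct4 a b c d)
  distinct4⁺ {a} {b} {c} {d} ab ac ad bc bd cd with a ≟ b | a ≟ c | a ≟ d | b ≟ c | b ≟ d | c ≟ d
  ... | no _  | no _  | no _  | no _  | no _  | no _  = _
  ... | yes e | _     | _     | _     | _     | _     = ab e
  ... | no _  | yes e | _     | _     | _     | _     = ac e
  ... | no _  | no _  | yes e | _     | _     | _     = ad e
  ... | no _  | no _  | no _  | yes e | _     | _     = bc e
  ... | no _  | no _  | no _  | no _  | yes e | _     = bd e
  ... | no _  | no _  | no _  | no _  | no _  | yes e = cd e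

  distinct4⁻ : ∀ {a b c d : Fin n} → T (distinct4 a b c d) → a ≢ c × b ≢ d × a ≢ d
  distinct4⁻ {a} {b} {c} {d} t with a ≟ b | a ≟ c | a ≟ d | b ≟ c | b ≟ d | c ≟ d
  ... | no _ | no ac | no ad | no _ | no bd | no _ = ac , bd , ad

  hasP4⁺ : ∀ {G a b c d} → Simple G → Adj G a b → Adj G b c → Adj G c d → a ≢ c → b ≢ d → a ≢ d → T (hasP4 G)
  hasP4⁺ {a = a} {b} {c} {d} s ab bc cd a≢c b≢d a≢d with adj-orient ab | adj-orient bc | adj-orient cd
  ... | e₁ , e₁∈ , o₁ | e₂ , e₂∈ , o₂ | e₃ , e₃∈ , o₃ =
    any⁺ _ (lose e₁∈ (any⁺ _ (lose e₂∈ (any⁺ _ (lose e₃∈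
      (any⁺ (λ p → any (λ q → any (pathOriented p q) (orient e₃)) (orient e₂))
        (lose o₁ (any⁺ (λ q → any (pathOriented (a , b) q) (orient e₃))
          (lose o₂ (any⁺ (pathOriented (a , b) (b , c)) (lose o₃ path)))))))))))
    where
    -- The inequations between consecutive vertices, which `P4free` does not list, come from
    -- simplicity.
    path : T (pathOriented (a , b) (b , c) (c , d))
    path = Equivalence.from T-∧ (==-refl b , Equivalence.from T-∧ (==-refl c ,
      distinct4⁺ (adj⇒≢ s ab) a≢c a≢d (adj⇒≢ s bc) b≢d (adj⇒≢ s cd)))

  hasP4⁻ : ∀ {G} → P4free G → ¬ T (hasP4 G)
  hasP4⁻ {G} free t with find (any⁻ _ G t)
  ... | e₁ , e₁∈ , t₁ with find (any⁻ _ G t₁)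
  ... | e₂ , e₂∈ , t₂ with find (any⁻ _ G t₂)
  ... | e₃ , e₃∈ , t₃ with find (any⁻ _ (orient e₁) t₃)
  ... | (a , b) , o₁ , t₄ with find (any⁻ _ (orient e₂) t₄)
  ... | (b′ , c) , o₂ , t₅ with find (any⁻ _ (orient e₃) t₅)
  ... | (c′ , d) , o₃ , t₆ with Equivalence.to T-∧ t₆
  ... | b≡ , t₇ with Equivalence.to T-∧ t₇
  ... | c≡ , t₈ with toWitness {a? = b ≟ b′} b≡ | toWitness {a? = c ≟ c′} c≡ | distinct4⁻ t₈
  ... | refl | refl | a≢c , b≢d , a≢d =
    free (orient-adj e₁∈ o₁) (orient-adj e₂∈ o₂) (orient-adj e₃∈ o₃) a≢c b≢d a≢d

  T-not⁺ : ∀ {b} → ¬ T b → T (not b)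
  T-not⁺ {false} _ = _
  T-not⁺ {true}  h = h _

  T-not⁻ : ∀ {b} → T (not b) → ¬ T b
  T-not⁻ {false} _ ()

  legal⇒P4free : ∀ {C q} → Simple (proj₁ q ∷ C) → Legal C q → P4free (proj₁ q ∷ C)
  legal⇒P4free s legal ab bc cd a≢c b≢d a≢d = T-not⁻ legal (hasP4⁺ s ab bc cd a≢c b≢d a≢d)

  P4free⇒legal : ∀ {C q} → P4free (proj₁ q ∷ C) → Legal C q
  P4free⇒legal free = T-not⁺ (hasP4⁻ free)

  -- Degrees and the degree formula for the score

  deg : Graph n → Fin n → ℕ
  deg G w = # (adj? G w)


  deg-[] : ∀ w → deg [] w ≡ 0
  deg-[] w = #-empty (adj? [] w) (λ { x (inj₁ ()) ; x (inj₂ ()) })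

  deg-∷ : ∀ {a b G} → Simple ((a , b) ∷ G) → ∀ w → deg ((a , b) ∷ G) w ≡ ⟦ w ≟ a ⟧ + ⟦ w ≟ b ⟧ + deg G w
  deg-∷ {a} {b} {G} s w = begin
    sum (λ x → ⟦ adj? ((a , b) ∷ G) w x ⟧)                            ≡⟨ sum-cong-≗ {n} pt ⟩
    sum (λ x → ⟦ x ≟ b ⟧ * ⟦ w ≟ a ⟧ + ⟦ x ≟ a ⟧ * ⟦ w ≟ b ⟧ + ⟦ adj? G w x ⟧)
      ≡⟨ ∑-distrib-+ {n} _ _ ⟩
    sum (λ x → ⟦ x ≟ b ⟧ * ⟦ w ≟ a ⟧ + ⟦ x ≟ a ⟧ * ⟦ w ≟ b ⟧) + deg G w
      ≡⟨ cong (_+ deg G w) (∑-distrib-+ {n} _ _) ⟩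
    sum (λ x → ⟦ x ≟ b ⟧ * ⟦ w ≟ a ⟧) + sum (λ x → ⟦ x ≟ a ⟧ * ⟦ w ≟ b ⟧) + deg G w
      ≡⟨ cong (_+ deg G w) (cong₂ _+_ (sum-point b (λ _ → ⟦ w ≟ a ⟧)) (sum-point a (λ _ → ⟦ w ≟ b ⟧))) ⟩
    ⟦ w ≟ a ⟧ + ⟦ w ≟ b ⟧ + deg G w ∎
    where
    open ≡-Reasoning
    a≢b : a ≢ b
    a≢b = adj⇒≢ s (adj-new {G = G})
    pt : ∀ x → ⟦ adj? ((a , b) ∷ G) w x ⟧ ≡ ⟦ x ≟ b ⟧ * ⟦ w ≟ a ⟧ + ⟦ x ≟ a ⟧ * ⟦ w ≟ b ⟧ + ⟦ adj? G w x ⟧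
    pt x with adj? G w x
    ... | yes e = trans (⟦⟧-yes (adj? ((a , b) ∷ G) w x) (adj-∷ e)) (sym (cong (_+ 1) none))
      where
      none : ⟦ x ≟ b ⟧ * ⟦ w ≟ a ⟧ + ⟦ x ≟ a ⟧ * ⟦ w ≟ b ⟧ ≡ 0
      none with x ≟ b | w ≟ a | x ≟ a | w ≟ b
      ... | yes refl | yes refl | _ | _ = contradiction e (simple-fresh s)
      ... | _ | _ | yes refl | yes refl = contradiction (adj-sym e) (simple-fresh s)
      ... | yes _ | no _ | yes _ | no _ = refl
      ... | yes _ | no _ | no _ | _ = refl
      ... | no _ | _ | yes _ | no _ = refl
      ... | no _ | _ | no _ | _ = refl
    ... | no ¬e with x ≟ b | w ≟ a | x ≟ a | w ≟ b
    ... | yes refl | yes refl | yes refl | _ = contradiction refl a≢b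
    ... | yes refl | yes refl | no _ | _ = ⟦⟧-yes (adj? ((a , b) ∷ G) w x) (adj-new {G = G})
    ... | yes refl | no _ | yes refl | _ = contradiction refl a≢b
    ... | yes refl | no w≢a | no _ | _ = ⟦⟧-no (adj? ((a , b) ∷ G) w x)
            ([ [ w≢a ∘ proj₁ , a≢b ∘ sym ∘ proj₂ ]′ , ¬e ]′ ∘ adj-∷⁻)
    ... | no _ | _ | yes refl | yes refl = ⟦⟧-yes (adj? ((a , b) ∷ G) w x) (adj-sym (adj-new {G = G}))
    ... | no _ | _ | yes refl | no w≢b = ⟦⟧-no (adj? ((a , b) ∷ G) w x)
            ([ [ a≢b ∘ proj₂ , w≢b ∘ proj₁ ]′ , ¬e ]′ ∘ adj-∷⁻)
    ... | no x≢b | _ | no x≢a | _ = ⟦⟧-no (adj? ((a , b) ∷ G) w x)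
            ([ [ x≢b ∘ proj₂ , x≢a ∘ proj₂ ]′ , ¬e ]′ ∘ adj-∷⁻)

  module _ {a b : Fin n} where

    -- Two different edges of a simple graph meet in at most one vertex, so adding the edges at `a`
    -- to those at `b` counts none twice.
    shared≡deg : ∀ {G} → Simple ((a , b) ∷ G) →
      length (filter (λ f → T? (sharesVertex (a , b) f)) G) ≡ deg G a + deg G b
    shared≡deg {[]} s = sym (cong₂ _+_ (deg-[] a) (deg-[] b))
    shared≡deg {(c , d) ∷ G} s@(a<b ∷ c<d ∷ o , (ab≢ ∷ uab) ∷ ucd ∷ u) =
      trans one (trans (cong (λ k → ⟦ a ≟ c ⟧ + ⟦ a ≟ d ⟧ + (⟦ b ≟ c ⟧ + ⟦ b ≟ d ⟧) + k)
                         (shared≡deg (a<b ∷ o , uab ∷ u)))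
                  (trans (lem (⟦ a ≟ c ⟧ + ⟦ a ≟ d ⟧) (⟦ b ≟ c ⟧ + ⟦ b ≟ d ⟧) (deg G a) (deg G b))
                         (sym (cong₂ _+_ (deg-∷ sG a) (deg-∷ sG b)))))
      where
      sG : Simple ((c , d) ∷ G)
      sG = c<d ∷ o , ucd ∷ u
      lem : ∀ p q r t → p + q + (r + t) ≡ (p + r) + (q + t)
      lem = solve-∀
      one : length (filter (λ f → T? (sharesVertex (a , b) f)) ((c , d) ∷ G)) ≡
        ⟦ a ≟ c ⟧ + ⟦ a ≟ d ⟧ + (⟦ b ≟ c ⟧ + ⟦ b ≟ d ⟧) +
        length (filter (λ f → T? (sharesVertex (a , b) f)) G)
      one with a ≟ c | a ≟ d | b ≟ c | b ≟ d
      ... | yes refl | yes refl | _        | _        = contradiction c<d (<-irrefl refl)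
      ... | yes refl | _        | yes refl | _        = contradiction a<b (<-irrefl refl)
      ... | yes refl | _        | _        | yes refl = contradiction refl ab≢
      ... | _        | yes refl | yes refl | _        = contradiction c<d (<-asym a<b)
      ... | _        | yes refl | _        | yes refl = contradiction a<b (<-irrefl refl)
      ... | _        | _        | yes refl | yes refl = contradiction c<d (<-irrefl refl)
      ... | yes _    | no _     | no _     | no _     = refl
      ... | no _     | yes _    | no _     | no _     = refl
      ... | no _     | no _     | yes _    | no _     = refl
      ... | no _     | no _     | no _     | yes _    = refl
      ... | no _     | no _     | no _     | no _     = refl

  -- Induction on the edges: a new edge `a b` forms one path with each earlier edge at `a` or `b`,
  -- and by `tri-suc` the right side grows by `2 * deg` at each end.
  countP3≡ : ∀ {G} → Simple G → 2 * countP3 G ≡ sum (λ w → tri (deg G w))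
  countP3≡ {[]} s = sym (trans (sum-cong-≗ {n} (λ w → cong tri (deg-[] w))) (trans (sum-const n 0) (*-zeroʳ n)))
  countP3≡ {(a , b) ∷ G} s = begin
    2 * (length (filter (λ f → T? (sharesVertex (a , b) f)) G) + countP3 G)
      ≡⟨ *-distribˡ-+ 2 (length (filter _ G)) (countP3 G) ⟩
    2 * length (filter (λ f → T? (sharesVertex (a , b) f)) G) + 2 * countP3 G
      ≡⟨ cong₂ _+_ (trans (cong (2 *_) (shared≡deg s)) (*-distribˡ-+ 2 (deg G a) (deg G b)))
                   (countP3≡ (simple-tail s)) ⟩
    2 * deg G a + 2 * deg G b + sum (λ w → tri (deg G w))
      ≡⟨ cong (_+ sum (λ w → tri (deg G w))) (sym (cong₂ _+_ (sum-point a (λ w → 2 * deg G w)) (sum-point b (λ w → 2 * deg G w)))) ⟩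
    sum (λ w → ⟦ w ≟ a ⟧ * (2 * deg G w)) + sum (λ w → ⟦ w ≟ b ⟧ * (2 * deg G w)) + sum (λ w → tri (deg G w))
      ≡⟨ sym (trans (∑-distrib-+ {n} _ _) (cong (_+ sum (λ w → tri (deg G w))) (∑-distrib-+ {n} _ _))) ⟩
    sum (λ w → ⟦ w ≟ a ⟧ * (2 * deg G w) + ⟦ w ≟ b ⟧ * (2 * deg G w) + tri (deg G w))
      ≡⟨ sym (sum-cong-≗ {n} pt) ⟩
    sum (λ w → tri (deg ((a , b) ∷ G) w)) ∎
    where
    open ≡-Reasoning
    one : ∀ p q → p + 0 + 0 + q ≡ p + q
    one = solve-∀
    pt : ∀ w → tri (deg ((a , b) ∷ G) w) ≡ ⟦ w ≟ a ⟧ * (2 * deg G w) + ⟦ w ≟ b ⟧ * (2 * deg G w) + tri (deg G w)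
    pt w rewrite deg-∷ s w with w ≟ a | w ≟ b
    ... | yes refl | yes refl = contradiction (adj-new {G = G}) (adj-irrefl s)
    ... | yes _ | no _ = trans (tri-suc (deg G w)) (lem (tri (deg G w)) (2 * deg G w))
      where
      lem : ∀ t d → t + d ≡ (d + 0) + 0 + t
      lem = solve-∀
    ... | no _ | yes _ = trans (tri-suc (deg G w)) (lem (tri (deg G w)) (2 * deg G w))
      where
      lem : ∀ t d → t + d ≡ 0 + (d + 0) + t
      lem = solve-∀
    ... | no _ | no _ = refl

-- Arithmetic of B

tri+ : ∀ d → tri d + d ≡ d * d
tri+ zero    = refl
tri+ (suc d) = lem d
  where
  lem : ∀ d → suc d * d + suc d ≡ suc d * suc d
  lem = solve-∀

tri-+ : ∀ x k → tri (x + k) ≡ tri x + tri k + 2 * (x * k)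
tri-+ x k = +-cancelʳ-≡ (x + k) _ _ (trans (tri+ (x + k)) (trans (lem x k)
  (trans (cong₂ (λ p q → p + q + 2 * (x * k)) (sym (tri+ x)) (sym (tri+ k))) (lem′ (tri x) x (tri k) k (2 * (x * k))))))
  where
  lem : ∀ x k → (x + k) * (x + k) ≡ x * x + k * k + 2 * (x * k)
  lem = solve-∀
  lem′ : ∀ a b c d e → (a + b) + (c + d) + e ≡ a + c + e + (b + d)
  lem′ = solve-∀

tri-mono : ∀ {x y} → x ≤ y → tri x ≤ tri y
tri-mono h = *-mono-≤ h (∸-monoˡ-≤ 1 h)

-- Convexity: by `tri-+` the two sides differ only in the cross terms `2 * (x * k)` and
-- `2 * (y * k)`.
tri-spread : ∀ {x y} k → x ≤ y → tri (x + k) + tri y ≤ tri x + tri (y + k)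
tri-spread {x} {y} k h rewrite tri-+ x k | tri-+ y k =
  linear 0 (+-monoʳ-≤ (tri x + tri k + tri y) (*-monoʳ-≤ 2 (*-monoˡ-≤ k h)))
    (lem (tri x) (tri k) (2 * (x * k)) (tri y)) (lem′ (tri x) (tri k) (tri y) (2 * (y * k)))
  where
  lem : ∀ a b c d → a + b + c + d + 0 ≡ a + b + d + c
  lem = solve-∀
  lem′ : ∀ a b c d → a + b + c + d ≡ a + (c + b + d) + 0
  lem′ = solve-∀

-- Passing to another split moves k leaves. For k ≥ 1, near-equality of `d` and `e` makes the part
-- that shrinks end no larger than the other one was, so `tri-spread` applies; k = 0 is separate
-- because there near-equality does not order the parts.
tri-balanced : ∀ {d e d′ e′} → d ≤ suc e → e ≤ suc d → d + e ≡ d′ + e′ → tri d + tri e ≤ tri d′ + tri e′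
tri-balanced {d} {e} {d′} {e′} d≤ e≤ eq with ≤-total d′ d
... | inj₁ d′≤d with d ∸ d′ | m+[n∸m]≡n d′≤d
...   | k | refl with +-cancelˡ-≡ d′ (k + e) e′ (trans (sym (+-assoc d′ k e)) eq)
...     | refl with k
...       | zero rewrite +-identityʳ d′ = ≤-refl
...       | suc j = subst (λ z → tri (d′ + suc j) + tri e ≤ tri d′ + tri z) (+-comm e (suc j)) (tri-spread (suc j)
            (≤-trans (m≤m+n d′ j) (≤-pred (subst (_≤ suc e) (+-suc d′ j) d≤))))
tri-balanced {d} {e} {d′} {e′} d≤ e≤ eq | inj₂ d≤d′ with d′ ∸ d | m+[n∸m]≡n d≤d′
... | k | refl with +-cancelˡ-≡ d e (k + e′) (trans eq (+-assoc d k e′))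
...   | refl with k
...     | zero rewrite +-identityʳ d = ≤-refl
...     | suc j = subst₂ _≤_
          (trans (+-comm (tri (e′ + suc j)) (tri d)) (cong (λ z → tri d + tri z) (+-comm e′ (suc j))))
          (+-comm (tri e′) (tri (d + suc j)))
          (tri-spread (suc j) (≤-trans (m≤m+n e′ j) (≤-pred (≤-trans (≤-reflexive (trans (sym (+-suc e′ j)) (+-comm e′ (suc j)))) e≤))))

2*C2 : ∀ a → 2 * (a choose 2) ≡ tri a
2*C2 zero    = refl
2*C2 (suc a) = begin
  2 * (suc a choose 2)           ≡⟨ cong (2 *_) (sym (nCk+nC[k+1]≡[n+1]C[k+1] a 1)) ⟩
  2 * (a choose 1 + a choose 2)       ≡⟨ *-distribˡ-+ 2 (a choose 1) (a choose 2) ⟩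
  2 * (a choose 1) + 2 * (a choose 2) ≡⟨ cong₂ (λ p q → 2 * p + q) (nC1≡n a) (2*C2 a) ⟩
  2 * a + tri a             ≡⟨ +-comm (2 * a) (tri a) ⟩
  tri a + 2 * a             ≡⟨ sym (tri-suc a) ⟩
  tri (suc a) ∎
  where open ≡-Reasoning

module _ (m : ℕ) where

  private
    a b : ℕ
    a = m / 2
    b = m ∸ m / 2

    a+b : a + b ≡ m
    a+b = m+[n∸m]≡n (≤-trans (m≤m*n a 2) (subst (a * 2 ≤_) (sym (m≡m%n+[m/n]*n m 2)) (m≤n+m (a * 2) (m % 2))))

    m≡ : m ≡ m % 2 + a * 2
    m≡ = m≡m%n+[m/n]*n m 2

    b≡ : b ≡ m % 2 + a
    b≡ = +-cancelˡ-≡ a b (m % 2 + a) (trans a+b (trans m≡ (lem (m % 2) a)))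
      where
      lem : ∀ r a → r + a * 2 ≡ a + (r + a)
      lem = solve-∀

    a≤ : a ≤ suc b
    a≤ = ≤-trans (subst (a ≤_) (sym b≡) (m≤n+m a (m % 2))) (n≤1+n b)

    b≤ : b ≤ suc a
    b≤ = subst (_≤ suc a) (sym b≡) (+-monoˡ-≤ a (≤-pred (m%n<n m 2)))

    2B : 2 * B (2 + m) ≡ tri a + tri b
    2B = trans (*-distribˡ-+ 2 (a choose 2) (b choose 2)) (cong₂ _+_ (2*C2 a) (2*C2 b))

  B-minimal : ∀ {d e} → d + e ≡ m → 2 * B (2 + m) ≤ tri d + tri e
  B-minimal {d} {e} eq = subst (_≤ tri d + tri e) (sym 2B) (tri-balanced {a} {b} {d} {e} a≤ b≤ (trans a+b (sym eq)))

  B-balanced : ∀ {d e} → d ≤ suc e → e ≤ suc d → d + e ≡ m → tri d + tri e ≤ 2 * B (2 + m)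
  B-balanced {d} {e} d≤ e≤ eq = subst (tri d + tri e ≤_) (sym 2B) (tri-balanced {d} {e} {a} {b} d≤ e≤ (trans eq (sym a+b)))

  -- The two parts of `m` satisfy the inequality between arithmetic and geometric means, and `tri+`
  -- turns squares into `tri`. Floor and ceiling thus disappear: a doubled score `f` is at most
  -- `2 * B (2 + m)` as soon as `2 * f + 2 * m ≤ m * m`.
  B-quadratic : m * m ≤ 2 * (2 * B (2 + m)) + 2 * m
  B-quadratic = begin
    m * m                             ≡⟨ cong (λ k → k * k) (sym a+b) ⟩
    (a + b) * (a + b)                 ≡⟨ lem₁ a b ⟩
    a * a + b * b + 2 * (a * b)       ≤⟨ +-monoʳ-≤ (a * a + b * b) (am-gm a b) ⟩
    a * a + b * b + (a * a + b * b)   ≡⟨ cong (λ k → k + k) (sym (cong₂ _+_ (tri+ a) (tri+ b))) ⟩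
    (tri a + a + (tri b + b)) + (tri a + a + (tri b + b)) ≡⟨ lem₂ (tri a) a (tri b) b ⟩
    2 * (tri a + tri b) + 2 * (a + b) ≡⟨ cong₂ (λ p q → 2 * p + 2 * q) (sym 2B) a+b ⟩
    2 * (2 * B (2 + m)) + 2 * m       ∎
    where
    open ≤-Reasoning
    lem₁ : ∀ a b → (a + b) * (a + b) ≡ a * a + b * b + 2 * (a * b)
    lem₁ = solve-∀
    lem₂ : ∀ p a q b → (p + a + (q + b)) + (p + a + (q + b)) ≡ 2 * (p + q) + 2 * (a + b)
    lem₂ = solve-∀
    ordered : ∀ x y → x ≤ y → 2 * (x * y) ≤ x * x + y * y
    ordered x y h with y ∸ x | m+[n∸m]≡n h
    ... | k | refl = linear 0 (m≤m+n (2 * (x * (x + k))) (k * k)) (lem₃ x k) (lem₄ x k)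
      where
      lem₃ : ∀ x k → 2 * (x * (x + k)) + 0 ≡ 2 * (x * (x + k))
      lem₃ = solve-∀
      lem₄ : ∀ x k → 2 * (x * (x + k)) + k * k ≡ x * x + (x + k) * (x + k) + 0
      lem₄ = solve-∀
    am-gm : ∀ x y → 2 * (x * y) ≤ x * x + y * y
    am-gm x y with ≤-total x y
    ... | inj₁ h = ordered x y h
    ... | inj₂ h = subst₂ _≤_ (cong (2 *_) (*-comm y x)) (+-comm (y * y) (x * x)) (ordered y x h)

-- Stars in a P₄-free graph

module _ {n : ℕ} where

  -- Uncovered vertices: those outside the two stars centred at `p` and `q`.
  Unc : Graph n → Fin n → Fin n → Fin n → Set
  Unc G p q x = x ≢ p × x ≢ q × ¬ Adj G p x × ¬ Adj G q x

  unc? : ∀ G p q → Decidable (Unc G p q)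
  unc? G p q x = ¬? (x ≟ p) ×-dec ¬? (x ≟ q) ×-dec ¬? (adj? G p x) ×-dec ¬? (adj? G q x)

  two-neighbours : ∀ {G : Graph n} {w} → 2 ≤ deg G w → ∃ λ x → ∃ λ y → Adj G w x × Adj G w y × y ≢ x
  two-neighbours {G} {w} h with #≤1⊎pair (adj? G w)
  ... | inj₁ h′ = contradiction (≤-trans h h′) (λ { (s≤s ()) })
  ... | inj₂ p  = p

  two≤deg : ∀ {G : Graph n} {w x y} → Adj G w x → Adj G w y → y ≢ x → 2 ≤ deg G w
  two≤deg {G} {w} {x} {y} wx wy y≢x = subst₂ (λ p q → p + q ≤ deg G w) (#-point x) (#-point y)
    (#-disjoint (_≟ x) (_≟ y) (adj? G w) (λ { refl refl → y≢x refl }) (λ { refl → wx }) (λ { refl → wy }))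

  count-n : ∀ {G : Graph n} {p q} → Simple G → p ≢ q → ¬ Adj G p q → (∀ {x} → Adj G p x → ¬ Adj G q x) →
            deg G p + deg G q + 2 + # (unc? G p q) ≤ n
  count-n {G} {p} {q} s p≢q pq dis = subst (_≤ n)
      (trans (cong₂ (λ a b → deg G p + (deg G q + (a + (b + # (unc? G p q))))) (#-point p) (#-point q))
             (lem (deg G p) (deg G q) (# (unc? G p q)))) step₄
    where
    lem : ∀ a b c → a + (b + suc (suc c)) ≡ a + b + 2 + c
    lem = solve-∀
    U? = unc? G p q
    R₁? : Decidable (λ x → x ≡ q ⊎ Unc G p q x)
    R₁? x = (x ≟ q) ⊎-dec U? x
    R₂? : Decidable (λ x → x ≡ p ⊎ x ≡ q ⊎ Unc G p q x)
    R₂? x = (x ≟ p) ⊎-dec R₁? x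
    R₃? : Decidable (λ x → Adj G q x ⊎ x ≡ p ⊎ x ≡ q ⊎ Unc G p q x)
    R₃? x = adj? G q x ⊎-dec R₂? x
    step₁ : # (_≟ q) + # U? ≤ # R₁?
    step₁ = #-disjoint (_≟ q) U? R₁? (λ { refl (_ , h , _) → h refl }) inj₁ inj₂
    step₂ : # (_≟ p) + (# (_≟ q) + # U?) ≤ # R₂?
    step₂ = ≤-trans (+-monoʳ-≤ (# (_≟ p)) step₁) (#-disjoint (_≟ p) R₁? R₂?
      (λ { refl (inj₁ e) → p≢q e ; refl (inj₂ (h , _)) → h refl }) inj₁ inj₂)
    step₃ : deg G q + (# (_≟ p) + (# (_≟ q) + # U?)) ≤ # R₃?
    step₃ = ≤-trans (+-monoʳ-≤ (deg G q) step₂) (#-disjoint (adj? G q) R₂? R₃?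
      (λ { e (inj₁ refl) → pq (adj-sym e) ; e (inj₂ (inj₁ refl)) → adj-irrefl s e
         ; e (inj₂ (inj₂ (_ , _ , _ , h))) → h e }) inj₁ inj₂)
    step₄ : deg G p + (deg G q + (# (_≟ p) + (# (_≟ q) + # U?))) ≤ n
    step₄ = ≤-trans (+-monoʳ-≤ (deg G p) step₃) (#-disjoint-n (adj? G p) R₃?
      (λ { e (inj₁ f) → dis e f ; e (inj₂ (inj₁ refl)) → adj-irrefl s e ; e (inj₂ (inj₂ (inj₁ refl))) → pq e
         ; e (inj₂ (inj₂ (inj₂ (_ , _ , h , _)))) → h e }))

  -- Overlaps of the two neighbourhoods only enlarge the right side. Together with `count-n` this
  -- fixes the leaf total of two disjoint spanning stars.
  n-count : ∀ (G : Graph n) p q → n ≤ deg G p + deg G q + 2 + # (unc? G p q)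
  n-count G p q = subst (n ≤_)
      (trans (cong₂ (λ a b → deg G p + (deg G q + (a + (b + # (unc? G p q))))) (#-point p) (#-point q))
             (lem (deg G p) (deg G q) (# (unc? G p q)))) step₁
    where
    lem : ∀ a b c → a + (b + suc (suc c)) ≡ a + b + 2 + c
    lem = solve-∀
    U? = unc? G p q
    R₁? : Decidable (λ x → x ≡ q ⊎ Unc G p q x)
    R₁? x = (x ≟ q) ⊎-dec U? x
    R₂? : Decidable (λ x → x ≡ p ⊎ x ≡ q ⊎ Unc G p q x)
    R₂? x = (x ≟ p) ⊎-dec R₁? x
    R₃? : Decidable (λ x → Adj G q x ⊎ x ≡ p ⊎ x ≡ q ⊎ Unc G p q x)
    R₃? x = adj? G q x ⊎-dec R₂? x
    cases : ∀ x → Adj G p x ⊎ Adj G q x ⊎ x ≡ p ⊎ x ≡ q ⊎ Unc G p q x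
    cases x with adj? G p x | adj? G q x | x ≟ p | x ≟ q
    ... | yes e | _ | _ | _ = inj₁ e
    ... | _ | yes e | _ | _ = inj₂ (inj₁ e)
    ... | _ | _ | yes e | _ = inj₂ (inj₂ (inj₁ e))
    ... | _ | _ | _ | yes e = inj₂ (inj₂ (inj₂ (inj₁ e)))
    ... | no a | no b | no c | no d = inj₂ (inj₂ (inj₂ (inj₂ (c , d , a , b))))
    step₁ : n ≤ deg G p + (deg G q + (# (_≟ p) + (# (_≟ q) + # U?)))
    step₁ = ≤-trans (#-cover-n (adj? G p) R₃? cases)
      (+-monoʳ-≤ (deg G p) (≤-trans (#-cover (adj? G q) R₂? R₃? id)
      (+-monoʳ-≤ (deg G q) (≤-trans (#-cover (_≟ p) R₁? R₂? id)
      (+-monoʳ-≤ (# (_≟ p)) (#-cover (_≟ q) U? R₁? id))))))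

  module Stars {G : Graph n} (s : Simple G) (free : P4free G) where

    d : Fin n → ℕ
    d = deg G

    -- A neighbour `y` of `w` other than `x` and `z` would complete the path `y w x z`.
    deg≤2-end : ∀ {w x z} → Adj G w x → Adj G x z → z ≢ w → d w ≤ 2
    deg≤2-end {w} {x} {z} wx xz z≢w = subst₂ (λ p q → d w ≤ p + q) (#-point x) (#-point z)
      (#-cover (_≟ x) (_≟ z) (adj? G w) near)
      where
      near : ∀ {y} → Adj G w y → y ≡ x ⊎ y ≡ z
      near {y} wy with y ≟ x | y ≟ z
      ... | yes e | _ = inj₁ e
      ... | _ | yes e = inj₂ e
      ... | no y≢x | no y≢z = ⊥-elim (free (adj-sym wy) wx xz y≢x (z≢w ∘ sym) y≢z)

    leaf : ∀ {w x z} → 3 ≤ d w → Adj G w x → Adj G x z → z ≡ w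
    leaf {w} {x} {z} 3≤ wx xz with z ≟ w
    ... | yes e = e
    ... | no z≢w = contradiction (≤-trans 3≤ (deg≤2-end wx xz z≢w)) λ { (s≤s (s≤s ())) }

    leaf-deg : ∀ {w x} → 3 ≤ d w → Adj G w x → d x ≤ 1
    leaf-deg {w} {x} 3≤ wx = subst (d x ≤_) (#-point w) (#-mono (adj? G x) (_≟ w) (leaf 3≤ wx))

    deg≤2-edge : ∀ {a b} → Adj G a b → d a ≤ 2 ⊎ d b ≤ 2
    deg≤2-edge {a} {b} ab with 3 ≤? d a
    ... | no h  = inj₁ (≤-pred (≰⇒> h))
    ... | yes h = inj₂ (≤-trans (leaf-deg h ab) (n≤1+n 1))

    big-nonadj : ∀ {p q} → 3 ≤ d p → 3 ≤ d q → ¬ Adj G p q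
    big-nonadj 3≤p 3≤q pq = contradiction (≤-trans 3≤q (leaf-deg 3≤p pq)) λ { (s≤s ()) }

    big-count : ∀ {p q} → p ≢ q → 3 ≤ d p → 3 ≤ d q → d p + d q + 2 + # (unc? G p q) ≤ n
    big-count p≢q 3≤p 3≤q = count-n s p≢q (big-nonadj 3≤p 3≤q)
      (λ px qx → p≢q (sym (leaf 3≤p px (adj-sym qx))))

    -- Double counting turns the sum of tri (deg v) into one over leaves, which the size of the graph controls.
    h : Fin n → ℕ
    h x = sum (λ v → ⟦ adj? G v x ⟧ * (d v ∸ 1))

    sum-h : sum (λ v → tri (d v)) ≡ sum h
    sum-h = trans (sum-cong-≗ {n} (λ v → *-distribʳ-sum {n} (d v ∸ 1) (λ x → ⟦ adj? G v x ⟧)))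
                  (∑-comm {n} {n} (λ v x → ⟦ adj? G v x ⟧ * (d v ∸ 1)))

    h-leaf : ∀ {v x} → 3 ≤ d v → Adj G v x → h x ≤ d v ∸ 1
    h-leaf {v} {x} 3≤ vx = ≤-trans (sum-mono pt) (≤-reflexive (sum-point v (λ w → d w ∸ 1)))
      where
      pt : ∀ w → ⟦ adj? G w x ⟧ * (d w ∸ 1) ≤ ⟦ w ≟ v ⟧ * (d w ∸ 1)
      pt w with adj? G w x | w ≟ v
      ... | no _  | _     = z≤n
      ... | yes _ | yes _ = ≤-refl
      ... | yes e | no w≢v = contradiction (leaf 3≤ vx (adj-sym e)) w≢v

    h-centre : ∀ {v} → 3 ≤ d v → h v ≤ 0
    h-centre {v} 3≤ = ≤-trans (sum-mono pt) (≤-reflexive (trans (sum-const n 0) (*-zeroʳ n)))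
      where
      pt : ∀ w → ⟦ adj? G w v ⟧ * (d w ∸ 1) ≤ 0
      pt w with adj? G w v
      ... | no _  = z≤n
      ... | yes e = ≤-trans (≤-reflexive (+-identityʳ _)) (∸-monoˡ-≤ 1 (leaf-deg 3≤ (adj-sym e)))

    -- A leaf of a star with at least three leaves sees only its centre, and such a centre
    -- contributes nothing. Otherwise `x` has at most two neighbours, each of degree at most two and
    -- contributing at most one; `2 ≤ c` serves this last case.
    h≤ : ∀ {c x} → 2 ≤ c → (∀ {w} → Adj G w x → d w ∸ 1 ≤ c) → h x ≤ c
    h≤ {c} {x} 2≤c bound with any? (λ v → adj? G v x ×-dec (3 ≤? d v)) | 3 ≤? d x
    ... | yes (v , vx , 3≤) | _      = ≤-trans (h-leaf 3≤ vx) (bound vx)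
    ... | no _              | yes 3≤ = ≤-trans (h-centre 3≤) z≤n
    ... | no ¬big           | no 3≰  = ≤-trans (sum-mono pt) (≤-trans (≤-pred (≰⇒> 3≰)) 2≤c)
      where
      pt : ∀ v → ⟦ adj? G v x ⟧ * (d v ∸ 1) ≤ ⟦ adj? G x v ⟧
      pt v with adj? G v x | adj? G x v
      ... | no _  | _ = z≤n
      ... | yes e | no ¬e = contradiction (adj-sym e) ¬e
      ... | yes e | yes _ = ≤-trans (≤-reflexive (+-identityʳ _))
              (∸-monoˡ-≤ 1 (≤-pred (≰⇒> (λ 3≤ → ¬big (v , e , 3≤)))))

    -- Both centres have `h` equal to zero, so neither is among the `r` remaining vertices. This is
    -- what lowers the bound on `r + d u` from `n` to `n - 2`.
    sum-h≤ : ∀ {u v c} → u ≢ v → 3 ≤ d u → 3 ≤ d v → 2 ≤ c → (∀ {w} → w ≢ u → d w ∸ 1 ≤ c) →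
             ∃ λ r → r + d u + 2 ≤ n × sum h ≤ tri (d u) + r * c
    sum-h≤ {u} {v} {c} u≢v 3≤u 3≤v 2≤c bound = # rest? , size , total
      where
      rest? : Decidable (λ x → ¬ Adj G u x × x ≢ u × x ≢ v)
      rest? x = ¬? (adj? G u x) ×-dec ¬? (x ≟ u) ×-dec ¬? (x ≟ v)
      R₁? : Decidable (λ x → x ≡ u ⊎ x ≡ v)
      R₁? x = (x ≟ u) ⊎-dec (x ≟ v)
      R₂? : Decidable (λ x → Adj G u x ⊎ x ≡ u ⊎ x ≡ v)
      R₂? x = adj? G u x ⊎-dec R₁? x
      lem : ∀ r t → r + (t + 2) ≡ r + t + 2
      lem = solve-∀
      size : # rest? + d u + 2 ≤ n
      size = ≤-trans (≤-reflexive (trans (sym (lem (# rest?) (d u)))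
               (cong (λ k → # rest? + (d u + k)) (sym (cong₂ _+_ (#-point u) (#-point v))))))
        (≤-trans (+-monoʳ-≤ (# rest?) (≤-trans
          (+-monoʳ-≤ (d u) (#-disjoint (_≟ u) (_≟ v) R₁? (λ { refl → u≢v }) inj₁ inj₂))
          (#-disjoint (adj? G u) R₁? R₂?
            (λ { e (inj₁ refl) → adj-irrefl s e ; e (inj₂ refl) → big-nonadj 3≤u 3≤v e }) inj₁ inj₂)))
        (#-disjoint-n rest? R₂? (λ { (a , b , c) (inj₁ e) → a e ; (a , b , c) (inj₂ (inj₁ e)) → b e
                                   ; (a , b , c) (inj₂ (inj₂ e)) → c e })))
      pt : ∀ x → h x ≤ ⟦ adj? G u x ⟧ * (d u ∸ 1) + ⟦ rest? x ⟧ * c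
      pt x with adj? G u x
      ... | yes ux = ≤-trans (h-leaf 3≤u ux) (≤-trans (≤-reflexive (sym (+-identityʳ _))) (m≤m+n _ _))
      ... | no ¬ux with x ≟ u | x ≟ v
      ...   | yes refl | _ = ≤-trans (h-centre 3≤u) z≤n
      ...   | no _ | yes refl = ≤-trans (h-centre 3≤v) z≤n
      ...   | no _ | no _ = ≤-trans (h≤ 2≤c (λ {w} wx → bound (λ { refl → ¬ux wx }))) (≤-reflexive (sym (+-identityʳ c)))
      total : sum h ≤ tri (d u) + # rest? * c
      total = ≤-trans (sum-mono pt) (≤-reflexive (trans (∑-distrib-+ {n} _ _)
        (sym (cong₂ _+_ (*-distribʳ-sum {n} (d u ∸ 1) (λ x → ⟦ adj? G u x ⟧)) (*-distribʳ-sum {n} c (λ x → ⟦ rest? x ⟧))))))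

-- The score of a P₄-free graph

-- A star with about m/2 leaves uses up only about half of `m * m`, and every other vertex has `tri`
-- at most 2; the other half absorbs all terms linear in `m`.
quadratic-one : ∀ {m S t} → S * S + S ≤ m → 2 * S + 16 ≤ m → 2 * t ≤ m + S →
                2 * (tri t + (2 + m) * 2) + 2 * m ≤ m * m
quadratic-one {m} {S} {t} S² hS ht = *-cancelˡ-≤ 2 (begin
  2 * (2 * (tri t + (2 + m) * 2) + 2 * m) ≡⟨ lem₁ (tri t) m ⟩
  4 * tri t + (12 * m + 16)               ≤⟨ +-monoˡ-≤ (12 * m + 16) (*-monoʳ-≤ 4 (*-monoʳ-≤ t (m∸n≤m t 1))) ⟩
  4 * (t * t) + (12 * m + 16)             ≡⟨ cong (_+ (12 * m + 16)) (lem₂ t) ⟩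
  (2 * t) * (2 * t) + (12 * m + 16)       ≤⟨ +-mono-≤ (*-mono-≤ ht ht) (+-monoʳ-≤ (12 * m) (≤-trans (m≤n+m 16 (2 * S)) hS)) ⟩
  (m + S) * (m + S) + (12 * m + m)        ≡⟨ lem₃ m S ⟩
  S * S + (m * m + 2 * S * m + 13 * m)    ≤⟨ +-monoˡ-≤ _ (≤-trans (m≤m+n (S * S) S) S²) ⟩
  m + (m * m + 2 * S * m + 13 * m)        ≡⟨ lem₄ m S ⟩
  m * m + (2 * S + 14) * m                ≤⟨ +-monoʳ-≤ (m * m) (*-monoˡ-≤ m (≤-trans (+-monoʳ-≤ (2 * S) (m≤m+n 14 2)) hS)) ⟩
  m * m + m * m                           ≡⟨ lem₅ m ⟩
  2 * (m * m)                             ∎)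
  where
  open ≤-Reasoning
  lem₁ : ∀ x m → 2 * (2 * (x + (2 + m) * 2) + 2 * m) ≡ 4 * x + (12 * m + 16)
  lem₁ = solve-∀
  lem₂ : ∀ t → 4 * (t * t) ≡ (2 * t) * (2 * t)
  lem₂ = solve-∀
  lem₃ : ∀ m S → (m + S) * (m + S) + (12 * m + m) ≡ S * S + (m * m + 2 * S * m + 13 * m)
  lem₃ = solve-∀
  lem₄ : ∀ m S → m + (m * m + 2 * S * m + 13 * m) ≡ m * m + (2 * S + 14) * m
  lem₄ = solve-∀
  lem₅ : ∀ m → m * m + m * m ≡ 2 * (m * m)
  lem₅ = solve-∀

-- The larger star has q + s leaves; each of at most q other vertices is a leaf of a star with at most q − 1 leaves.
quadratic-two : ∀ {S} q s r → q ≡ 2 + r → s ≤ S → S * S + S ≤ q + s + q →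
                2 * (tri (q + s) + q * r) + 2 * (q + s + q) ≤ (q + s + q) * (q + s + q)
quadratic-two {S} q s r eq s≤S S² = begin
  2 * (tri (q + s) + q * r) + 2 * (q + s + q)                 ≡⟨ lem₁ (tri (q + s)) (q * r) q s ⟩
  2 * (tri (q + s) + (q + s)) + 2 * (q * r + q)               ≡⟨ cong (λ k → 2 * k + 2 * (q * r + q)) (tri+ (q + s)) ⟩
  2 * ((q + s) * (q + s)) + 2 * (q * r + q)                   ≡⟨ lem₂ q s r ⟩
  2 * (q * q) + 4 * (q * s) + s * s + 2 * q * (1 + r) + s * s ≤⟨ +-monoʳ-≤ _ small ⟩
  2 * (q * q) + 4 * (q * s) + s * s + 2 * q * (1 + r) + 2 * q ≡⟨ lem₃ q s r ⟩
  2 * (q * q) + 4 * (q * s) + s * s + 2 * q * (2 + r)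
    ≡⟨ cong (λ k → 2 * (q * q) + 4 * (q * s) + s * s + 2 * q * k) (sym eq) ⟩
  2 * (q * q) + 4 * (q * s) + s * s + 2 * q * q               ≡⟨ lem₄ q s ⟩
  (q + s + q) * (q + s + q) ∎
  where
  open ≤-Reasoning
  lem₁ : ∀ x y q s → 2 * (x + y) + 2 * (q + s + q) ≡ 2 * (x + (q + s)) + 2 * (y + q)
  lem₁ = solve-∀
  lem₂ : ∀ q s r → 2 * ((q + s) * (q + s)) + 2 * (q * r + q) ≡ 2 * (q * q) + 4 * (q * s) + s * s + 2 * q * (1 + r) + s * s
  lem₂ = solve-∀
  lem₃ : ∀ q s r → 2 * (q * q) + 4 * (q * s) + s * s + 2 * q * (1 + r) + 2 * q ≡ 2 * (q * q) + 4 * (q * s) + s * s + 2 * q * (2 + r)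
  lem₃ = solve-∀
  lem₄ : ∀ q s → 2 * (q * q) + 4 * (q * s) + s * s + 2 * q * q ≡ (q + s + q) * (q + s + q)
  lem₄ = solve-∀
  lem₅ : ∀ q s → q + s + q ≡ 2 * q + s
  lem₅ = solve-∀
  -- What remains is `s * s` against `2 * q`: the gain from an imbalance `s` against the cost of one
  -- lost leaf.
  small : s * s ≤ 2 * q
  small = linear s (≤-trans (+-mono-≤ (*-mono-≤ s≤S s≤S) s≤S) S²) refl (lem₅ q s)

-- Each of the `t + r` vertices is charged at most `c`, so the whole sum is at most `m * c`.
quadratic-balanced : ∀ {m t r c} → t + r ≤ m → t ∸ 1 ≤ c → 2 * c + 2 ≤ m →
                     2 * (tri t + r * c) + 2 * m ≤ m * m
quadratic-balanced {m} {t} {r} {c} tr tc hc = begin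
  2 * (tri t + r * c) + 2 * m  ≤⟨ +-monoˡ-≤ (2 * m) (*-monoʳ-≤ 2 (+-monoˡ-≤ (r * c) (*-monoʳ-≤ t tc))) ⟩
  2 * (t * c + r * c) + 2 * m  ≡⟨ cong (λ k → 2 * k + 2 * m) (sym (*-distribʳ-+ c t r)) ⟩
  2 * ((t + r) * c) + 2 * m    ≤⟨ +-monoˡ-≤ (2 * m) (*-monoʳ-≤ 2 (*-monoˡ-≤ c tr)) ⟩
  2 * (m * c) + 2 * m          ≡⟨ lem m c ⟩
  m * (2 * c + 2)              ≤⟨ *-monoʳ-≤ m hc ⟩
  m * m ∎
  where
  open ≤-Reasoning
  lem : ∀ m c → 2 * (m * c) + 2 * m ≡ m * (2 * c + 2)
  lem = solve-∀

module Score {n m S : ℕ} (n≡ : n ≡ 2 + m) (S² : S * S + S ≤ m) (hS : 2 * S + 16 ≤ m) where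

  private
    n≡m+2 : n ≡ m + 2
    n≡m+2 = trans n≡ (+-comm 2 m)

  B-bound : ∀ {G : Graph n} {f} → Simple G → sum (λ w → tri (deg G w)) ≤ f → 2 * f + 2 * m ≤ m * m →
            countP3 G ≤ B n
  B-bound {G} {f} s ≤f f≤ = *-cancelˡ-≤ 2 (*-cancelˡ-≤ 2 (+-cancelʳ-≤ (2 * m) _ _
    (≤-trans (+-monoˡ-≤ (2 * m) (*-monoʳ-≤ 2 (≤-trans (≤-reflexive (countP3≡ s)) ≤f)))
    (≤-trans f≤ (subst (λ k → m * m ≤ 2 * (2 * B k) + 2 * m) (sym n≡) (B-quadratic m))))))

  private
    16≤m : 16 ≤ m
    16≤m = ≤-trans (m≤n+m 16 (2 * S)) hS

    abstract
      -- The largest `d ∸ 1` with `2 * d < m`.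
      c₀ : ℕ
      c₀ = ⌊ m ∸ 3 /2⌋

      c₀≤ : 2 * c₀ + 2 ≤ m
      c₀≤ = begin
        2 * c₀ + 2            ≡⟨ cong (λ k → c₀ + k + 2) (+-identityʳ c₀) ⟩
        c₀ + c₀ + 2           ≤⟨ +-monoˡ-≤ 2 (+-monoʳ-≤ c₀ (⌊n/2⌋≤⌈n/2⌉ (m ∸ 3))) ⟩
        c₀ + ⌈ m ∸ 3 /2⌉ + 2  ≡⟨ cong (_+ 2) (⌊n/2⌋+⌈n/2⌉≡n (m ∸ 3)) ⟩
        m ∸ 3 + 2             ≤⟨ +-monoʳ-≤ (m ∸ 3) (n≤1+n 2) ⟩
        m ∸ 3 + 3             ≡⟨ m∸n+n≡m (≤-trans (s≤s (s≤s (s≤s z≤n))) 16≤m) ⟩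
        m                     ∎
        where open ≤-Reasoning

      ≤c₀ : ∀ d → 2 * d < m → d ∸ 1 ≤ c₀
      ≤c₀ zero    _ = z≤n
      ≤c₀ (suc d) h = subst (_≤ c₀) (sym (n≡⌊n+n/2⌋ d)) (⌊n/2⌋-mono
        (≤-trans (≤-reflexive (sym (lem d))) (∸-monoˡ-≤ 3 h)))
        where
        lem : ∀ d → 2 * suc d ∸ 2 ≡ d + d
        lem d rewrite +-identityʳ d | +-suc d d = refl

      2≤c₀ : 2 ≤ c₀
      2≤c₀ = ⌊n/2⌋-mono {4} (∸-monoˡ-≤ 3 (≤-trans (m≤m+n 7 9) 16≤m))

  -- Three regimes. With at most one vertex of degree three or more, the score is far below the
  -- benchmark. If a star has at least m/2 leaves, the vertex missed jointly with it caps every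
  -- other star. If all stars have fewer than m/2 leaves, each leaf is worth at most `c₀`.
  score : ∀ {G : Graph n} → Simple G → P4free G → (∀ w → 2 * deg G w ≤ m + S) →
          (∀ {p q} → p ≢ q → deg G p ≤ 2 ⊎ deg G q ≤ 2 ⊎ ∃ (Unc G p q)) → countP3 G ≤ B n
  score {G} s free deg≤ pairs = cases (any? (λ u → 3 ≤? d u))
    where
    open Stars s free

    one-star : ∀ u → (∀ w → w ≢ u → d w ≤ 2) → countP3 G ≤ B n
    one-star u small = B-bound s (≤-trans (sum-mono pt) (≤-reflexive (trans (∑-distrib-+ {n} _ _)
        (cong₂ _+_ (sum-point u (λ w → tri (d w))) (sum-const n 2)))))
      (subst (λ k → 2 * (tri (d u) + k * 2) + 2 * m ≤ m * m) (sym n≡) (quadratic-one {m} {S} {d u} S² hS (deg≤ u)))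
      where
      pt : ∀ w → tri (d w) ≤ ⟦ w ≟ u ⟧ * tri (d w) + 2
      pt w with w ≟ u
      ... | yes _  = ≤-trans (m≤m+n _ 2) (≤-reflexive (cong (_+ 2) (sym (+-identityʳ _))))
      ... | no w≢u = tri-mono (small w w≢u)

    big-star : ∀ {u v} → u ≢ v → 3 ≤ d u → 3 ≤ d v → m ≤ 2 * d u → countP3 G ≤ B n
    big-star {u} {v} u≢v 3≤u 3≤v m≤ =
      B-bound s (≤-trans (≤-reflexive sum-h) (≤-trans (proj₂ (proj₂ bound))
                  (+-monoʳ-≤ (tri (d u)) (*-monoˡ-≤ c r≤))))
        (subst₂ (λ t k → 2 * (tri t + (2 + c) * c) + 2 * k ≤ k * k) q+s≡ m≡
          (quadratic-two (2 + c) s′ c refl s≤S (≤-trans S² (≤-reflexive (sym m≡)))))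
      where
      -- Every other large star misses a vertex together with the star at `u`, so it has at most
      -- `m ∸ d u ∸ 1` leaves; `c` is one less.
      c : ℕ
      c = m ∸ d u ∸ 2

      others : ∀ {w} → w ≢ u → d u + d w ≤ m ∸ 1 ⊎ d w ≤ 2
      others {w} w≢u with 3 ≤? d w
      ... | no h = inj₂ (≤-pred (≰⇒> h))
      ... | yes 3≤w with pairs (w≢u ∘ sym)
      ...   | inj₁ h        = contradiction (≤-trans 3≤u h) λ { (s≤s (s≤s ())) }
      ...   | inj₂ (inj₁ h) = inj₂ h
      ...   | inj₂ (inj₂ (y , unc)) = inj₁ (≤-trans (≤-reflexive (sym (m+n∸n≡m (d u + d w) 1)))
              (∸-monoˡ-≤ 1 (+-cancelʳ-≤ 2 _ _ (≤-trans (≤-reflexive (lem (d u + d w)))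
                (≤-trans (+-monoʳ-≤ (d u + d w + 2) (#≥1 (unc? G u w) unc))
                (≤-trans (big-count (w≢u ∘ sym) 3≤u 3≤w) (≤-reflexive n≡m+2)))))))
        where
        lem : ∀ k → k + 1 + 2 ≡ k + 2 + 1
        lem = solve-∀

      d+4≤m : d u + 4 ≤ m
      d+4≤m with others (u≢v ∘ sym)
      ... | inj₂ h = contradiction (≤-trans 3≤v h) λ { (s≤s (s≤s ())) }
      ... | inj₁ h = ≤-trans (≤-reflexive (sym (+-assoc (d u) 3 1)))
              (≤-trans (+-monoˡ-≤ 1 (≤-trans (+-monoʳ-≤ (d u) 3≤v) h))
              (≤-reflexive (m∸n+n≡m (≤-trans (s≤s z≤n) 16≤m))))

      du≤m : d u ≤ m
      du≤m = ≤-trans (m≤m+n _ 4) d+4≤m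

      4≤ : 4 ≤ m ∸ d u
      4≤ = subst (_≤ m ∸ d u) (m+n∸m≡n (d u) 4) (∸-monoˡ-≤ (d u) d+4≤m)

      2+c : 2 + c ≡ m ∸ d u
      2+c = m+[n∸m]≡n (≤-trans (s≤s (s≤s z≤n)) 4≤)

      t+c : d u + (2 + c) ≡ m
      t+c = trans (cong (d u +_) 2+c) (m+[n∸m]≡n du≤m)

      q≤du : 2 + c ≤ d u
      q≤du = +-cancelˡ-≤ (d u) _ _ (subst₂ _≤_ (sym t+c) (cong (d u +_) (+-identityʳ (d u))) m≤)

      s′ : ℕ
      s′ = d u ∸ (2 + c)

      q+s≡ : 2 + c + s′ ≡ d u
      q+s≡ = m+[n∸m]≡n q≤du

      m≡ : 2 + c + s′ + (2 + c) ≡ m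
      m≡ = trans (cong (_+ (2 + c)) q+s≡) t+c

      s≤S : s′ ≤ S
      s≤S = +-cancelˡ-≤ (d u + (2 + c)) _ _ (subst₂ _≤_
        (trans (cong (d u +_) (trans (+-identityʳ (d u)) (sym q+s≡))) (sym (+-assoc (d u) (2 + c) s′)))
        (cong (_+ S) (sym t+c)) (deg≤ u))

      2≤c : 2 ≤ c
      2≤c = ∸-monoˡ-≤ 2 4≤

      deg∸1≤c : ∀ {w} → w ≢ u → d w ∸ 1 ≤ c
      deg∸1≤c {w} w≢u with others w≢u
      ... | inj₂ h = ≤-trans (∸-monoˡ-≤ 1 h) (≤-trans (s≤s z≤n) 2≤c)
      ... | inj₁ h = ≤-trans (∸-monoˡ-≤ 1 (≤-trans (≤-reflexive (sym (m+n∸m≡n (d u) (d w)))) (∸-monoˡ-≤ (d u) h)))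
                             (≤-reflexive same)
        where
        lem : ∀ k → 1 + k + 1 ≡ k + 2
        lem = solve-∀
        same : m ∸ 1 ∸ d u ∸ 1 ≡ c
        same = trans (cong (_∸ 1) (∸-+-assoc m 1 (d u))) (trans (∸-+-assoc m (1 + d u) 1)
                 (trans (cong (m ∸_) (lem (d u))) (sym (∸-+-assoc m (d u) 2))))

      bound = sum-h≤ u≢v 3≤u 3≤v 2≤c deg∸1≤c

      r≤ : proj₁ bound ≤ 2 + c
      r≤ = +-cancelˡ-≤ (d u) _ _ (≤-trans (≤-reflexive (+-comm (d u) _))
        (≤-trans (+-cancelʳ-≤ 2 _ _ (≤-trans (proj₁ (proj₂ bound)) (≤-reflexive n≡m+2))) (≤-reflexive (sym t+c))))

    balanced-stars : ∀ {u v} → u ≢ v → 3 ≤ d u → 3 ≤ d v → (∀ w → 2 * d w < m) → countP3 G ≤ B n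
    balanced-stars {u} {v} u≢v 3≤u 3≤v half =
      B-bound s (≤-trans (≤-reflexive sum-h) (proj₂ (proj₂ bound)))
        (quadratic-balanced {m} {d u} {proj₁ bound} {c₀} size (≤c₀ (d u) (half u)) c₀≤)
      where
      bound : ∃ λ r → r + d u + 2 ≤ n × sum h ≤ tri (d u) + r * c₀
      bound = sum-h≤ {u} {v} {c₀} u≢v 3≤u 3≤v 2≤c₀ (λ {w} _ → ≤c₀ (d w) (half w))
      size : d u + proj₁ bound ≤ m
      size = +-cancelʳ-≤ 2 (d u + proj₁ bound) m (≤-trans (≤-reflexive (cong (_+ 2) (+-comm (d u) (proj₁ bound))))
               (≤-trans (proj₁ (proj₂ bound)) (≤-reflexive n≡m+2)))

    cases : Dec (∃ λ u → 3 ≤ d u) → countP3 G ≤ B n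
    cases (no h) = one-star (subst Fin (sym n≡) zero) (λ w _ → ≤-pred (≰⇒> (λ 3≤ → h (w , 3≤))))
    cases (yes (u , 3≤u)) with any? (λ v → ¬? (v ≟ u) ×-dec (3 ≤? d v))
    ... | no h = one-star u (λ w w≢u → ≤-pred (≰⇒> (λ 3≤ → h (w , w≢u , 3≤))))
    ... | yes (v , v≢u , 3≤v) with any? (λ w → m ≤? 2 * d w)
    ...   | no h = balanced-stars (v≢u ∘ sym) 3≤u 3≤v (λ w → ≰⇒> (λ m≤ → h (w , m≤)))
    ...   | yes (w , m≤) with u ≟ w
    ...     | yes refl = big-star (v≢u ∘ sym) 3≤u 3≤v m≤
    ...     | no u≢w   = big-star (u≢w ∘ sym) (*-cancelˡ-≤ 2 (≤-trans (m≤m+n 6 10) (≤-trans 16≤m m≤))) 3≤u m≤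

  -- With nothing uncovered, `big-count` and `n-count` force the two degrees to sum to `m`, and
  -- every other vertex is a leaf, whose `tri` vanishes.
  score-spanning : ∀ {G : Graph n} {u v} → Simple G → P4free G → u ≢ v → 3 ≤ deg G u → 3 ≤ deg G v →
    (∀ x → ¬ Unc G u v x) → deg G u ≤ suc (deg G v) → deg G v ≤ suc (deg G u) → countP3 G ≤ B n
  score-spanning {G} {u} {v} s free u≢v 3≤u 3≤v cov u≤ v≤ = *-cancelˡ-≤ 2 (≤-trans (≤-reflexive (countP3≡ s))
    (≤-trans (sum-mono pt) (≤-trans (≤-reflexive (trans (∑-distrib-+ {n} _ _)
      (cong₂ _+_ (sum-point u (λ w → tri (d w))) (sum-point v (λ w → tri (d w))))))
      (subst (λ k → tri (d u) + tri (d v) ≤ 2 * B k) (sym n≡) (B-balanced m {d u} {d v} u≤ v≤ (≤-antisym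
        (+-cancelʳ-≤ 2 _ _ (≤-trans (m≤m+n _ _) (≤-trans (big-count u≢v 3≤u 3≤v) (≤-reflexive n≡m+2))))
        (+-cancelʳ-≤ 2 _ _ (≤-trans (≤-reflexive (sym n≡m+2)) (≤-trans (n-count G u v)
          (≤-reflexive (trans (cong (d u + d v + 2 +_) (#-empty (unc? G u v) cov)) (+-identityʳ _))))))))))))
    where
    open Stars s free
    pt : ∀ w → tri (d w) ≤ ⟦ w ≟ u ⟧ * tri (d w) + ⟦ w ≟ v ⟧ * tri (d w)
    pt w with w ≟ u | w ≟ v | adj? G u w | adj? G v w
    ... | yes _ | _ | _ | _ = ≤-trans (≤-reflexive (sym (+-identityʳ _))) (m≤m+n _ _)
    ... | no _ | yes _ | _ | _ = ≤-reflexive (sym (+-identityʳ _))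
    ... | no _ | no _ | yes e | _ = tri-mono (leaf-deg 3≤u e)
    ... | no _ | no _ | _ | yes e = tri-mono (leaf-deg 3≤v e)
    ... | no a | no b | no c | no e = contradiction (a , b , c , e) (cov w)

-- Positions and dead pairs

all-or : ∀ {n} {P : Fin n → Set} {Q : Set} → (∀ x → P x ⊎ Q) → (∀ x → P x) ⊎ Q
all-or {zero}  h = inj₁ λ ()
all-or {suc n} h with h zero | all-or (h ∘ suc)
... | inj₂ q | _      = inj₂ q
... | inj₁ _ | inj₂ q = inj₂ q
... | inj₁ p | inj₁ f = inj₁ λ { zero → p ; (suc x) → f x }

module _ {n : ℕ} where

  Free : Graph n → Fin n → Set
  Free C x = ∀ y → ¬ Adj C x y

  abstract
    free? : ∀ C → Decidable (Free C)
    free? C x = all? (λ y → ¬? (adj? C x y))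

    neighbour : ∀ {C x} → ¬ Free C x → ∃ (Adj C x)
    neighbour {C} {x} ¬f with any? (adj? C x)
    ... | yes e = e
    ... | no ¬e = contradiction (λ y e → ¬e (y , e)) ¬f

  notFree? : ∀ C → Decidable (λ x → ¬ Free C x)
  notFree? C x = ¬? (free? C x)

  free-deg : ∀ {C x} → Free C x → deg C x ≡ 0
  free-deg {C} {x} f = #-empty (adj? C x) f

  -- The potential and its change under moves

  useful? : ∀ A C w → Decidable (λ x → Adj A w x × Free C x)
  useful? A C w x = adj? A w x ×-dec free? C x

  use : Graph n → Graph n → Fin n → ℕ
  use A C w = # (useful? A C w)

  opaque
    -- An exchange at `w` leaves it unchanged: Constructor's edge to an isolated vertex adds 2 and
    -- uses up one useful edge, and Blocker's answer removes another. Once no useful edge is left,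
    -- only the even number `2 * deg C w` remains.
    φ : Graph n → Graph n → Fin n → ℕ
    φ A C w = 2 * deg C w + use A C w

    φ≡ : ∀ A C w → φ A C w ≡ 2 * deg C w + use A C w
    φ≡ A C w = refl

  2deg≤φ : ∀ A C w → 2 * deg C w ≤ φ A C w
  2deg≤φ A C w = ≤-trans (m≤m+n (2 * deg C w) (use A C w)) (≤-reflexive (sym (φ≡ A C w)))

  φ-mono : ∀ {A C A′ C′ w w′} → 2 * deg C w + use A C w ≤ 2 * deg C′ w′ + use A′ C′ w′ → φ A C w ≤ φ A′ C′ w′
  φ-mono {A} {C} {A′} {C′} {w} {w′} h = subst₂ _≤_ (sym (φ≡ A C w)) (sym (φ≡ A′ C′ w′)) h

  _⊆ₑ_ : Graph n → Graph n → Set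
  G ⊆ₑ H = ∀ {x y : Fin n} → Adj G x y → Adj H x y

  -- True of every later position, whoever moved. `origin` makes losses permanent: a pair neither
  -- available nor claimed can never become an edge.
  record Future (A C A′ C′ : Graph n) : Set where
    field
      avail  : A′ ⊆ₑ A
      extend : C ⊆ₑ C′
      origin : ∀ {x y} → Adj C′ x y → Adj C x y ⊎ Adj A x y

  record Position (A C : Graph n) : Set where
    field
      simple : Simple (A ++ C)
      free   : P4free C

    simpleC : Simple C
    simpleC = simple-++ʳ A simple

  blocked-future : ∀ {A C A′} → A′ ⊆ₑ A → Future A C A′ C
  blocked-future h = record { avail = h ; extend = id ; origin = inj₁ }

  claimed-future : ∀ {a b A C A′} → Take a b A A′ → Future A C A′ ((a , b) ∷ C)
  claimed-future t = record { avail = t.sub ; extend = adj-∷ ; origin = λ e →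
    [ (λ q → inj₂ (same⇒adj q)) , inj₁ ]′ (adj-∷⁻ e) }
    where
    module t = Take t
    same⇒adj : ∀ {x y} → Same _ _ x y → Adj _ x y
    same⇒adj (inj₁ (refl , refl)) = t.was
    same⇒adj (inj₂ (refl , refl)) = adj-sym t.was

  free-future : ∀ {A C A′ C′ x} → Future A C A′ C′ → Free C′ x → Free C x
  free-future fut f y e = f y (Future.extend fut e)

  use-future : ∀ {A C A′ C′} → Future A C A′ C′ → ∀ w → use A′ C′ w ≤ use A C w
  use-future {A} {C} {A′} {C′} fut w = #-mono (useful? A′ C′ w) (useful? A C w)
    (λ (e , f) → Future.avail fut e , free-future fut f)

  use-shrink : ∀ {A C A′ C′} → Future A C A′ C′ → ∀ {w x} → Adj A w x → Free C x →
               ¬ (Adj A′ w x × Free C′ x) → suc (use A′ C′ w) ≤ use A C w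
  use-shrink {A} {C} {A′} {C′} fut {w} {x} e f gone = subst (_≤ use A C w)
    (trans (cong (use A′ C′ w +_) (#-point x)) (+-comm (use A′ C′ w) 1))
    (#-disjoint (useful? A′ C′ w) (_≟ x) (useful? A C w)
      (λ { u refl → gone u }) (λ (e , f) → Future.avail fut e , free-future fut f) (λ { refl → e , f }))

  φ-blocked : ∀ {A C A′} → A′ ⊆ₑ A → ∀ w → φ A′ C w ≤ φ A C w
  φ-blocked {A} {C} {A′} h w = φ-mono {A′} {C} {A} {C} (+-monoʳ-≤ (2 * deg C w) (use-future (blocked-future {C = C} h) w))

  φ≤ : ∀ {A C w} k → deg C w ≤ k → φ A C w ≤ 2 * k + n
  φ≤ {A} {C} {w} k h = ≤-trans (≤-reflexive (φ≡ A C w)) (+-mono-≤ (*-monoʳ-≤ 2 h) (#≤n (useful? A C w)))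

  -- Claiming the edge w w′ raises 2 deg w by two but uses up w′ as a useful neighbour,
  -- unless w′ already has an edge; then w can never be the centre of a large star.
  φ-claimed : ∀ {A C A′ C′} → Future A C A′ C′ → Simple C′ → P4free C′ → ∀ {w w′} → Adj A w w′ → ¬ Adj C w w′ →
              Adj C′ w w′ → deg C′ w ≤ suc (deg C w) →
              ∀ {M} → 4 + n ≤ M → φ A C w ≤ M → φ A′ C′ w ≤ suc M
  φ-claimed {A} {C} {A′} {C′} fut s free {w} {w′} ww′∈A ww′∉C ww′∈C′ d≤ {M} hM φ≤M with free? C w′
  ... | yes f = ≤-trans step (s≤s φ≤M)
    where
    lem₁ : ∀ d u → 2 * d + u + 1 ≡ 2 * d + suc u
    lem₁ = solve-∀
    lem₂ : ∀ d u → 2 * suc d + u ≡ suc (2 * d + u) + 1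
    lem₂ = solve-∀
    step : φ A′ C′ w ≤ suc (φ A C w)
    step = subst₂ (λ i j → i ≤ suc j) (sym (φ≡ A′ C′ w)) (sym (φ≡ A C w))
      (linear 1 (+-mono-≤ (*-monoʳ-≤ 2 d≤) (use-shrink fut ww′∈A f (λ (_ , f′) → f′ w (adj-sym ww′∈C′))))
        (lem₁ (deg C′ w) (use A′ C′ w)) (lem₂ (deg C w) (use A C w)))
  ... | no ¬f with neighbour ¬f
  ...   | z , w′z = ≤-trans (φ≤ {A′} {C′} 2 (Stars.deg≤2-end s free ww′∈C′ (Future.extend fut w′z)
                      (λ { refl → ww′∉C (adj-sym w′z) }))) (≤-trans hM (n≤1+n M))

  same-same : ∀ {a b p q r s : Fin n} → Same a b p q → Same a b r s → Same p q r s
  same-same (inj₁ (refl , refl)) h = h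
  same-same (inj₂ (refl , refl)) h = ⊎-swap h

  module Claim {a b : Fin n} {A A′ C : Graph n} (t : Take a b A A′) (pos : Position A C)
               (pos′ : Position A′ ((a , b) ∷ C)) where

    C′ : Graph n
    C′ = (a , b) ∷ C

    fut : Future A C A′ C′
    fut = claimed-future t

    open Position pos′ using () renaming (simpleC to s′; free to f′) public

    deg-C′ : ∀ w → deg C′ w ≡ ⟦ w ≟ a ⟧ + ⟦ w ≟ b ⟧ + deg C w
    deg-C′ = deg-∷ s′

    deg-suc : ∀ w → deg C′ w ≤ suc (deg C w)
    deg-suc w rewrite deg-C′ w with w ≟ a | w ≟ b
    ... | yes refl | yes refl = contradiction (adj-new {G = C}) (adj-irrefl s′)
    ... | yes _ | no _ = ≤-refl
    ... | no _ | yes _ = ≤-refl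
    ... | no _ | no _ = n≤1+n _

    deg-other : ∀ {w} → w ≢ a → w ≢ b → deg C′ w ≡ deg C w
    deg-other {w} w≢a w≢b rewrite deg-C′ w with w ≟ a | w ≟ b
    ... | yes e | _ = contradiction e w≢a
    ... | _ | yes e = contradiction e w≢b
    ... | no _ | no _ = refl

    deg-a : deg C′ a ≡ suc (deg C a)
    deg-a rewrite deg-C′ a with a ≟ a | a ≟ b
    ... | no h | _ = contradiction refl h
    ... | _ | yes refl = contradiction (adj-new {G = C}) (adj-irrefl s′)
    ... | yes _ | no _ = refl

    deg-b : deg C′ b ≡ suc (deg C b)
    deg-b rewrite deg-C′ b with b ≟ a | b ≟ b
    ... | _ | no h = contradiction refl h
    ... | yes refl | _ = contradiction (adj-new {G = C}) (adj-irrefl s′)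
    ... | no _ | yes _ = refl

    deg-end : ∀ {x y} → Same a b x y → deg C′ x ≡ suc (deg C x)
    deg-end (inj₁ (refl , refl)) = deg-a
    deg-end (inj₂ (refl , refl)) = deg-b

    deg-off : ∀ {w x y} → Same a b x y → w ≢ x → w ≢ y → deg C′ w ≡ deg C w
    deg-off (inj₁ (refl , refl)) w≢x w≢y = deg-other w≢x w≢y
    deg-off (inj₂ (refl , refl)) w≢x w≢y = deg-other w≢y w≢x

    φ-other : ∀ {w} → w ≢ a → w ≢ b → φ A′ C′ w ≤ φ A C w
    φ-other {w} w≢a w≢b = φ-mono {A′} {C′} {A} {C} (+-mono-≤ (≤-reflexive (cong (2 *_) (deg-other w≢a w≢b))) (use-future fut w))

    φ-step : ∀ {M} → 4 + n ≤ M → ∀ w → φ A C w ≤ M → φ A′ C′ w ≤ suc M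
    φ-step {M} hM w h with w ≟ a | w ≟ b
    ... | yes refl | _ = φ-claimed fut s′ f′ (Take.was t) (simple-fresh s′) (adj-new {G = C}) (deg-suc a) hM h
    ... | _ | yes refl = φ-claimed fut s′ f′ (adj-sym (Take.was t)) (simple-fresh s′ ∘ adj-sym)
                           (adj-sym (adj-new {G = C})) (deg-suc b) hM h
    ... | no w≢a | no w≢b = ≤-trans (φ-other w≢a w≢b) (≤-trans h (n≤1+n M))

    new : ∀ {x y} → Adj C′ x y → ¬ Adj C x y → Same a b x y
    new e ¬e with adj-∷⁻ e
    ... | inj₁ q = q
    ... | inj₂ e′ = contradiction e′ ¬e

  -- Measures how early the game still is: each claim touches at most two new vertices.
  record Small (k : ℕ) (C : Graph n) : Set where
    constructor small≤
    field touched : # (notFree? C) ≤ k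

  small-weaken : ∀ {k j C} → k ≤ j → Small k C → Small j C
  small-weaken k≤j (small≤ h) = small≤ (≤-trans h k≤j)

  small-deg : ∀ {k C} → Small k C → ∀ w → deg C w ≤ k
  small-deg {k} {C} (small≤ h) w = ≤-trans (#-mono (adj? C w) (notFree? C) (λ e f → f w (adj-sym e))) h

  small-frees : ∀ {k C} → Small k C → n ≤ k + # (free? C)
  small-frees {k} {C} (small≤ h) = ≤-trans (#-cover-n (notFree? C) (free? C) cases) (+-monoˡ-≤ (# (free? C)) h)
    where
    cases : ∀ x → ¬ Free C x ⊎ Free C x
    cases x with free? C x
    ... | yes f = inj₂ f
    ... | no ¬f = inj₁ ¬f

  small-free : ∀ {k C} → k < n → Small k C → ∃ (Free C)
  small-free {k} {C} k<n h = #-inhabited (free? C) (+-cancelˡ-≤ k _ _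
    (≤-trans (≤-reflexive (+-comm k 1)) (≤-trans k<n (small-frees h))))

  small-[] : Small 0 []
  small-[] = small≤ (≤-reflexive (#-empty (notFree? []) (λ x ¬f → ¬f λ { y (inj₁ ()) ; y (inj₂ ()) })))

  small-∷ : ∀ {k C a b} → Small k C → Small (2 + k) ((a , b) ∷ C)
  small-∷ {k} {C} {a} {b} (small≤ h) = small≤ (≤-trans (#-cover (_≟ a) R? (notFree? _) cases)
    (≤-trans (+-mono-≤ (≤-reflexive (#-point a)) (≤-trans (#-cover (_≟ b) (notFree? C) R? id)
      (+-mono-≤ (≤-reflexive (#-point b)) h))) ≤-refl))
    where
    R? : Decidable (λ x → x ≡ b ⊎ ¬ Free C x)
    R? x = (x ≟ b) ⊎-dec notFree? C x
    cases : ∀ {x} → ¬ Free ((a , b) ∷ C) x → x ≡ a ⊎ x ≡ b ⊎ ¬ Free C x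
    cases ¬f with neighbour ¬f
    ... | y , e with adj-∷⁻ e
    ...   | inj₁ (inj₁ (x≡a , _)) = inj₁ x≡a
    ...   | inj₁ (inj₂ (x≡b , _)) = inj₂ (inj₁ x≡b)
    ...   | inj₂ e′ = inj₂ (inj₂ λ f → f y e′)

  -- A path `p y z` caps the degree of `p` at two in this and every later P₄-free graph, by
  -- `deg≤2-end`.
  NonCentre : Graph n → Fin n → Set
  NonCentre C p = ∃ λ y → ∃ λ z → Adj C p y × Adj C y z × z ≢ p

  Gone : Graph n → Graph n → Fin n → Fin n → Set
  Gone A C x y = ¬ Adj A x y × ¬ Adj C x y

  -- Either `y` has an edge to a third vertex, so that joining it to a centre would spoil that
  -- centre, or both edges towards the centres have gone to Blocker.
  Escapes : Graph n → Graph n → Fin n → Fin n → Fin n → Set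
  Escapes A C p q y = y ≢ p × y ≢ q ×
    ((∃ λ z → Adj C y z × z ≢ p × z ≢ q) ⊎ (Gone A C p y × Gone A C q y))

  -- Certifies that the final graph is not a pair of spanning stars centred at p and q.
  data Dead (A C : Graph n) (p q : Fin n) : Set where
    first  : NonCentre C p → Dead A C p q
    second : NonCentre C q → Dead A C p q
    escape : ∀ y → Escapes A C p q y → Dead A C p q

  Lost : Graph n → Graph n → Set
  Lost A C = ∀ {p q} → p ≢ q → Dead A C p q

  dead-sym : ∀ {A C p q} → Dead A C p q → Dead A C q p
  dead-sym (first h)  = second h
  dead-sym (second h) = first h
  dead-sym (escape y (y≢p , y≢q , inj₁ (z , yz , z≢p , z≢q))) = escape y (y≢q , y≢p , inj₁ (z , yz , z≢q , z≢p))
  dead-sym (escape y (y≢p , y≢q , inj₂ (gp , gq))) = escape y (y≢q , y≢p , inj₂ (gq , gp))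

  module _ {A C A′ C′ : Graph n} (fut : Future A C A′ C′) where

    open Future fut

    gone-future : ∀ {x y} → Gone A C x y → Gone A′ C′ x y
    gone-future (a , c) = a ∘ avail , λ e → [ c , a ]′ (origin e)

    nonCentre-future : ∀ {p} → NonCentre C p → NonCentre C′ p
    nonCentre-future (y , z , py , yz , z≢p) = y , z , extend py , extend yz , z≢p

    dead-future : ∀ {p q} → Dead A C p q → Dead A′ C′ p q
    dead-future (first h)  = first (nonCentre-future h)
    dead-future (second h) = second (nonCentre-future h)
    dead-future (escape y (y≢p , y≢q , inj₁ (z , yz , z≢))) = escape y (y≢p , y≢q , inj₁ (z , extend yz , z≢))
    dead-future (escape y (y≢p , y≢q , inj₂ (gp , gq))) = escape y (y≢p , y≢q , inj₂ (gone-future gp , gone-future gq))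

  dead-edge : ∀ {A C p q c d} → Adj C c d → c ≢ p → c ≢ q → d ≢ p → d ≢ q → Dead A C p q
  dead-edge {c = c} {d} cd c≢p c≢q d≢p d≢q = escape c (c≢p , c≢q , inj₁ (d , cd , d≢p , d≢q))

  -- A vertex of degree two lies in every live pair. Either one of the two edges at `v` misses both
  -- `p` and `q`, or `p v q` is a path and `p` can no longer be a centre.
  dead-centre : ∀ {A C p q v x y} → Adj C v x → Adj C v y → y ≢ x → v ≢ p → v ≢ q → p ≢ q → Dead A C p q
  dead-centre {p = p} {q} {v} {x} {y} vx vy y≢x v≢p v≢q p≢q with x ≟ p | x ≟ q | y ≟ p | y ≟ q
  ... | no x≢p | no x≢q | _ | _ = dead-edge vx v≢p v≢q x≢p x≢q
  ... | _ | _ | no y≢p | no y≢q = dead-edge vy v≢p v≢q y≢p y≢q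
  ... | yes refl | _ | yes refl | _ = contradiction refl y≢x
  ... | _ | yes refl | _ | yes refl = contradiction refl y≢x
  ... | yes refl | _ | no _ | yes refl = first (v , y , adj-sym vx , vy , y≢x)
  ... | no _ | yes refl | yes refl | _ = first (v , x , adj-sym vy , vx , y≢x ∘ sym)

  module _ {A C : Graph n} (pos : Position A C) where

    open Position pos
    open Stars simpleC free

    Pair : Fin n → Fin n → Set
    Pair p q = deg C p ≤ 2 ⊎ deg C q ≤ 2 ⊎ ∃ (Unc C p q)

    -- Translates a certificate into the condition `score` asks for, already now, since the game may
    -- stop here. If the escaping vertex has meanwhile been joined to a centre, that centre has
    -- degree at most two.
    dead-pair : ∀ {p q} → Dead A C p q → Pair p q
    dead-pair (first (y , z , py , yz , z≢p))  = inj₁ (deg≤2-end py yz z≢p)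
    dead-pair (second (y , z , qy , yz , z≢q)) = inj₂ (inj₁ (deg≤2-end qy yz z≢q))
    dead-pair (escape y (y≢p , y≢q , inj₂ ((_ , ¬py) , (_ , ¬qy)))) = inj₂ (inj₂ (y , y≢p , y≢q , ¬py , ¬qy))
    dead-pair {p} {q} (escape y (y≢p , y≢q , inj₁ (z , yz , z≢p , z≢q))) with adj? C p y | adj? C q y
    ... | yes py | _ = inj₁ (deg≤2-end py yz z≢p)
    ... | _ | yes qy = inj₂ (inj₁ (deg≤2-end qy yz z≢q))
    ... | no ¬py | no ¬qy = inj₂ (inj₂ (y , y≢p , y≢q , ¬py , ¬qy))

    -- An isolated vertex is uncovered unless it is `p` or `q` itself, which then has degree zero.
    -- Stopping while one exists is therefore harmless to Blocker.
    free-pair : ∀ {x} → Free C x → ∀ p q → Pair p q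
    free-pair {x} f p q with x ≟ p | x ≟ q
    ... | yes refl | _ = inj₁ (≤-trans (≤-reflexive (free-deg f)) z≤n)
    ... | _ | yes refl = inj₂ (inj₁ (≤-trans (≤-reflexive (free-deg f)) z≤n))
    ... | no x≢p | no x≢q = inj₂ (inj₂ (x , x≢p , x≢q , (λ e → f p (adj-sym e)) , (λ e → f q (adj-sym e))))

  module _ {A C : Graph n} {b₀ : ℕ} (pos : Position A C) where

    open Position pos

    private
      blocked : ∀ {e A′} → (e , A′) ∈ picks A → Position A′ C
      blocked q∈ = record { simple = take-blocker simple (picks-↭ q∈) ; free = free }

    block-at : ∀ k {a b} → Adj A a b → countP3 C ≤ b₀ →
               (∀ {A′} → Take a b A A′ → Position A′ C → value k constructor′ A′ C ≤ b₀) →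
               value (suc k) blocker A C ≤ b₀
    block-at k (inj₁ e) c≤ h with ∈-picks e
    ... | A′ , q∈ = value-blocker≤ k q∈ (h (take simple (picks-↭ q∈)) (blocked q∈)) c≤
    block-at k (inj₂ e) c≤ h with ∈-picks e
    ... | A′ , q∈ = value-blocker≤ k q∈ (h (take-flip (take simple (picks-↭ q∈))) (blocked q∈)) c≤

    claim : ∀ k → countP3 C ≤ b₀ →
            (∀ {a b A′} → Take a b A A′ → Position A′ ((a , b) ∷ C) → value k blocker A′ ((a , b) ∷ C) ≤ b₀) →
            value (suc k) constructor′ A C ≤ b₀
    claim k c≤ h = value-constructor≤ k c≤ λ {q} q∈ legal → h (take simple (picks-↭ q∈))
      (record { simple = take-constructor simple (picks-↭ q∈)
              ; free = legal⇒P4free {q = q} (simple-++ʳ (proj₂ q) (take-constructor simple (picks-↭ q∈))) legal })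

  block-any : ∀ {A C : Graph n} {b₀} → Position A C → ∀ k → countP3 C ≤ b₀ →
              (∀ {A′} → A′ ⊆ₑ A → Position A′ C → value k constructor′ A′ C ≤ b₀) →
              value (suc k) blocker A C ≤ b₀
  block-any {[]}    pos k c≤ h = c≤
  block-any {e ∷ A} pos k c≤ h = block-at pos k (adj-new {G = A}) c≤ (λ t → h (Take.sub t))

-- Blocker's strategy

-- N bounds φ throughout and P bounds it while Constructor builds a single star; both are even, so that
-- 2 deg w ≤ suc N improves to 2 deg w ≤ N.
record Sizes (n m S N P T : ℕ) : Set where
  field
    n≡    : n ≡ 2 + m
    S²    : S * S + S ≤ m
    hS    : 2 * S + 16 ≤ m
    hP₁   : 12 + n ≤ P
    hP₂   : P ≤ 13 + n
    hN₁   : 100 + n ≤ N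
    hN₂   : suc N ≤ m + S
    evenP : ∀ d → 2 * d ≤ suc P → 2 * d ≤ P
    evenN : ∀ d → 2 * d ≤ suc N → 2 * d ≤ N
    hn    : 100 ≤ n
    B≤T   : B n ≤ T

module Strategy {n m S N P T : ℕ} (sizes : Sizes n m S N P T) where

  open Sizes sizes
  open Score {n} {m} {S} n≡ S² hS

  +n≤N : ∀ c {d} → c + d ≡ 100 → c + n ≤ N
  +n≤N c {d} eq = ≤-trans (+-monoˡ-≤ n (subst (c ≤_) eq (m≤m+n c d))) hN₁

  count : ∀ {A C : Graph n} (pos : Position A C) → (∀ w → φ A C w ≤ suc N) →
          (∀ {p q} → p ≢ q → Pair pos p q) → countP3 C ≤ T
  count {A} {C} pos h pairs = ≤-trans
    (score (Position.simpleC pos) (Position.free pos) (λ w → ≤-trans (2deg≤φ A C w) (≤-trans (h w) hN₂)) pairs) B≤T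

  -- Taking an edge from `w` to an isolated vertex lowers `φ` by one. If there is none, `φ` equals
  -- `2 * deg C w`, and parity improves `suc M` to `M` without a useful move.
  reply : ∀ {A C : Graph n} {b₀} → Position A C → ∀ k w M → (∀ d → 2 * d ≤ suc M → 2 * d ≤ M) → φ A C w ≤ suc M → countP3 C ≤ b₀ →
          (∀ {A′ : Graph n} → A′ ⊆ₑ A → Position A′ C → φ A′ C w ≤ M → value k constructor′ A′ C ≤ b₀) →
          value (suc k) blocker A C ≤ b₀
  reply {A} {C} pos k w M even hφ c≤ h with any? (useful? A C w)
  ... | yes (x , e , f) = block-at pos k e c≤ λ t pos′ → h (Take.sub t) pos′ (drop t)
    where
    drop : ∀ {A′ : Graph n} → Take w x A A′ → φ A′ C w ≤ M
    drop {A′} t = ≤-pred (≤-trans (≤-reflexive (trans (cong suc (φ≡ A′ C w)) (sym (+-suc (2 * deg C w) (use A′ C w)))))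
      (≤-trans (+-monoʳ-≤ (2 * deg C w) (use-shrink (blocked-future {C = C} (Take.sub t)) e f (λ (e′ , _) → Take.gone t e′)))
      (≤-trans (≤-reflexive (sym (φ≡ A C w))) hφ)))
  ... | no ¬u = block-any pos k c≤ λ {A′} sub pos′ → h sub pos′ (≤-trans (φ-blocked sub w) stuck)
    where
    stuck : φ A C w ≤ M
    stuck = ≤-trans (≤-reflexive (trans (φ≡ A C w) (trans
        (cong (2 * deg C w +_) (#-empty (useful? A C w) (λ x u → ¬u (x , u)))) (+-identityʳ (2 * deg C w)))))
      (even (deg C w) (≤-trans (2deg≤φ A C w) hφ))

  -- Of the two ends of a claimed edge one has degree at most two, hence `φ` at most `4 + n`. So
  -- only one vertex can exceed `N`, and by one; a single reply there restores the bound.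
  lost-constructor : ∀ k {A C : Graph n} → Position A C → Lost A C → (∀ w → φ A C w ≤ N) →
                     value k constructor′ A C ≤ T
  lost-blocker : ∀ k {A C : Graph n} → Position A C → Lost A C → ∀ w → φ A C w ≤ suc N →
                 (∀ {w′} → w′ ≢ w → φ A C w′ ≤ N) → value k blocker A C ≤ T

  lost-constructor k {A} {C} pos lost hφ = go k
    where
    c≤ : countP3 C ≤ T
    c≤ = count pos (λ w → m≤n⇒m≤1+n (hφ w)) (λ p≢q → dead-pair pos (lost p≢q))
    go : ∀ k → value k constructor′ A C ≤ T
    go zero    = c≤
    go (suc k) = claim pos k c≤ after
      where
      after : ∀ {a b : Fin n} {A′ : Graph n} → Take a b A A′ → Position A′ ((a , b) ∷ C) → value k blocker A′ ((a , b) ∷ C) ≤ T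
      after {a} {b} {A′} t pos′ with Stars.deg≤2-edge (Position.simpleC pos′) (Position.free pos′) (adj-new {G = C})
      ... | inj₁ da = lost-blocker k pos′ (λ p≢q → dead-future fut (lost p≢q)) b (φ-step (+n≤N 4 refl) b (hφ b)) others
        where
        open Claim t pos pos′
        others : ∀ {w} → w ≢ b → φ A′ C′ w ≤ N
        others {w} w≢b with w ≟ a
        ... | yes refl = ≤-trans (φ≤ {A = A′} {C = C′} 2 da) (+n≤N 4 refl)
        ... | no w≢a = ≤-trans (φ-other w≢a w≢b) (hφ w)
      ... | inj₂ db = lost-blocker k pos′ (λ p≢q → dead-future fut (lost p≢q)) a (φ-step (+n≤N 4 refl) a (hφ a)) others
        where
        open Claim t pos pos′
        others : ∀ {w} → w ≢ a → φ A′ C′ w ≤ N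
        others {w} w≢a with w ≟ b
        ... | yes refl = ≤-trans (φ≤ {A = A′} {C = C′} 2 db) (+n≤N 4 refl)
        ... | no w≢b = ≤-trans (φ-other w≢a w≢b) (hφ w)

  lost-blocker k {A} {C} pos lost w hw hφ = go k
    where
    all : ∀ w′ → φ A C w′ ≤ suc N
    all w′ with w′ ≟ w
    ... | yes refl = hw
    ... | no w′≢w = m≤n⇒m≤1+n (hφ w′≢w)
    c≤ : countP3 C ≤ T
    c≤ = count pos all (λ p≢q → dead-pair pos (lost p≢q))
    go : ∀ k → value k blocker A C ≤ T
    go zero    = c≤
    go (suc k) = reply pos k w N evenN hw c≤ λ {A′} sub pos′ hw′ →
      lost-constructor k pos′ (λ p≢q → dead-future (blocked-future sub) (lost p≢q)) (all′ sub hw′)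
      where
      all′ : ∀ {A′ : Graph n} → A′ ⊆ₑ A → φ A′ C w ≤ N → ∀ w′ → φ A′ C w′ ≤ N
      all′ sub hw′ w′ with w′ ≟ w
      ... | yes refl = hw′
      ... | no w′≢w = ≤-trans (φ-blocked sub w′) (hφ w′≢w)

  -- Centres and leaves already exhaust the vertices, so `big-count` leaves no room for either
  -- degree to grow and the balance is frozen.
  spanning : ∀ k p {A C : Graph n} {u v : Fin n} → Position A C → u ≢ v → 3 ≤ deg C u → 3 ≤ deg C v → (∀ x → ¬ Unc C u v x) →
             deg C u ≤ suc (deg C v) → deg C v ≤ suc (deg C u) → value k p A C ≤ T
  spanning k p {A} {C} {u} {v} pos u≢v 3≤u 3≤v cov u≤ v≤ = go k p
    where
    c≤ : countP3 C ≤ T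
    c≤ = ≤-trans (score-spanning (Position.simpleC pos) (Position.free pos) u≢v 3≤u 3≤v cov u≤ v≤) B≤T
    go : ∀ k p → value k p A C ≤ T
    go zero    p = c≤
    go (suc k) blocker = block-any pos k c≤ λ _ pos′ → spanning k constructor′ pos′ u≢v 3≤u 3≤v cov u≤ v≤
    go (suc k) constructor′ = claim pos k c≤ λ {a} {b} {A′} t pos′ → after t pos′
      where
      after : ∀ {a b : Fin n} {A′ : Graph n} → Take a b A A′ → Position A′ ((a , b) ∷ C) → value k blocker A′ ((a , b) ∷ C) ≤ T
      after {a} {b} t pos′ = spanning k blocker pos′ u≢v (≤-trans 3≤u u↑) (≤-trans 3≤v v↑)
          (λ x (x≢u , x≢v , ¬ux , ¬vx) → cov x (x≢u , x≢v , ¬ux ∘ adj-∷ , ¬vx ∘ adj-∷))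
          (subst₂ (λ i j → i ≤ suc j) (sym u≡) (sym v≡) u≤) (subst₂ (λ i j → i ≤ suc j) (sym v≡) (sym u≡) v≤)
        where
        open Claim t pos pos′
        u↑ : deg C u ≤ deg C′ u
        u↑ = #-mono (adj? C u) (adj? C′ u) adj-∷
        v↑ : deg C v ≤ deg C′ v
        v↑ = #-mono (adj? C v) (adj? C′ v) adj-∷
        total : deg C′ u + deg C′ v ≤ deg C u + deg C v
        total = +-cancelʳ-≤ 2 _ _ (≤-trans (m≤m+n _ _) (≤-trans
          (Stars.big-count s′ f′ u≢v (≤-trans 3≤u u↑) (≤-trans 3≤v v↑))
          (≤-trans (n-count C u v) (≤-reflexive (trans (cong (deg C u + deg C v + 2 +_) (#-empty (unc? C u v) cov)) (+-identityʳ _))))))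
        u≡ : deg C′ u ≡ deg C u
        u≡ = ≤-antisym (+-cancelʳ-≤ (deg C v) _ _ (≤-trans (+-monoʳ-≤ (deg C′ u) v↑) total)) u↑
        v≡ : deg C′ v ≡ deg C v
        v≡ = ≤-antisym (+-cancelˡ-≤ (deg C u) _ _ (≤-trans (+-monoˡ-≤ (deg C′ v) u↑) total)) v↑

  -- One live pair: balancing two stars

  -- The only pair that can still become the centres of two spanning stars is {u, v}.
  record Two (u v : Fin n) (A C : Graph n) : Set where
    field
      u≢v    : u ≢ v
      u-nbr  : ∃ λ x → Adj C u x × x ≢ v
      v-nbr  : ∃ λ x → Adj C v x × x ≢ u
      others : ∀ {p q} → p ≢ q → Dead A C p q ⊎ Same u v p q
      bound  : ∀ w → φ A C w ≤ N

    lost : Dead A C u v → Lost A C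
    lost dead p≢q with others p≢q
    ... | inj₁ d = d
    ... | inj₂ (inj₁ (refl , refl)) = dead
    ... | inj₂ (inj₂ (refl , refl)) = dead-sym dead

    unc-pair : (pos : Position A C) → ∃ (Unc C u v) → ∀ {p q} → p ≢ q → Pair pos p q
    unc-pair pos (x , unc@(a , b , c , d)) p≢q with others p≢q
    ... | inj₁ dead = dead-pair pos dead
    ... | inj₂ (inj₁ (refl , refl)) = inj₂ (inj₂ (x , unc))
    ... | inj₂ (inj₂ (refl , refl)) = inj₂ (inj₂ (x , b , a , d , c))

  two-sym : ∀ {u v : Fin n} {A C : Graph n} → Two u v A C → Two v u A C
  two-sym two = record
    { u≢v = u≢v ∘ sym ; u-nbr = v-nbr ; v-nbr = u-nbr ; bound = bound
    ; others = λ p≢q → ⊎-map id [ (λ (a , b) → inj₂ (a , b)) , (λ (a , b) → inj₁ (a , b)) ]′ (others p≢q) }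
    where open Two two

  -- The constant 24 only keeps `φ` bounded. The conditions involving `unc?` say that the uncovered
  -- vertices suffice to level the stars up to one leaf; when none remains they give the final
  -- balance.
  record Balanced (u v : Fin n) (C : Graph n) : Set where
    field
      u≤v : deg C u ≤ 24 + deg C v
      v≤u : deg C v ≤ 24 + deg C u
      u≤r : deg C u ≤ suc (deg C v + # (unc? C u v))
      v≤r : deg C v ≤ suc (deg C u + # (unc? C u v))

  unc-sym : ∀ {C : Graph n} {u v x : Fin n} → Unc C u v x → Unc C v u x
  unc-sym (a , b , c , d) = b , a , d , c

  balanced-sym : ∀ {u v : Fin n} {C : Graph n} → Balanced u v C → Balanced v u C
  balanced-sym {u} {v} {C} bal = record
    { u≤v = v≤u ; v≤u = u≤v
    ; u≤r = ≤-trans v≤r (s≤s (+-monoʳ-≤ _ r≤))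
    ; v≤r = ≤-trans u≤r (s≤s (+-monoʳ-≤ _ r≤)) }
    where
    open Balanced bal
    r≤ : # (unc? C u v) ≤ # (unc? C v u)
    r≤ = #-mono (unc? C u v) (unc? C v u) unc-sym

  -- The threat that forces Constructor's answers: on his turn Blocker takes the other edge to `x`,
  -- and the last live pair dies.
  HalfBlocked : Fin n → Fin n → Graph n → Graph n → Set
  HalfBlocked u v A C = ∃ λ x → Unc C u v x × (¬ Adj A u x ⊎ ¬ Adj A v x)

  two-dead : ∀ k {u v : Fin n} {A C : Graph n} → Position A C → Two u v A C → Dead A C u v → value k blocker A C ≤ T
  two-dead k {u} pos two dead = lost-blocker k pos (lost dead) u (m≤n⇒m≤1+n (bound u)) (λ {w} _ → bound w)
    where open Two two

  two-win : ∀ k {u v : Fin n} {A C : Graph n} {x : Fin n} → Position A C → Two u v A C → Unc C u v x → ¬ Adj A u x → value k blocker A C ≤ T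
  two-win k {u} {v} {A} {C} {x} pos two unc@(x≢u , x≢v , ¬ux , ¬vx) ¬A with adj? A v x
  ... | no ¬A′ = two-dead k pos two (escape x (x≢u , x≢v , inj₂ ((¬A , ¬ux) , (¬A′ , ¬vx))))
  ... | yes e = go k
    where
    open Two two
    c≤ : countP3 C ≤ T
    c≤ = count pos (λ w → m≤n⇒m≤1+n (bound w)) (unc-pair pos (x , unc))
    go : ∀ k → value k blocker A C ≤ T
    go zero    = c≤
    go (suc k) = block-at pos k e c≤ λ {A′} t pos′ →
      lost-constructor k pos′ (after t) (λ w → ≤-trans (φ-blocked (Take.sub t) w) (bound w))
      where
      after : ∀ {A′ : Graph n} → Take v x A A′ → Lost A′ C
      after t p≢q with others p≢q
      ... | inj₁ d = dead-future (blocked-future (Take.sub t)) d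
      ... | inj₂ (inj₁ (refl , refl)) = escape x (x≢u , x≢v , inj₂ ((¬A ∘ Take.sub t , ¬ux) , (Take.gone t , ¬vx)))
      ... | inj₂ (inj₂ (refl , refl)) = escape x (x≢v , x≢u , inj₂ ((Take.gone t , ¬vx) , (¬A ∘ Take.sub t , ¬ux)))

  half-blocked-win : ∀ k {u v : Fin n} {A C : Graph n} → Position A C → Two u v A C → HalfBlocked u v A C → value k blocker A C ≤ T
  half-blocked-win k pos two (x , unc , inj₁ h) = two-win k pos two unc h
  half-blocked-win k pos two (x , unc , inj₂ h) = two-win k pos (two-sym two) (unc-sym unc) h

  data Status (u v : Fin n) (A C : Graph n) (x : Fin n) : Set where
    is-u   : x ≡ u → Status u v A C x
    is-v   : x ≡ v → Status u v A C x
    leaf-u : Adj C u x → (∀ {z} → Adj C x z → z ≡ u) → Status u v A C x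
    leaf-v : Adj C v x → (∀ {z} → Adj C x z → z ≡ v) → Status u v A C x
    open-x : Free C x → Adj A u x → Adj A v x → Status u v A C x

  -- Apart from a possible edge `u v`, any deviation from two disjoint stars with every uncovered
  -- vertex isolated and reachable from both centres is itself a certificate or a half-blocked
  -- vertex, so it ends this phase at once.
  status : ∀ (u v : Fin n) (A C : Graph n) → u ≢ v → ∀ x → Status u v A C x ⊎ (Dead A C u v ⊎ HalfBlocked u v A C)
  status u v A C u≢v x with x ≟ u | x ≟ v
  ... | yes e | _ = inj₁ (is-u e)
  ... | _ | yes e = inj₁ (is-v e)
  ... | no x≢u | no x≢v with adj? C u x | adj? C v x
  ...   | yes ux | _ = leaf (any? (λ z → adj? C x z ×-dec ¬? (z ≟ u)))
    where
    leaf : Dec (∃ λ z → Adj C x z × z ≢ u) → _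
    leaf (yes (z , xz , z≢u)) = inj₂ (inj₁ (first (x , z , ux , xz , z≢u)))
    leaf (no h) = inj₁ (leaf-u ux (λ {z} xz → decidable-stable (z ≟ u) (λ z≢u → h (z , xz , z≢u))))
  ...   | no _ | yes vx = leaf (any? (λ z → adj? C x z ×-dec ¬? (z ≟ v)))
    where
    leaf : Dec (∃ λ z → Adj C x z × z ≢ v) → _
    leaf (yes (z , xz , z≢v)) = inj₂ (inj₁ (second (x , z , vx , xz , z≢v)))
    leaf (no h) = inj₁ (leaf-v vx (λ {z} xz → decidable-stable (z ≟ v) (λ z≢v → h (z , xz , z≢v))))
  ...   | no ¬ux | no ¬vx with adj? A u x | adj? A v x | free? C x
  ...     | no ¬e | _ | _ = inj₂ (inj₂ (x , (x≢u , x≢v , ¬ux , ¬vx) , inj₁ ¬e))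
  ...     | yes _ | no ¬e | _ = inj₂ (inj₂ (x , (x≢u , x≢v , ¬ux , ¬vx) , inj₂ ¬e))
  ...     | yes e | yes e′ | yes f = inj₁ (open-x f e e′)
  ...     | yes _ | yes _ | no ¬f with neighbour ¬f
  ...       | z , xz = inj₂ (inj₁ (escape x (x≢u , x≢v , inj₁ (z , xz ,
                (λ { refl → ¬ux (adj-sym xz) }) , (λ { refl → ¬vx (adj-sym xz) })))))

  -- The useful neighbours of a centre are uncovered, and both degrees plus the uncovered vertices
  -- number at most `n`; so `φ` exceeds `n` by no more than the imbalance. Being recomputed every
  -- round, the bound does not build up although Blocker no longer replies to each claim.
  tight-φ : ∀ {u v : Fin n} {A C : Graph n} → Position A C → Two u v A C → Balanced u v C → ¬ Adj C u v →
            (∀ x → Status u v A C x) → ∀ w → φ A C w ≤ 24 + n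
  tight-φ {u} {v} {A} {C} pos two bal ¬uv st w = cases (st w)
    where
    open Two two
    open Position pos
    small : ∀ {k} → deg C w ≤ k → 2 * k ≤ 24 → φ A C w ≤ 24 + n
    small {k} h h′ = ≤-trans (φ≤ {A = A} {C = C} k h) (+-monoˡ-≤ n h′)
    disjoint : ∀ {x} → Adj C u x → ¬ Adj C v x
    disjoint {x} ux vx with st x
    ... | is-u refl = adj-irrefl simpleC ux
    ... | is-v refl = ¬uv ux
    ... | leaf-u _ h = u≢v (sym (h (adj-sym vx)))
    ... | leaf-v _ h = u≢v (h (adj-sym ux))
    ... | open-x f _ _ = f u (adj-sym ux)
    total : deg C u + deg C v + 2 + # (unc? C u v) ≤ n
    total = count-n simpleC u≢v ¬uv disjoint
    centre : ∀ {p q} → (∀ {x} → Free C x → Adj A p x → Unc C u v x) → deg C p ≤ 24 + deg C q →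
             deg C p + deg C q ≡ deg C u + deg C v → φ A C p ≤ 24 + n
    centre {p} {q} h d≤ eq = ≤-trans (≤-reflexive (φ≡ A C p)) (≤-trans
      (+-monoʳ-≤ (2 * deg C p) (#-mono (useful? A C p) (unc? C u v) (λ (e , f) → h f e)))
      (≤-trans (linear (deg C q + 2) {2 * deg C p + # (unc? C u v)} {22 + n} (+-mono-≤ d≤ (subst (λ k → k + 2 + # (unc? C u v) ≤ n) (sym eq) total))
        (lem (deg C p) (# (unc? C u v)) (deg C q)) (lem′ (deg C q) n)) (m≤n+m (22 + n) 2)))
      where
      lem : ∀ p r q → 2 * p + r + (q + 2) ≡ p + (p + q + 2 + r)
      lem = solve-∀
      lem′ : ∀ q n → 24 + q + n ≡ 22 + n + (q + 2)
      lem′ = solve-∀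
    unc : ∀ {x} → x ≢ u → x ≢ v → Free C x → Unc C u v x
    unc x≢u x≢v f = x≢u , x≢v , (λ e → f u (adj-sym e)) , (λ e → f v (adj-sym e))
    not-u : ∀ {x} → Free C x → x ≢ u
    not-u f refl = f _ (proj₁ (proj₂ u-nbr))
    not-v : ∀ {x} → Free C x → x ≢ v
    not-v f refl = f _ (proj₁ (proj₂ v-nbr))
    cases : Status u v A C w → φ A C w ≤ 24 + n
    cases (is-u refl) = centre {u} {v} (λ f _ → unc (not-u f) (not-v f) f) (Balanced.u≤v bal) refl
    cases (is-v refl) = centre {v} {u} (λ f _ → unc (not-u f) (not-v f) f) (Balanced.v≤u bal) (+-comm (deg C v) (deg C u))
    cases (leaf-u _ h) = small {1} (≤-trans (#-mono (adj? C w) (_≟ u) h) (≤-reflexive (#-point u))) (m≤m+n 2 22)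
    cases (leaf-v _ h) = small {1} (≤-trans (#-mono (adj? C w) (_≟ v) h) (≤-reflexive (#-point v))) (m≤m+n 2 22)
    cases (open-x f _ _) = small {0} (≤-reflexive (free-deg f)) z≤n

  -- A forced round uses one uncovered vertex and adds a leaf to the star at `v`, so `deg C v` plus
  -- the number uncovered does not drop; `v` overtakes by at most one because its star was no
  -- larger. Any other answer leaves `y` half-blocked.
  two-larger : ∀ k {u v y : Fin n} {A C : Graph n} → Position A C → Two u v A C → Balanced u v C →
               (∀ w → φ A C w ≤ 24 + n) → Unc C u v y → Free C y → Adj A u y → deg C v ≤ deg C u →
               value k blocker A C ≤ T
  two-blocker : ∀ k {u v : Fin n} {A C : Graph n} → Position A C → Two u v A C →
                HalfBlocked u v A C ⊎ Balanced u v C → value k blocker A C ≤ T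

  two-larger k {u} {v} {y} {A} {C} pos two bal tight unc@(y≢u , y≢v , ¬uy , ¬vy) free-y uy∈A v≤u = go k
    where
    open Two two
    c≤ : countP3 C ≤ T
    c≤ = count pos (λ w → m≤n⇒m≤1+n (bound w)) (unc-pair pos (y , unc))
    module _ {A″ : Graph n} (tB : Take u y A A″) (pos″ : Position A″ C) where
      module _ {a b : Fin n} {A′ : Graph n} (t : Take a b A″ A′) (pos′ : Position A′ ((a , b) ∷ C)) where
        open Claim t pos″ pos′
        ¬uy∈A′ : ¬ Adj A′ u y
        ¬uy∈A′ = Take.gone tB ∘ Take.sub t
        ¬uy′ : ¬ Adj C′ u y
        ¬uy′ e = [ ¬uy , Take.gone tB ]′ (Future.origin fut e)
        two′ : Two u v A′ C′
        two′ = record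
          { u≢v = u≢v
          ; u-nbr = proj₁ u-nbr , adj-∷ (proj₁ (proj₂ u-nbr)) , proj₂ (proj₂ u-nbr)
          ; v-nbr = proj₁ v-nbr , adj-∷ (proj₁ (proj₂ v-nbr)) , proj₂ (proj₂ v-nbr)
          ; others = λ p≢q → ⊎-map (λ d → dead-future fut (dead-future (blocked-future (Take.sub tB)) d)) id (others p≢q)
          ; bound = λ w → ≤-trans (φ-step (+-monoˡ-≤ n (m≤m+n 4 20)) w (≤-trans (φ-blocked (Take.sub tB) w) (tight w)))
                                  (+n≤N 25 refl) }
        next : HalfBlocked u v A′ C′ ⊎ Balanced u v C′
        next with adj? C′ v y
        ... | no ¬vy′ = inj₁ (y , (y≢u , y≢v , ¬uy′ , ¬vy′) , inj₁ ¬uy∈A′)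
        ... | yes vy′ = inj₂ (record
            { u≤v = ≤-trans (≤-reflexive u≡) (≤-trans u≤v (+-monoʳ-≤ 24 (≤-trans (n≤1+n _) (≤-reflexive (sym v≡)))))
            ; v≤u = ≤-trans (≤-reflexive v≡) (≤-trans (s≤s v≤u) (≤-trans (m≤n+m (suc (deg C u)) 23)
                      (≤-reflexive (trans (+-suc 23 (deg C u)) (cong (24 +_) (sym u≡))))))
            ; u≤r = subst₂ (λ i j → i ≤ suc (j + # (unc? C′ u v))) (sym u≡) (sym v≡)
                      (≤-trans u≤r (s≤s (≤-trans (+-monoʳ-≤ (deg C v) r≤) (≤-reflexive (+-suc (deg C v) _)))))
            ; v≤r = subst₂ (λ i j → i ≤ suc (j + # (unc? C′ u v))) (sym v≡) (sym u≡)
                      (s≤s (≤-trans v≤u (m≤m+n (deg C u) _))) })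
          where
          open Balanced bal using (u≤v; u≤r)
          ends : Same a b v y
          ends = new vy′ ¬vy
          v≡ : deg C′ v ≡ suc (deg C v)
          v≡ = deg-end ends
          u≡ : deg C′ u ≡ deg C u
          u≡ = deg-off ends u≢v (y≢u ∘ sym)
          stays : ∀ {x} → Unc C u v x → x ≡ y ⊎ Unc C′ u v x
          stays {x} (x≢u , x≢v , ¬ux , ¬vx) with x ≟ y
          ... | yes e = inj₁ e
          ... | no x≢y = inj₂ (x≢u , x≢v ,
                (λ e → [ (λ (p , _) → u≢v p) , (λ (p , _) → y≢u (sym p)) ]′ (same-same ends (new e ¬ux))) ,
                (λ e → [ (λ (_ , p) → x≢y p) , (λ (p , _) → y≢v (sym p)) ]′ (same-same ends (new e ¬vx))))
          r≤ : # (unc? C u v) ≤ suc (# (unc? C′ u v))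
          r≤ = ≤-trans (#-cover (_≟ y) (unc? C′ u v) (unc? C u v) stays)
                 (+-monoˡ-≤ (# (unc? C′ u v)) (≤-reflexive (#-point y)))
    go : ∀ k → value k blocker A C ≤ T
    go zero          = c≤
    go (suc zero)    = block-at pos zero uy∈A c≤ (λ _ _ → c≤)
    go (suc (suc k)) = block-at pos (suc k) uy∈A c≤ λ tB pos″ → claim pos″ k c≤ λ t pos′ →
      two-blocker k pos′ (two′ tB pos″ t pos′) (next tB pos″ t pos′)

  two-blocker k pos two (inj₁ half) = half-blocked-win k pos two half
  two-blocker k {u} {v} {A} {C} pos two (inj₂ bal) = cases (adj? C u v) (all-or (status u v A C u≢v)) (any? (unc? C u v))
    where
    open Two two
    open Balanced bal
    at : ∀ {y} → (∀ w → φ A C w ≤ 24 + n) → Unc C u v y → Status u v A C y → value k blocker A C ≤ T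
    at tight (y≢u , _) (is-u e) = contradiction e y≢u
    at tight (_ , y≢v , _) (is-v e) = contradiction e y≢v
    at tight (_ , _ , ¬uy , _) (leaf-u e _) = contradiction e ¬uy
    at tight (_ , _ , _ , ¬vy) (leaf-v e _) = contradiction e ¬vy
    at {y} tight unc (open-x f e e′) with ≤-total (deg C v) (deg C u)
    ... | inj₁ v≤u = two-larger k pos two bal tight unc f e v≤u
    ... | inj₂ u≤v = two-larger k pos (two-sym two) (balanced-sym bal) tight (unc-sym unc) f e′ u≤v

    large : (∀ x → ¬ Unc C u v x) → ∀ {p q} → deg C p + deg C q ≡ deg C u + deg C v → deg C q ≤ suc (deg C p) → 3 ≤ deg C p
    large none {p} {q} eq q≤ with 3 ≤? deg C p
    ... | yes h = h
    ... | no h = contradiction (≤-trans hn (≤-trans (n-count C u v) (≤-trans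
            (≤-reflexive (trans (cong (deg C u + deg C v + 2 +_) (#-empty (unc? C u v) none)) (trans (+-identityʳ _) (cong (_+ 2) (sym eq)))))
            (+-monoˡ-≤ 2 (+-mono-≤ p≤2 (≤-trans q≤ (s≤s p≤2)))))))
          (λ h′ → contradiction (≤-trans (m≤m+n 8 92) h′) (λ { (s≤s (s≤s (s≤s (s≤s (s≤s (s≤s (s≤s ()))))))) }))
      where
      p≤2 : deg C p ≤ 2
      p≤2 = ≤-pred (≰⇒> h)

    cases : Dec (Adj C u v) → (∀ x → Status u v A C x) ⊎ (Dead A C u v ⊎ HalfBlocked u v A C) → Dec (∃ (Unc C u v)) →
            value k blocker A C ≤ T
    -- Once the centres are joined, a further neighbour `x` of `u` gives the path `v u x`, so `v`
    -- cannot be the centre of a large star.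
    cases (yes uv) _ _ = two-dead k pos two (second (u , proj₁ u-nbr , adj-sym uv , proj₁ (proj₂ u-nbr) , proj₂ (proj₂ u-nbr)))
    cases (no _) (inj₂ (inj₁ dead)) _ = two-dead k pos two dead
    cases (no _) (inj₂ (inj₂ half)) _ = half-blocked-win k pos two half
    cases (no ¬uv) (inj₁ st) (yes (y , unc)) = at (tight-φ pos two bal ¬uv st) unc (st y)
    cases (no _) (inj₁ _) (no none) = spanning k blocker pos u≢v (large none′ refl v≤) (large none′ (+-comm (deg C v) (deg C u)) u≤) none′ u≤ v≤
      where
      none′ : ∀ x → ¬ Unc C u v x
      none′ x unc = none (x , unc)
      zero-r : ∀ {i} j → i ≤ suc (j + # (unc? C u v)) → i ≤ suc j
      zero-r j h = ≤-trans h (s≤s (≤-reflexive (trans (cong (j +_) (#-empty (unc? C u v) none′)) (+-identityʳ j))))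
      u≤ : deg C u ≤ suc (deg C v)
      u≤ = zero-r (deg C v) u≤r
      v≤ : deg C v ≤ suc (deg C u)
      v≤ = zero-r (deg C u) v≤r

  -- At least `n - 24` vertices are isolated, hence uncovered, and no degree exceeds 24: the
  -- vertices left over outweigh any imbalance.
  small-balanced : ∀ {u v : Fin n} {C : Graph n} → ¬ Free C u → ¬ Free C v → Small 24 C → Balanced u v C
  small-balanced {u} {v} {C} nu nv sm = record
    { u≤v = ≤-trans (d u) (m≤m+n 24 _) ; v≤u = ≤-trans (d v) (m≤m+n 24 _)
    ; u≤r = ≤-trans (d u) (≤-trans r≥ (≤-trans (m≤n+m _ (deg C v)) (n≤1+n _)))
    ; v≤r = ≤-trans (d v) (≤-trans r≥ (≤-trans (m≤n+m _ (deg C u)) (n≤1+n _))) }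
    where
    d : ∀ w → deg C w ≤ 24
    d = small-deg sm
    r≥ : 24 ≤ # (unc? C u v)
    r≥ = +-cancelˡ-≤ 24 24 _ (≤-trans (m≤m+n 48 52) (≤-trans hn (≤-trans (small-frees sm) (+-monoʳ-≤ 24
      (#-mono (free? C) (unc? C u v) λ {x} f → (λ { refl → nu f }) , (λ { refl → nv f }) ,
        (λ e → f u (adj-sym e)) , (λ e → f v (adj-sym e)))))))

  -- A star and a separate edge

  -- A star at u, and an edge c d one of whose ends must become the second centre.
  record StarEdge (u c d : Fin n) (C : Graph n) : Set where
    field
      {y₁ y₂} : Fin n
      uy₁   : Adj C u y₁
      uy₂   : Adj C u y₂
      y₂≢y₁ : y₂ ≢ y₁
      cd    : Adj C c d
      c≢u   : c ≢ u
      d≢u   : d ≢ u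

    flip : StarEdge u d c C
    flip = record { uy₁ = uy₁ ; uy₂ = uy₂ ; y₂≢y₁ = y₂≢y₁ ; cd = adj-sym cd ; c≢u = d≢u ; d≢u = c≢u }

    grow : ∀ {C′ : Graph n} → C ⊆ₑ C′ → StarEdge u c d C′
    grow h = record { uy₁ = h uy₁ ; uy₂ = h uy₂ ; y₂≢y₁ = y₂≢y₁ ; cd = h cd ; c≢u = c≢u ; d≢u = d≢u }

    -- `u` has degree two and so lies in every live pair; its partner has to meet the edge `c d`,
    -- and `c` is excluded.
    pairs-dead : ∀ {A p q} → Dead A C u c → p ≢ q → Dead A C p q ⊎ Same u d p q
    pairs-dead {A} {p} {q} dead p≢q with u ≟ p | u ≟ q
    ... | no u≢p | no u≢q = inj₁ (dead-centre uy₁ uy₂ y₂≢y₁ u≢p u≢q p≢q)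
    ... | yes refl | _ with c ≟ q | d ≟ q
    ...   | yes refl | _ = inj₁ dead
    ...   | _ | yes refl = inj₂ (inj₁ (refl , refl))
    ...   | no c≢q | no d≢q = inj₁ (dead-edge cd c≢u c≢q d≢u d≢q)
    pairs-dead {A} {p} {q} dead p≢q | no _ | yes refl with c ≟ p | d ≟ p
    ...   | yes refl | _ = inj₁ (dead-sym dead)
    ...   | _ | yes refl = inj₂ (inj₂ (refl , refl))
    ...   | no c≢p | no d≢p = inj₁ (dead-edge cd c≢p c≢u d≢p d≢u)

    two : ∀ {A} → Dead A C u c → (∀ w → φ A C w ≤ N) → Two u d A C
    two dead bound = record
      { u≢v = d≢u ∘ sym ; u-nbr = other ; v-nbr = c , adj-sym cd , c≢u ; others = pairs-dead dead ; bound = bound }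
      where
      other : ∃ λ x → Adj C u x × x ≢ d
      other with y₁ ≟ d
      ... | no y₁≢d = y₁ , uy₁ , y₁≢d
      ... | yes e = y₂ , uy₂ , λ e′ → y₂≢y₁ (trans e′ (sym e))

    not-free : ¬ Free C u × ¬ Free C c × ¬ Free C d
    not-free = (λ f → f y₁ uy₁) , (λ f → f d cd) , (λ f → f c (adj-sym cd))

    free≢ : ∀ {x} → Free C x → x ≢ u × x ≢ c × x ≢ d
    free≢ f = (λ { refl → proj₁ not-free f }) , (λ { refl → proj₁ (proj₂ not-free) f }) , (λ { refl → proj₂ (proj₂ not-free) f })

    free-unc : ∀ {x} → Free C x → Unc C u d x
    free-unc f = proj₁ (free≢ f) , proj₂ (proj₂ (free≢ f)) , (λ e → f u (adj-sym e)) , (λ e → f d (adj-sym e))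

  Reserve : Fin n → Fin n → Graph n → Graph n → Set
  Reserve u x A C = Small 22 C ⊎ ∃ λ x₂ → Free C x₂ × ¬ Adj A u x₂ × x₂ ≢ x

  -- Blocker claims c x, so that only d can still reach x.  If Constructor answers d x, then either few vertices
  -- have been touched, or x₂, which is barred from u as well, is lost next.
  cut-off : ∀ k {u c d x : Fin n} {A C : Graph n} → Position A C → StarEdge u c d C → Free C x → ¬ Adj A u x →
            (∀ w → φ A C w ≤ 90 + n) → Reserve u x A C → value k blocker A C ≤ T
  cut-off k {u} {c} {d} {x} {A} {C} pos se fx ¬ux hφ res with adj? A c x
  ... | no ¬cx = two-blocker k pos (StarEdge.two se dead (λ w → ≤-trans (hφ w) (+n≤N 90 refl)))
                   (inj₁ (x , StarEdge.free-unc se fx , inj₁ ¬ux))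
    where
    dead : Dead A C u c
    dead = escape x (proj₁ (StarEdge.free≢ se fx) , proj₁ (proj₂ (StarEdge.free≢ se fx)) ,
      inj₂ ((¬ux , λ e → fx u (adj-sym e)) , (¬cx , λ e → fx c (adj-sym e))))
  ... | yes cx = go k
    where
    open StarEdge se
    x≢u : x ≢ u
    x≢u = proj₁ (free≢ fx)
    x≢d : x ≢ d
    x≢d = proj₂ (proj₂ (free≢ fx))
    c≤ : countP3 C ≤ T
    c≤ = count pos (λ w → m≤n⇒m≤1+n (≤-trans (hφ w) (+n≤N 90 refl))) (λ {p} {q} _ → free-pair pos fx p q)
    module _ {A″ : Graph n} (tB : Take c x A A″) (pos″ : Position A″ C) where
      module _ {a b : Fin n} {A′ : Graph n} (t : Take a b A″ A′) (pos′ : Position A′ ((a , b) ∷ C)) where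
        open Claim t pos″ pos′
        dead : Dead A′ C′ u c
        dead = dead-future fut (escape x (x≢u , proj₁ (proj₂ (free≢ fx)) ,
          inj₂ ((¬ux ∘ Take.sub tB , λ e → fx u (adj-sym e)) , (Take.gone tB , λ e → fx c (adj-sym e)))))
        se′ : StarEdge u c d C′
        se′ = grow adj-∷
        two′ : Two u d A′ C′
        two′ = StarEdge.two se′ dead (λ w → ≤-trans
          (φ-step (+-monoˡ-≤ n (m≤m+n 4 86)) w (≤-trans (φ-blocked (Take.sub tB) w) (hφ w))) (+n≤N 91 refl))
        not-now : ∀ {z} → ¬ Adj A u z → Free C z → ¬ Adj C′ u z
        not-now ¬uz fz e = [ (λ e′ → fz u (adj-sym e′)) , ¬uz ∘ Take.sub tB ]′ (Future.origin fut e)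
        next : Dec (Adj C′ d x) → Reserve u x A C → HalfBlocked u d A′ C′ ⊎ Balanced u d C′
        next (no ¬dx) _ = inj₁ (x , (x≢u , x≢d , not-now ¬ux fx , ¬dx) , inj₁ (¬ux ∘ Take.sub tB ∘ Take.sub t))
        next (yes _) (inj₁ sm) = inj₂ (small-balanced (proj₁ (StarEdge.not-free se′)) (proj₂ (proj₂ (StarEdge.not-free se′))) (small-∷ sm))
        -- Constructor's one edge was `d x`, so it did not also rescue `x₂`.
        next (yes dx) (inj₂ (x₂ , fx₂ , ¬ux₂ , x₂≢x)) = inj₁ (x₂ ,
              (proj₁ (free≢ fx₂) , proj₂ (proj₂ (free≢ fx₂)) , not-now ¬ux₂ fx₂ ,
                λ e → [ (λ (_ , p) → x₂≢x p) , (λ (p , _) → x≢d (sym p)) ]′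
                        (same-same (new dx (λ e → fx d (adj-sym e))) (new e (λ e → fx₂ d (adj-sym e))))) ,
              inj₁ (¬ux₂ ∘ Take.sub tB ∘ Take.sub t))
    go : ∀ k → value k blocker A C ≤ T
    go zero          = c≤
    go (suc zero)    = block-at pos zero cx c≤ (λ _ _ → c≤)
    go (suc (suc k)) = block-at pos (suc k) cx c≤ λ tB pos″ → claim pos″ k c≤ λ t pos′ →
      two-blocker k pos′ (two′ tB pos″ t pos′) (next tB pos″ t pos′ (adj? _ d x) res)

  small-φ : ∀ j {A C : Graph n} → j ≤ 45 → Small j C → ∀ w → φ A C w ≤ 90 + n
  small-φ j {A} {C} j≤ sm w = ≤-trans (φ≤ {A = A} {C = C} j (small-deg sm w)) (+-monoˡ-≤ n (*-monoʳ-≤ 2 j≤))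

  -- Claiming `u x` produces a first isolated vertex barred from `u`. If `x` stays isolated,
  -- `cut-off` applies. Otherwise Constructor has joined `x` to some `y` other than `u`: when `y` is
  -- `d`, the path `c d x` rules out `c` as a centre; when it is not, `x` cannot be a leaf of `u` or
  -- `d`, which leaves only `u` and `c`. The bound 20 grows to at most 24 in the two rounds played
  -- here and in `cut-off`, as `small-balanced` requires.
  small-star : ∀ k {u c d : Fin n} {A C : Graph n} → Position A C → StarEdge u c d C → Small 20 C →
               value k blocker A C ≤ T
  small-star k {u} {c} {d} {A} {C} pos se sm with small-free (≤-trans (m≤m+n 21 79) hn) sm
  ... | x , fx with adj? A u x
  ...   | no ¬ux = cut-off k pos se fx ¬ux (small-φ 20 (m≤m+n 20 25) sm) (inj₁ (small-weaken (m≤m+n 20 2) sm))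
  ...   | yes ux = go k
    where
    open StarEdge se
    c≤ : countP3 C ≤ T
    c≤ = count pos (λ w → m≤n⇒m≤1+n (≤-trans (small-φ 20 (m≤m+n 20 25) sm w) (+n≤N 90 refl))) (λ {p} {q} _ → free-pair pos fx p q)
    module _ {A″ : Graph n} (tB : Take u x A A″) (pos″ : Position A″ C) where
      module _ {a b : Fin n} {A′ : Graph n} (t : Take a b A″ A′) (pos′ : Position A′ ((a , b) ∷ C)) where
        open Claim t pos″ pos′
        se′ : StarEdge u c d C′
        se′ = grow adj-∷
        small′ : Small 22 C′
        small′ = small-∷ sm
        φ′ : ∀ w → φ A′ C′ w ≤ N
        φ′ w = ≤-trans (small-φ 22 (m≤m+n 22 23) small′ w) (+n≤N 90 refl)
        ¬ux′ : ¬ Adj C′ u x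
        ¬ux′ e = [ (λ e′ → fx u (adj-sym e′)) , Take.gone tB ]′ (Future.origin fut e)
        balanced : ∀ {c d : Fin n} → StarEdge u c d C′ → Balanced u d C′
        balanced se = small-balanced (proj₁ (StarEdge.not-free se)) (proj₂ (proj₂ (StarEdge.not-free se)))
                        (small-weaken (m≤m+n 22 2) small′)
        next : ∀ k → value k blocker A′ C′ ≤ T
        next k with free? C′ x
        ... | yes fx′ = cut-off k pos′ se′ fx′ (Take.gone tB ∘ Take.sub t) (small-φ 22 (m≤m+n 22 23) small′) (inj₁ small′)
        ... | no ¬fx′ with neighbour ¬fx′
        ...   | y , xy with y ≟ d
        ...     | yes refl = two-blocker k pos′ (StarEdge.two se′ (second (d , x , adj-∷ cd , adj-sym xy , proj₁ (proj₂ (free≢ fx)))) φ′)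
                               (inj₂ (balanced se′))
        ...     | no y≢d = two-blocker k pos′ (StarEdge.two (StarEdge.flip se′)
                    (escape x (proj₁ (free≢ fx) , proj₂ (proj₂ (free≢ fx)) ,
                      inj₁ (y , xy , (λ { refl → ¬ux′ (adj-sym xy) }) , y≢d))) φ′)
                    (inj₂ (balanced (StarEdge.flip se′)))
    go : ∀ k → value k blocker A C ≤ T
    go zero          = c≤
    go (suc zero)    = block-at pos zero ux c≤ (λ _ _ → c≤)
    go (suc (suc k)) = block-at pos (suc k) ux c≤ λ tB pos″ → claim pos″ k c≤ λ t pos′ → next tB pos″ t pos′ k

  -- A single star

  record Star (u : Fin n) (A C : Graph n) : Set where
    field
      {y₁ y₂} : Fin n
      uy₁     : Adj C u y₁
      uy₂     : Adj C u y₂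
      y₂≢y₁   : y₂ ≢ y₁
      centred : ∀ {x y} → Adj C x y → x ≡ u ⊎ y ≡ u

    leaf≤1 : ∀ {w} → w ≢ u → deg C w ≤ 1
    leaf≤1 {w} w≢u = ≤-trans (#-mono (adj? C w) (_≟ u) (λ e → [ (λ w≡u → contradiction w≡u w≢u) , id ]′ (centred e)))
                       (≤-reflexive (#-point u))

    star-φ : ∀ {M} → 2 + n ≤ M → φ A C u ≤ M → ∀ w → φ A C w ≤ M
    star-φ hM hu w with w ≟ u
    ... | yes refl = hu
    ... | no w≢u = ≤-trans (φ≤ {A = A} {C = C} 1 (leaf≤1 w≢u)) hM

    star-count : Position A C → φ A C u ≤ suc P → countP3 C ≤ T
    star-count pos hu = count pos (star-φ (≤-trans (+n≤N 2 refl) (n≤1+n N))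
        (≤-trans hu (≤-trans (s≤s hP₂) (m≤n⇒m≤1+n (+n≤N 14 refl))))) pair
      where
      pair : ∀ {p q} → p ≢ q → Pair pos p q
      pair {p} {q} p≢q with p ≟ u
      ... | no p≢u = inj₁ (≤-trans (leaf≤1 p≢u) (n≤1+n 1))
      ... | yes refl = inj₂ (inj₁ (≤-trans (leaf≤1 (p≢q ∘ sym)) (n≤1+n 1)))

  -- While all edges meet `u`, no other vertex has large degree, so stopping is harmless and
  -- replying at `u` suffices. The first edge avoiding `u` ends the phase.
  star-constructor : ∀ k {u : Fin n} {A C : Graph n} → Position A C → Star u A C → φ A C u ≤ P →
                     value k constructor′ A C ≤ T
  star-blocker : ∀ k {u : Fin n} {A C : Graph n} → Position A C → Star u A C → φ A C u ≤ suc P →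
                 value k blocker A C ≤ T

  star-blocker zero    pos st hu = Star.star-count st pos hu
  star-blocker (suc k) {u} pos st hu = reply pos k u P evenP hu (Star.star-count st pos hu) λ _ pos′ hu′ →
    star-constructor k pos′ (record { uy₁ = uy₁ ; uy₂ = uy₂ ; y₂≢y₁ = y₂≢y₁ ; centred = centred }) hu′
    where open Star st

  star-constructor zero pos st hu = Star.star-count st pos (m≤n⇒m≤1+n hu)
  star-constructor (suc k) {u} {A} {C} pos st hu = claim pos k (Star.star-count st pos (m≤n⇒m≤1+n hu)) after
    where
    open Star st
    after : ∀ {a b : Fin n} {A′ : Graph n} → Take a b A A′ → Position A′ ((a , b) ∷ C) → value k blocker A′ ((a , b) ∷ C) ≤ T
    after {a} {b} {A′} t pos′ = cases (a ≟ u) (b ≟ u)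
      where
      open Claim t pos pos′
      extended : a ≡ u ⊎ b ≡ u → value k blocker A′ C′ ≤ T
      extended at-u = star-blocker k pos′ (record
          { uy₁ = adj-∷ uy₁ ; uy₂ = adj-∷ uy₂ ; y₂≢y₁ = y₂≢y₁ ; centred = λ e → [ new-edge , centred ]′ (adj-∷⁻ e) })
        (φ-step (≤-trans (+-monoˡ-≤ n (m≤m+n 4 8)) hP₁) u hu)
        where
        new-edge : ∀ {x y} → Same a b x y → x ≡ u ⊎ y ≡ u
        new-edge (inj₁ (refl , refl)) = at-u
        new-edge (inj₂ (refl , refl)) = ⊎-swap at-u

      separate : a ≢ u → b ≢ u → value k blocker A′ C′ ≤ T
      separate a≢u b≢u = split (#≤1⊎pair X?)
        where
        X? : Decidable (λ x → Free C′ x × ¬ Adj A′ u x)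
        X? x = free? C′ x ×-dec ¬? (adj? A′ u x)
        se : StarEdge u a b C′
        se = record { uy₁ = adj-∷ uy₁ ; uy₂ = adj-∷ uy₂ ; y₂≢y₁ = y₂≢y₁ ; cd = adj-new {G = C}
                    ; c≢u = a≢u ; d≢u = b≢u }
        φ′ : ∀ w → φ A′ C′ w ≤ 90 + n
        φ′ w = ≤-trans (φ-step (+-monoˡ-≤ n (m≤m+n 4 9)) w (star-φ (+-monoˡ-≤ n (m≤m+n 2 11)) (≤-trans hu hP₂) w))
                       (+-monoˡ-≤ n (m≤m+n 14 76))
        split : # X? ≤ 1 ⊎ _ → value k blocker A′ C′ ≤ T
        -- Two isolated vertices are barred from `u`: one to cut off, one in reserve.
        split (inj₂ (x , x₂ , (fx , ¬ux) , (fx₂ , ¬ux₂) , x₂≢x)) =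
          cut-off k pos′ se fx ¬ux φ′ (inj₂ (x₂ , fx₂ , ¬ux₂ , x₂≢x))
        split (inj₁ few) = small-star k pos′ se (small≤ (≤-trans touched (+-monoʳ-≤ 3 deg≤17)))
          where
          R₁? : Decidable (λ x → x ≡ u ⊎ Adj C u x)
          R₁? x = (x ≟ u) ⊎-dec adj? C u x
          R₂? : Decidable (λ x → x ≡ b ⊎ x ≡ u ⊎ Adj C u x)
          R₂? x = (x ≟ b) ⊎-dec R₁? x
          touch : ∀ {x} → ¬ Free C′ x → x ≡ a ⊎ x ≡ b ⊎ x ≡ u ⊎ Adj C u x
          touch ¬f with neighbour ¬f
          ... | z , xz with adj-∷⁻ xz
          ...   | inj₁ (inj₁ (x≡a , _)) = inj₁ x≡a
          ...   | inj₁ (inj₂ (x≡b , _)) = inj₂ (inj₁ x≡b)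
          ...   | inj₂ e with centred e
          ...     | inj₁ x≡u = inj₂ (inj₂ (inj₁ x≡u))
          ...     | inj₂ refl = inj₂ (inj₂ (inj₂ (adj-sym e)))
          touched : # (notFree? C′) ≤ 3 + deg C u
          touched = ≤-trans (#-cover (_≟ a) R₂? (notFree? C′) touch)
            (+-mono-≤ (≤-reflexive (#-point a)) (≤-trans (#-cover (_≟ b) R₁? R₂? id)
            (+-mono-≤ (≤-reflexive (#-point b)) (≤-trans (#-cover (_≟ u) (adj? C u) R₁? id)
            (+-monoˡ-≤ (deg C u) (≤-reflexive (#-point u)))))))
          free-split : ∀ {x} → Free C′ x → (Adj A′ u x × Free C′ x) ⊎ (Free C′ x × ¬ Adj A′ u x)
          free-split {x} f with adj? A′ u x
          ... | yes e = inj₁ (e , f)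
          ... | no ¬e = inj₂ (f , ¬e)
          decide : ∀ x → ¬ Free C′ x ⊎ Free C′ x
          decide x with free? C′ x
          ... | yes f = inj₂ f
          ... | no ¬f = inj₁ ¬f
          n≤ : n ≤ 3 + deg C u + (use A C u + 1)
          n≤ = ≤-trans (#-cover-n (notFree? C′) (free? C′) decide) (+-mono-≤ touched
            (≤-trans (#-cover (useful? A′ C′ u) X? (free? C′) free-split) (+-mono-≤ (use-future fut u) few)))
          lem₁ : ∀ d u n → d + (n + d + u) ≡ n + (2 * d + u)
          lem₁ = solve-∀
          lem₂ : ∀ d u n → 3 + d + (u + 1) + (13 + n) ≡ 17 + (n + d + u)
          lem₂ = solve-∀
          -- With at most one isolated vertex barred from `u`, nearly all vertices outside the star
          -- are still useful, and `φ A C u ≤ 13 + n` then permits at most 17 leaves. Adding `u`,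
          -- `a` and `b` gives the 20 of `small-star`.
          deg≤17 : deg C u ≤ 17
          deg≤17 = linear (n + deg C u + use A C u) {deg C u} {17}
            (+-mono-≤ n≤ (≤-trans (≤-reflexive (sym (φ≡ A C u))) (≤-trans hu hP₂)))
            (lem₁ (deg C u) (use A C u) n) (lem₂ (deg C u) (use A C u) n)

      cases : Dec (a ≡ u) → Dec (b ≡ u) → value k blocker A′ C′ ≤ T
      cases (yes e) _ = extended (inj₁ e)
      cases _ (yes e) = extended (inj₂ e)
      cases (no a≢u) (no b≢u) = separate a≢u b≢u

  -- The opening

  Incident : Fin n → Fin n → Fin n → Set
  Incident a b v = ∃ λ w → Same a b v w

  same-end : ∀ {a b c d v w : Fin n} → Same a b v w → Same c d v w → Same a b c d
  same-end (inj₁ (refl , refl)) h = ⊎-map (λ (p , q) → sym p , sym q) (λ (p , q) → sym q , sym p) h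
  same-end (inj₂ (refl , refl)) (inj₁ (p , q)) = inj₂ (sym p , sym q)
  same-end (inj₂ (refl , refl)) (inj₂ (p , q)) = inj₁ (sym q , sym p)

  clash : ∀ {C : Graph n} {a b c d v : Fin n} → (∀ u → deg C u ≤ 1) → Adj C a b → Adj C c d → ¬ Same a b c d →
          Incident a b v → Incident c d v → ⊥
  clash {C} {v = v} d≤1 ab cd ¬same (w , p) (w′ , q) = 1+n≰n (≤-trans (two≤deg (edge ab p) (edge cd q)
      (λ { refl → ¬same (same-end p q) })) (d≤1 v))
    where
    edge : ∀ {a b w} → Adj C a b → Same a b v w → Adj C v w
    edge e (inj₁ (refl , refl)) = e
    edge e (inj₂ (refl , refl)) = adj-sym e

  -- Degrees at most one make the three edges disjoint. Two vertices meet at most two of them, and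
  -- an end of the third escapes.
  matching-lost : ∀ {A : Graph n} {a b c d e f : Fin n} → let C = (a , b) ∷ (c , d) ∷ (e , f) ∷ [] in
                  Simple C → (∀ u → deg C u ≤ 1) → Lost A C
  matching-lost {A} {a} {b} {c} {d} {e} {f} s d≤1 {p} {q} p≢q = go (place ab) (place cd) (place ef)
    where
    C : Graph n
    C = (a , b) ∷ (c , d) ∷ (e , f) ∷ []
    ab : Adj C a b
    ab = inj₁ (here refl)
    cd : Adj C c d
    cd = inj₁ (there (here refl))
    ef : Adj C e f
    ef = inj₁ (there (there (here refl)))
    ab≠cd : ¬ Same a b c d
    ab≠cd h = simple-fresh s (same-adj h (inj₁ (here refl)))
    ab≠ef : ¬ Same a b e f
    ab≠ef h = simple-fresh s (same-adj h (inj₁ (there (here refl))))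
    cd≠ef : ¬ Same c d e f
    cd≠ef h = simple-fresh (simple-tail s) (same-adj h (inj₁ (here refl)))
    place : ∀ {x y} → Adj C x y → Dead A C p q ⊎ (Incident x y p ⊎ Incident x y q)
    place {x} {y} xy with x ≟ p | x ≟ q | y ≟ p | y ≟ q
    ... | yes refl | _ | _ | _ = inj₂ (inj₁ (y , inj₁ (refl , refl)))
    ... | _ | yes refl | _ | _ = inj₂ (inj₂ (y , inj₁ (refl , refl)))
    ... | _ | _ | yes refl | _ = inj₂ (inj₁ (x , inj₂ (refl , refl)))
    ... | _ | _ | _ | yes refl = inj₂ (inj₂ (x , inj₂ (refl , refl)))
    ... | no x≢p | no x≢q | no y≢p | no y≢q = inj₁ (dead-edge xy x≢p x≢q y≢p y≢q)
    go : Dead A C p q ⊎ (Incident a b p ⊎ Incident a b q) → Dead A C p q ⊎ (Incident c d p ⊎ Incident c d q) →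
         Dead A C p q ⊎ (Incident e f p ⊎ Incident e f q) → Dead A C p q
    go (inj₁ dead) _ _ = dead
    go _ (inj₁ dead) _ = dead
    go _ _ (inj₁ dead) = dead
    go (inj₂ (inj₁ i)) (inj₂ (inj₁ j)) _ = ⊥-elim (clash d≤1 ab cd ab≠cd i j)
    go (inj₂ (inj₂ i)) (inj₂ (inj₂ j)) _ = ⊥-elim (clash d≤1 ab cd ab≠cd i j)
    go (inj₂ (inj₁ i)) _ (inj₂ (inj₁ j)) = ⊥-elim (clash d≤1 ab ef ab≠ef i j)
    go (inj₂ (inj₂ i)) _ (inj₂ (inj₂ j)) = ⊥-elim (clash d≤1 ab ef ab≠ef i j)
    go _ (inj₂ (inj₁ i)) (inj₂ (inj₁ j)) = ⊥-elim (clash d≤1 cd ef cd≠ef i j)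
    go _ (inj₂ (inj₂ i)) (inj₂ (inj₂ j)) = ⊥-elim (clash d≤1 cd ef cd≠ef i j)

  small-count : ∀ j {A C : Graph n} → j ≤ 45 → Small j C → Position A C → countP3 C ≤ T
  small-count j {A} {C} j≤ sm pos with small-free (≤-trans (s≤s j≤) (≤-trans (m≤m+n 46 54) hn)) sm
  ... | x , fx = count pos (λ w → m≤n⇒m≤1+n (≤-trans (small-φ j j≤ sm w) (+n≤N 90 refl))) (λ {p} {q} _ → free-pair pos fx p q)

  -- Two disjoint edges still leave four candidate pairs, one end from each; the third edge decides.
  -- Either the three form a matching, or some vertex has degree two and the edges all meet it or
  -- one avoids it. A triangle belongs to the last case.
  three-edges : ∀ k {A : Graph n} {a b c d e f : Fin n} → let C = (a , b) ∷ (c , d) ∷ (e , f) ∷ [] in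
                Position A C → Small 6 C → value k blocker A C ≤ T
  three-edges k {A} {a} {b} {c} {d} {e} {f} pos sm = cases (any? (λ u → 2 ≤? deg C u))
    where
    C : Graph n
    C = (a , b) ∷ (c , d) ∷ (e , f) ∷ []
    open Position pos
    φ₆ : ∀ w → φ A C w ≤ 12 + n
    φ₆ w = φ≤ {A = A} {C = C} 6 (small-deg sm w)
    star : ∀ {u} → 2 ≤ deg C u → Dec (∃ λ x → ∃ λ y → Adj C x y × x ≢ u × y ≢ u) → value k blocker A C ≤ T
    star {u} 2≤ away with two-neighbours {G = C} 2≤
    star {u} 2≤ (yes (x , y , xy , x≢u , y≢u)) | y₁ , y₂ , uy₁ , uy₂ , y₂≢y₁ =
      small-star k pos (record { uy₁ = uy₁ ; uy₂ = uy₂ ; y₂≢y₁ = y₂≢y₁ ; cd = xy ; c≢u = x≢u ; d≢u = y≢u }) (small-weaken (m≤m+n 6 14) sm)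
    star {u} 2≤ (no ¬away) | y₁ , y₂ , uy₁ , uy₂ , y₂≢y₁ =
      star-blocker k pos (record { uy₁ = uy₁ ; uy₂ = uy₂ ; y₂≢y₁ = y₂≢y₁ ; centred = centred })
        (≤-trans (φ₆ u) (≤-trans hP₁ (n≤1+n P)))
      where
      centred : ∀ {x y} → Adj C x y → x ≡ u ⊎ y ≡ u
      centred {x} {y} xy with x ≟ u | y ≟ u
      ... | yes h | _ = inj₁ h
      ... | _ | yes h = inj₂ h
      ... | no x≢u | no y≢u = contradiction (x , y , xy , x≢u , y≢u) ¬away
    cases : Dec (∃ λ u → 2 ≤ deg C u) → value k blocker A C ≤ T
    cases (yes (u , 2≤)) = star 2≤ (any? (λ x → any? (λ y → adj? C x y ×-dec ¬? (x ≟ u) ×-dec ¬? (y ≟ u))))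
    cases (no h) = lost-blocker k pos (matching-lost simpleC (λ u → ≤-pred (≰⇒> (λ 2≤ → h (u , 2≤)))))
      a (≤-trans (φ₆ a) (m≤n⇒m≤1+n (+n≤N 12 refl))) (λ {w} _ → ≤-trans (φ₆ w) (+n≤N 12 refl))

  open-claim : ∀ k j {A C : Graph n} → j ≤ 45 → Small j C → Position A C →
    (∀ k {a b : Fin n} {A′ : Graph n} → Small (2 + j) ((a , b) ∷ C) → Position A′ ((a , b) ∷ C) → value k blocker A′ ((a , b) ∷ C) ≤ T) →
    value k constructor′ A C ≤ T
  open-claim zero    j j≤ sm pos h = small-count j j≤ sm pos
  open-claim (suc k) j j≤ sm pos h = claim pos k (small-count j j≤ sm pos) (λ _ pos′ → h k (small-∷ sm) pos′)

  open-block : ∀ k j {A C : Graph n} → j ≤ 45 → Small j C → Position A C →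
    (∀ k {A′ : Graph n} → Position A′ C → value k constructor′ A′ C ≤ T) → value k blocker A C ≤ T
  open-block zero    j j≤ sm pos h = small-count j j≤ sm pos
  open-block (suc k) j j≤ sm pos h = block-any pos k (small-count j j≤ sm pos) (λ _ pos′ → h k pos′)

  -- Blocker's first two moves can be arbitrary, because `three-edges` handles every position after
  -- Constructor's third claim.
  upper-bound : ∀ k {A : Graph n} → Position A [] → value k constructor′ A [] ≤ T
  upper-bound k pos =
    open-claim k 0 z≤n small-[] pos λ k sm₂ pos →
    open-block k 2 (m≤m+n 2 43) sm₂ pos λ k pos →
    open-claim k 2 (m≤m+n 2 43) sm₂ pos λ k sm₄ pos →
    open-block k 4 (m≤m+n 4 41) sm₄ pos λ k pos →
    open-claim k 4 (m≤m+n 4 41) sm₄ pos λ k sm₆ pos → three-edges k pos sm₆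

-- Constructor's strategy

module DoubleStar {n m T : ℕ} (n≡ : n ≡ 2 + m) (T≤B : T ≤ B n) {u v : Fin n} (u≢v : u ≢ v) where

  Centre : Fin n → Set
  Centre x = x ≡ u ⊎ x ≡ v

  centre? : Decidable Centre
  centre? x = (x ≟ u) ⊎-dec (x ≟ v)

  record Shape (C : Graph n) : Set where
    field
      centred : ∀ {x y} → Adj C x y → Centre x ⊎ Centre y
      apart   : ∀ {x y} → Adj C x y → Centre x → ¬ Centre y
      single  : ∀ {x} → Adj C u x → ¬ Adj C v x

    one-centre : ∀ {p q x} → Centre p → Centre q → Adj C p x → Adj C q x → p ≡ q
    one-centre (inj₁ refl) (inj₁ refl) _ _ = refl
    one-centre (inj₂ refl) (inj₂ refl) _ _ = refl
    one-centre (inj₁ refl) (inj₂ refl) ux vx = contradiction vx (single ux)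
    one-centre (inj₂ refl) (inj₁ refl) vx ux = contradiction vx (single ux)

    across : ∀ {x y} → Adj C x y → ¬ Centre x → Centre y
    across e ¬c = [ (λ c → contradiction c ¬c) , id ]′ (centred e)

    -- Centres and leaves alternate along a path, so `a` and `c`, or `b` and `d`, are centres with a
    -- common neighbour. No leaf has two centres, so they coincide.
    shape-free : P4free C
    shape-free {a} {b} {c} {d} ab bc cd a≢c b≢d a≢d with centre? a
    ... | yes ca = a≢c (one-centre ca (across bc (apart ab ca)) ab (adj-sym bc))
    ... | no ¬ca = b≢d (one-centre cb (across cd (apart bc cb)) bc (adj-sym cd))
      where
      cb : Centre b
      cb = across ab ¬ca

  shape-[] : Shape []
  shape-[] = record { centred = λ { (inj₁ ()) ; (inj₂ ()) } ; apart = λ { (inj₁ ()) ; (inj₂ ()) }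
                    ; single = λ { (inj₁ ()) ; (inj₂ ()) } }

  shape-∷ : ∀ {C a b c x} → Shape C → Centre c → Unc C u v x → Same a b c x → Shape ((a , b) ∷ C)
  shape-∷ {C} {a} {b} {c} {x} sh cc (x≢u , x≢v , ¬ux , ¬vx) ends = record
    { centred = λ e → [ (λ q → centred′ (same-same ends q)) , centred ]′ (adj-∷⁻ e)
    ; apart   = λ e cy → [ (λ q → apart′ (same-same ends q) cy) , (λ e′ → apart e′ cy) ]′ (adj-∷⁻ e)
    ; single  = λ e f → single′ (adj-∷⁻ e) (adj-∷⁻ f) }
    where
    open Shape sh
    ¬cx : ¬ Centre x
    ¬cx = [ x≢u , x≢v ]′
    centred′ : ∀ {y z} → Same c x y z → Centre y ⊎ Centre z
    centred′ (inj₁ (refl , refl)) = inj₁ cc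
    centred′ (inj₂ (refl , refl)) = inj₂ cc
    apart′ : ∀ {y z} → Same c x y z → Centre y → ¬ Centre z
    apart′ (inj₁ (refl , refl)) _ = ¬cx
    apart′ (inj₂ (refl , refl)) cx = contradiction cx ¬cx
    single′ : ∀ {y} → Same a b u y ⊎ Adj C u y → Same a b v y ⊎ Adj C v y → ⊥
    single′ (inj₂ e) (inj₂ f) = single e f
    single′ (inj₁ p) (inj₁ q) with same-same p q
    ... | inj₁ (v≡u , _) = u≢v (sym v≡u)
    ... | inj₂ (v≡y , y≡u) = u≢v (sym (trans v≡y y≡u))
    single′ (inj₁ p) (inj₂ f) with same-same ends p
    ... | inj₁ (refl , refl) = ¬vx f
    ... | inj₂ (u≡x , _) = x≢u (sym u≡x)
    single′ (inj₂ e) (inj₁ q) with same-same ends q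
    ... | inj₁ (refl , refl) = ¬ux e
    ... | inj₂ (v≡x , _) = x≢v (sym v≡x)

  -- The two centres alone already account for the score: their stars have `m` leaves together, and
  -- `B-minimal` is convexity.
  covered : ∀ {C} → Simple C → Shape C → (∀ x → ¬ Unc C u v x) → T ≤ countP3 C
  covered {C} s sh none = ≤-trans T≤B (*-cancelˡ-≤ 2 (≤-trans
      (subst (λ k → 2 * B k ≤ tri (deg C u) + tri (deg C v)) (sym n≡) (B-minimal m {deg C u} {deg C v} total))
      (≤-trans (≤-reflexive (sym (trans (∑-distrib-+ {n} (λ w → ⟦ w ≟ u ⟧ * t w) (λ w → ⟦ w ≟ v ⟧ * t w))
                                        (cong₂ _+_ (sum-point u t) (sum-point v t)))))
      (≤-trans (sum-mono pt) (≤-reflexive (sym (countP3≡ s)))))))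
    where
    open Shape sh
    t : Fin n → ℕ
    t w = tri (deg C w)
    none-0 : # (unc? C u v) ≡ 0
    none-0 = #-empty (unc? C u v) none
    total : deg C u + deg C v ≡ m
    total = ≤-antisym
      (+-cancelʳ-≤ 2 _ _ (≤-trans (m≤m+n _ _) (≤-trans (count-n s u≢v (λ e → apart e (inj₁ refl) (inj₂ refl)) single)
        (≤-reflexive (trans n≡ (+-comm 2 m))))))
      (+-cancelʳ-≤ 2 _ _ (≤-trans (≤-reflexive (trans (+-comm m 2) (sym n≡))) (≤-trans (n-count C u v)
        (≤-reflexive (trans (cong (deg C u + deg C v + 2 +_) none-0) (+-identityʳ _))))))
    pt : ∀ w → ⟦ w ≟ u ⟧ * t w + ⟦ w ≟ v ⟧ * t w ≤ t w
    pt w with w ≟ u | w ≟ v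
    ... | yes w≡u | yes w≡v = contradiction (trans (sym w≡u) w≡v) u≢v
    ... | yes _ | no _ = ≤-reflexive (trans (+-identityʳ _) (+-identityʳ _))
    ... | no _ | yes _ = ≤-reflexive (+-identityʳ _)
    ... | no _ | no _ = z≤n

  Open : Graph n → Fin n → Set
  Open A x = Adj A u x × Adj A v x

  claim≥ : ∀ k {A C : Graph n} {c x : Fin n} → Simple (A ++ C) → Shape C → suc k ≡ length A → Centre c → Unc C u v x → Adj A c x →
    (∀ {a b : Fin n} {A′ : Graph n} → Take a b A A′ → Same a b c x → Simple (A′ ++ (a , b) ∷ C) → Shape ((a , b) ∷ C) →
       k ≡ length A′ → T ≤ value k blocker A′ ((a , b) ∷ C)) →
    T ≤ value (suc k) constructor′ A C
  claim≥ k {A} {C} {c} {x} s sh len cc unc e h = go e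
    where
    at : ∀ {a b} → (a , b) ∈ A → Same a b c x → T ≤ value (suc k) constructor′ A C
    at {a} {b} e∈ ends with ∈-picks e∈
    ... | A′ , q∈ = ≤-trans
        (h (take s (picks-↭ q∈)) ends (take-constructor s (picks-↭ q∈)) sh′ (suc-injective (trans len (↭-length (picks-↭ q∈)))))
        (value-constructor≥ k q∈ (P4free⇒legal {C = C} {q = (a , b) , A′} (Shape.shape-free sh′)))
      where
      sh′ : Shape ((a , b) ∷ C)
      sh′ = shape-∷ sh cc unc ends
    go : Adj A c x → T ≤ value (suc k) constructor′ A C
    go (inj₁ e∈) = at e∈ (inj₁ (refl , refl))
    go (inj₂ e∈) = at e∈ (inj₂ (refl , refl))

  -- Blocker's last move can have spoiled only the vertex x₀.
  Spoiled : Graph n → Graph n → Fin n → Set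
  Spoiled A C x₀ = ∀ {x} → Unc C u v x → Open A x ⊎ (x ≡ x₀ × (Adj A u x ⊎ Adj A v x))

  -- At most one vertex is threatened, so an answer there leaves every uncovered vertex open again;
  -- without a threat any uncovered vertex will do. `k ≡ length A` keeps the fuel from running out
  -- while a vertex is uncovered.
  lower-constructor : ∀ k {A C : Graph n} {x₀} → Simple (A ++ C) → Shape C → k ≡ length A → Spoiled A C x₀ →
                      T ≤ value k constructor′ A C
  lower-blocker : ∀ k {A C : Graph n} → Simple (A ++ C) → Shape C → k ≡ length A → (∀ {x} → Unc C u v x → Open A x) →
                  T ≤ value k blocker A C

  lower-constructor k {A} {C} {x₀} s sh len sp = cases (unc? C u v x₀) (any? (unc? C u v))
    where
    avail : ∀ {x} → Unc C u v x → Adj A u x ⊎ Adj A v x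
    avail unc = [ (λ o → inj₁ (proj₁ o)) , proj₂ ]′ (sp unc)
    move : ∀ k {y} → k ≡ length A → Unc C u v y → (∀ {x} → Unc C u v x → x ≢ y → Open A x) → T ≤ value k constructor′ A C
    move zero len′ unc _ = ⊥-elim (empty A len′ (avail unc))
      where
      empty : ∀ (A : Graph n) {x} → 0 ≡ length A → ¬ (Adj A u x ⊎ Adj A v x)
      empty [] _ (inj₁ (inj₁ ()))
      empty [] _ (inj₁ (inj₂ ()))
      empty [] _ (inj₂ (inj₁ ()))
      empty [] _ (inj₂ (inj₂ ()))
    move (suc k) {y} len′ unc others = [ take-edge (inj₁ refl) , take-edge (inj₂ refl) ]′ (avail unc)
      where
      take-edge : ∀ {c} → Centre c → Adj A c y → T ≤ value (suc k) constructor′ A C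
      take-edge {c} cc e = claim≥ k s sh len′ cc unc e λ {a} {b} {A′} t ends s′ sh′ len″ →
          lower-blocker k s′ sh′ len″ (still t ends)
        where
        still : ∀ {a b : Fin n} {A′ : Graph n} → Take a b A A′ → Same a b c y → ∀ {x} → Unc ((a , b) ∷ C) u v x → Open A′ x
        still {a} {b} {A′} t ends {x} (x≢u , x≢v , ¬ux , ¬vx) =
            keep (inj₁ refl) (proj₁ o) , keep (inj₂ refl) (proj₂ o)
          where
          x≢y : x ≢ y
          x≢y refl = [ (λ { refl → ¬ux (new-adj ends) }) , (λ { refl → ¬vx (new-adj ends) }) ]′ cc
            where
            new-adj : ∀ {p} → Same a b p x → Adj ((a , b) ∷ C) p x
            new-adj (inj₁ (refl , refl)) = adj-new {G = C}
            new-adj (inj₂ (refl , refl)) = adj-sym (adj-new {G = C})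
          o : Open A x
          o = others (x≢u , x≢v , ¬ux ∘ adj-∷ , ¬vx ∘ adj-∷) x≢y
          keep : ∀ {p} → Centre p → Adj A p x → Adj A′ p x
          keep {p} cp e′ with Take.rest t e′
          ... | inj₂ e″ = e″
          ... | inj₁ q with same-same ends q
          ...   | inj₁ (_ , x≡y) = contradiction x≡y x≢y
          ...   | inj₂ (_ , refl) = ⊥-elim ([ x≢u , x≢v ]′ cc)
    cases : Dec (Unc C u v x₀) → Dec (∃ (Unc C u v)) → T ≤ value k constructor′ A C
    cases (yes unc) _ = move k len unc λ unc′ x≢x₀ → [ id , (λ (x≡x₀ , _) → contradiction x≡x₀ x≢x₀) ]′ (sp unc′)
    cases (no ¬unc) (yes (y , unc)) = move k len unc λ unc′ _ → [ id , (λ { (refl , _) → contradiction unc′ ¬unc }) ]′ (sp unc′)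
    cases (no _) (no none) = ≤-trans (covered (simple-++ʳ A s) sh (λ x unc → none (x , unc))) (countP3≤value k constructor′ {A})

  lower-blocker zero {[]} s sh len op = covered s sh λ x unc → [ (λ ()) , (λ ()) ]′ (proj₁ (op unc))
  lower-blocker (suc k) {A} {C} s sh len op = value-blocker≥ k
      (λ illegal → covered (simple-++ʳ A s) sh (λ x unc → playable illegal unc (proj₁ (op unc))))
      (λ {q} q∈ → lower-constructor k (take-blocker s (picks-↭ q∈)) sh
        (suc-injective (trans len (↭-length (picks-↭ q∈)))) (spoil (take s (picks-↭ q∈))))
    where
    playable : (∀ {q} → q ∈ picks A → ¬ Legal C q) → ∀ {x} → Unc C u v x → Adj A u x → ⊥
    playable illegal unc (inj₁ e) with ∈-picks e
    ... | A′ , q∈ = illegal q∈ (P4free⇒legal {C = C} {q = _ , A′} (Shape.shape-free (shape-∷ sh (inj₁ refl) unc (inj₁ (refl , refl)))))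
    playable illegal unc (inj₂ e) with ∈-picks e
    ... | A′ , q∈ = illegal q∈ (P4free⇒legal {C = C} {q = _ , A′} (Shape.shape-free (shape-∷ sh (inj₁ refl) unc (inj₂ (refl , refl)))))
    -- The vertex threatened by Blocker's edge. For an edge between two centres or two other
    -- vertices the value is a dummy, since such a move spoils nothing.
    leaf-end : Fin n → Fin n → Fin n
    leaf-end a b with centre? a
    ... | yes _ = b
    ... | no _  = a
    at-leaf : ∀ {a b p x} → Centre p → ¬ Centre x → Same a b p x → x ≡ leaf-end a b
    at-leaf {a} {b} cp ¬cx ends with centre? a | ends
    ... | yes _  | inj₁ (_ , x≡b) = x≡b
    ... | yes ca | inj₂ (_ , refl) = contradiction ca ¬cx
    ... | no ¬ca | inj₁ (refl , _) = contradiction cp ¬ca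
    ... | no _   | inj₂ (_ , x≡a) = x≡a
    spoil : ∀ {a b A′} → Take a b A A′ → Spoiled A′ C (leaf-end a b)
    spoil {a} {b} t unc@(x≢u , x≢v , _) with Take.rest t (proj₁ (op unc)) | Take.rest t (proj₂ (op unc))
    ... | inj₂ e | inj₂ f = inj₁ (e , f)
    ... | inj₁ p | inj₂ f = inj₂ (at-leaf (inj₁ refl) [ x≢u , x≢v ]′ p , inj₂ f)
    ... | inj₂ e | inj₁ q = inj₂ (at-leaf (inj₂ refl) [ x≢u , x≢v ]′ q , inj₁ e)
    ... | inj₁ p | inj₁ q with same-same p q
    ...   | inj₁ (v≡u , _) = contradiction (sym v≡u) u≢v
    ...   | inj₂ (_ , x≡u) = contradiction x≡u x≢u

-- The initial position and the choice of constants

module _ (n : ℕ) where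

  private
    up : Fin n → List (Fin n)
    up i = filter (λ j → toℕ i <? toℕ j) (allFin n)

    row : Fin n → Graph n
    row i = map (i ,_) (up i)

  allEdges-unique : Unique (allEdges n)
  allEdges-unique = go (Unique.allFin⁺ n)
    where
    go : ∀ {is} → Unique is → Unique (concatMap row is)
    go [] = []
    go {i ∷ is} (i∉ ∷ uis) = Unique.++⁺
      (Unique.map⁺ (λ { refl → refl }) (Unique.filter⁺ (λ j → toℕ i <? toℕ j) (Unique.allFin⁺ n)))
      (go uis) λ { (e , f) → clash-row (∈-map⁻ (i ,_) e) (find (∈-concatMap⁻ row {xs = is} f)) }
      where
      clash-row : ∀ {e} → (∃ λ j → j ∈ up i × e ≡ (i , j)) → (∃ λ i′ → i′ ∈ is × e ∈ row i′) → ⊥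
      clash-row (j , _ , refl) (i′ , i′∈ , e∈) with ∈-map⁻ (i′ ,_) e∈
      ... | _ , _ , refl = All.lookup i∉ i′∈ refl

  allEdges-ordered : All Ordered (allEdges n)
  allEdges-ordered = All.tabulate λ {e} e∈ → ordered (find (∈-concatMap⁻ row {xs = allFin n} e∈))
    where
    ordered : ∀ {e} → (∃ λ i → i ∈ allFin n × e ∈ row i) → Ordered e
    ordered (i , _ , e∈) with ∈-map⁻ (i ,_) e∈
    ... | j , j∈ , refl = proj₂ (∈-filter⁻ (λ j → toℕ i <? toℕ j) {xs = allFin n} j∈)

  allEdges-simple : Simple (allEdges n ++ [])
  allEdges-simple = subst Simple (sym (++-identityʳ (allEdges n))) (allEdges-ordered , allEdges-unique)

  private
    edge : ∀ {i j} → toℕ i < toℕ j → (i , j) ∈ allEdges n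
    edge {i} {j} h = ∈-concatMap⁺ row (lose (∈-allFin i) (∈-map⁺ (i ,_) (∈-filter⁺ (λ j → toℕ i <? toℕ j) (∈-allFin j) h)))

  allEdges-complete : ∀ {x y : Fin n} → x ≢ y → Adj (allEdges n) x y
  allEdges-complete {x} {y} x≢y with <-cmp (toℕ x) (toℕ y)
  ... | tri< x<y _ _ = inj₁ (edge x<y)
  ... | tri≈ _ x≡y _ = contradiction (toℕ-injective x≡y) x≢y
  ... | tri> _ _ y<x = inj₂ (edge y<x)

  initial : Position (allEdges n) []
  initial = record { simple = allEdges-simple ; free = λ { (inj₁ ()) ; (inj₂ ()) } }

lower-bound : ∀ m → B (2 + m) ≤ g (2 + m)
-- Nothing is threatened before the first move; `zero` is the centre `u`, hence never uncovered, and
-- serves as a dummy.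
lower-bound m = lower-constructor (length (allEdges (2 + m))) {x₀ = zero} (allEdges-simple (2 + m)) shape-[] refl
    (λ (x≢u , x≢v , _) → inj₁ (allEdges-complete (2 + m) (x≢u ∘ sym) , allEdges-complete (2 + m) (x≢v ∘ sym)))
  where open DoubleStar {2 + m} {m} {B (2 + m)} refl ≤-refl {zero} {suc zero} (λ ())

even-bound : ∀ M d → 2 * d ≤ suc (2 * M) → 2 * d ≤ 2 * M
even-bound M d h = *-monoʳ-≤ 2 {d} {M} (≮⇒≥ λ M<d →
  1+n≰n (≤-trans (≤-reflexive (sym (*-suc 2 M))) (≤-trans (*-monoʳ-≤ 2 M<d) h)))

-- Since `2 * ⌈ n /2⌉` is `n` or `n + 1`, the two bounds are the least even numbers from `100 + n`
-- and from `12 + n` on; the 12 is twice the six vertices touched in the opening. Then `suc N` is at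
-- most `n + 102`, that is `m + 104`, which fixes `S = 104`, and `104 * 104 + 104 = 10920`.
sizes : ∀ {n m} → n ≡ 2 + m → 10920 ≤ m → Sizes n m 104 (2 * (50 + ⌈ n /2⌉)) (2 * (6 + ⌈ n /2⌉)) (B n)
sizes {n} {m} n≡ hm = record
  { n≡ = n≡ ; S² = hm ; hS = ≤-trans (m≤m+n 224 10696) hm
  ; hP₁ = ≤-trans (+-monoʳ-≤ 12 n≤2c) (≤-reflexive (sym (*-distribˡ-+ 2 6 c)))
  ; hP₂ = ≤-trans (≤-reflexive (*-distribˡ-+ 2 6 c)) (≤-trans (+-monoʳ-≤ 12 2c≤n+1) (≤-reflexive (+-suc 12 n)))
  ; hN₁ = ≤-trans (+-monoʳ-≤ 100 n≤2c) (≤-reflexive (sym (*-distribˡ-+ 2 50 c)))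
  ; hN₂ = ≤-trans (s≤s (≤-trans (≤-reflexive (*-distribˡ-+ 2 50 c)) (+-monoʳ-≤ 100 2c≤n+1)))
                  (≤-reflexive (trans (cong (λ k → 101 + suc k) n≡) (+-comm 104 m)))
  ; evenP = even-bound (6 + c) ; evenN = even-bound (50 + c)
  ; hn = ≤-trans (≤-trans (m≤m+n 100 10820) hm) (≤-trans (m≤n+m m 2) (≤-reflexive (sym n≡)))
  ; B≤T = ≤-refl }
  where
  c : ℕ
  c = ⌈ n /2⌉
  n≤2c : n ≤ 2 * c
  n≤2c = ≤-trans (≤-reflexive (sym (⌊n/2⌋+⌈n/2⌉≡n n))) (+-mono-≤ (⌊n/2⌋≤⌈n/2⌉ n) (≤-reflexive (sym (+-identityʳ c))))
  2c≤n+1 : 2 * c ≤ suc n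
  2c≤n+1 = ≤-trans (+-mono-≤ (⌊n/2⌋-mono (n≤1+n (suc n))) (≤-reflexive (+-identityʳ c))) (≤-reflexive (cong suc (⌊n/2⌋+⌈n/2⌉≡n n)))

theorem1p3 : ∃ λ (n₀ : ℕ) → ∀ (n : ℕ) → n₀ ≤ n → g n ≡ B n
theorem1p3 = 10922 , λ n h → ≤-antisym (upper n h) (lower n h)
  where
  split : ∀ {n} → 10922 ≤ n → n ≡ 2 + (n ∸ 2)
  split h = sym (m+[n∸m]≡n (≤-trans (m≤m+n 2 10920) h))
  upper : ∀ n → 10922 ≤ n → g n ≤ B n
  upper n h = Strategy.upper-bound (sizes {n} {n ∸ 2} (split h) (∸-monoˡ-≤ 2 h)) (length (allEdges n)) (initial n)
  lower : ∀ n → 10922 ≤ n → B n ≤ g n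
  lower n h = subst (λ k → B k ≤ g k) (sym (split h)) (lower-bound (n ∸ 2))
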